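{- Let $a,b\ge0$ be given integers. Then there are polynomials $A(m,n,d)$ and $B(m,n,d)$ in $m$ and $n$ of total degree at most $2a+b$, with coefficients rational functions of $d$, such that $G^+_{d,m,a,b}(n)=A(m,n,d)M_d(n)+B(m,n,d)M_d(n+1)$.
   Context: For integers $d\ge1$, $n\ge0$ let $\mathcal{A}_{d,n}=\{(i,j):1\le i\le d,\ 1\le j\le n\}$. A subset $I\subseteq\mathcal{A}_{d,n}$ is nice if (1) $(i+1,j)\in I$ with $i\ge1$ implies $(i,j)\in I$, and (2) $(1,j)\in I$ with $1\le j\le n-1$ implies $(1,j+1)\notin I$. $\mathcal{B}^+_{d,n}$ is the set of nice subsets of $\mathcal{A}_{d,n}$. For $I$ nice, $|I|$ is its cardinality and $\sigma_m(I)=\sum_{(i,j)\in I}((i-1)m+j)$ for an integer $m\ge0$. Define $G^+_{d,m,a,b}(n)=\sum_{I\in\mathcal{B}^+_{d,n}}\sigma_m(I)^a|I|^b$ (with $0^0=1$). $M_d(n)$ is defined by $M_d(-1)=0$, $M_d(0)=1$, $M_d(n)=M_d(n-1)+dM_d(n-2)$ for $n\ge1$. -}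

module Defs where

open import Data.Bool using (Bool; true; false; _∧_; not; if_then_else_)
open import Data.Nat as ℕ using (ℕ; zero; suc; _∸_)
open import Data.List using (List; []; _∷_; map; upTo; concatMap; filter; foldr)
open import Data.Nat.ListAction using (sum)
open import Data.Vec using (Vec; []; _∷_)
open import Data.Rational as ℚ using (ℚ; 0ℚ; _≟_)
open import Relation.Nullary using (yes; no)
import Data.Integer
open import Relation.Nullary.Decidable using (T?)

-- A subset I of A_{d,n} encoded as a d×n Boolean matrix: row i (0-based) , column j (0-based)
-- stores whether (i+1, j+1) ∈ I.
Subset : ℕ → ℕ → Set
Subset d n = Vec (Vec Bool n) d

allVecs : (k : ℕ) → List (Vec Bool k)
allVecs zero = [] ∷ []
allVecs (suc k) = concatMap (λ v → (true ∷ v) ∷ (false ∷ v) ∷ []) (allVecs k)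

allVecsOf : {A : Set} → List A → (k : ℕ) → List (Vec A k)
allVecsOf xs zero = [] ∷ []
allVecsOf xs (suc k) = concatMap (λ v → map (λ x → x ∷ v) xs) (allVecsOf xs k)

allSubsets : (d n : ℕ) → List (Subset d n)
allSubsets d n = allVecsOf (allVecs n) d

-- 1-based lookup, false out of range
lookupB : {k : ℕ} → Vec Bool k → ℕ → Bool
lookupB [] _ = false
lookupB (x ∷ v) zero = false
lookupB (x ∷ v) (suc zero) = x
lookupB (x ∷ v) (suc (suc j)) = lookupB v (suc j)

-- mem I i j  ⇔  (i , j) ∈ I   (1-based indices)
mem : {d n : ℕ} → Subset d n → ℕ → ℕ → Bool
mem [] _ _ = false
mem (r ∷ I) zero j = false
mem (r ∷ I) (suc zero) j = lookupB r j
mem (r ∷ I) (suc (suc i)) j = mem I (suc i) j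

allB : {A : Set} → (A → Bool) → List A → Bool
allB p = foldr (λ x acc → p x ∧ acc) true

range1 : ℕ → List ℕ
range1 k = map suc (upTo k)

_⇒b_ : Bool → Bool → Bool
x ⇒b y = not x Data.Bool.∨ y

isNice : {d n : ℕ} → Subset d n → Bool
isNice {d} {n} I =
  allB (λ i → allB (λ j → mem I (suc i) j ⇒b mem I i j) (range1 n)) (range1 (d ∸ 1))
  ∧ allB (λ j → mem I 1 j ⇒b not (mem I 1 (suc j))) (range1 (n ∸ 1))

niceSubsets : (d n : ℕ) → List (Subset d n)
niceSubsets d n = filter (λ I → T? (isNice I)) (allSubsets d n)

sumOver : {d n : ℕ} → Subset d n → (ℕ → ℕ → ℕ) → ℕ
sumOver {d} {n} I f =
  sum (map (λ i → sum (map (λ j → if mem I i j then f i j else 0) (range1 n))) (range1 d))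

card : {d n : ℕ} → Subset d n → ℕ
card I = sumOver I (λ _ _ → 1)

σ : {d n : ℕ} → ℕ → Subset d n → ℕ
σ m I = sumOver I (λ i j → (i ∸ 1) ℕ.* m ℕ.+ j)

-- G^+_{d,m,a,b}(n)   (note 0 ^ 0 = 1 in Data.Nat)
G+ : (d m a b n : ℕ) → ℕ
G+ d m a b n = sum (map (λ I → (σ m I ℕ.^ a) ℕ.* (card I ℕ.^ b)) (niceSubsets d n))

-- M_d(n) for n ≥ 0  (M_d(-1) = 0, M_d(0) = 1, so M_d(1) = 1)
M : ℕ → ℕ → ℕ
M d zero = 1
M d (suc zero) = 1
M d (suc (suc n)) = M d (suc n) ℕ.+ d ℕ.* M d n

-- univariate polynomials over ℚ as coefficient lists (constant term first)
Poly : Set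
Poly = List ℚ

_^ℚ_ : ℚ → ℕ → ℚ
x ^ℚ zero = ℚ.1ℚ
x ^ℚ suc k = x ℚ.* (x ^ℚ k)

evalPoly : Poly → ℚ → ℚ
evalPoly p x = foldr (λ c acc → c ℚ.+ x ℚ.* acc) 0ℚ p

record RatFun : Set where
  constructor _//_
  field
    num : Poly
    den : Poly
open RatFun public

-- total inverse (junk value 0 at 0; never used under the nonvanishing hypotheses)
inv : ℚ → ℚ
inv q with q ≟ 0ℚ
... | yes _ = 0ℚ
... | no q≢0 = ℚ.1/_ q {{ℚ.≢-nonZero q≢0}}

evalRF : RatFun → ℚ → ℚ
evalRF r x = evalPoly (num r) x ℚ.* inv (evalPoly (den r) x)

-- a polynomial in m, n of total degree ≤ D with coefficients in ℚ(d):
-- given by coefficients c k l (of m^k n^l), only k + l ≤ D used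
evalPoly2 : ℕ → (ℕ → ℕ → RatFun) → ℚ → ℚ → ℚ → ℚ
evalPoly2 D c m n d =
  foldr ℚ._+_ 0ℚ (map (λ k → foldr ℚ._+_ 0ℚ
    (map (λ l → evalRF (c k l) d ℚ.* (m ^ℚ k) ℚ.* (n ^ℚ l)) (upTo (suc (D ∸ k)))))
    (upTo (suc D)))

toℚ : ℕ → ℚ
toℚ k = (Data.Integer.+ k) ℚ./ 1

-- Write T_{a,b}(n) = Σ_{I nice} σ(I)^a |I|^b.  Removing the first column of a nice subset
-- (it is empty or {1,…,h}) gives T(n+2) = T(n+1) + d·T(n) + h(n), where h combines moments
-- T_{a',b'} with 2a'+b' < 2a+b with coefficients polynomial in m and d (power sums Σ h^i
-- are polynomials in d).  Call f expressible of degree D if f(n) = Σ_j C(n,j)·(A_j M(n) +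
-- B_j M(n+1)) with deg A_j, deg B_j ≤ D - j in m.  The key lemma 'solve-recurrence' says
-- that a solution of g(n+2) = g(n+1) + d·g(n) + h(n) with h expressible of degree D is
-- expressible of degree D+1.  Induction on 2a+b makes T_{a,b} expressible of degree 2a+b,
-- and expanding each C(n,j) as a polynomial in n yields A and B.
module Submission where

open import Data.Bool using (Bool; true; false; _∧_; not; if_then_else_)
open import Data.Empty using (⊥-elim)
open import Data.Integer as ℤ using ()
import Data.Integer.Tactic.RingSolver as ℤ-Ring
open import Data.List using (List; []; _∷_; map; foldr; _++_; concatMap; upTo; applyUpTo; filter)
import Data.List.Properties as ListP
open import Data.Nat as ℕ using (ℕ; zero; suc; _∸_; _≤_; _<_; z≤n; s≤s; _≤′_; ≤′-refl; ≤′-step)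
open import Data.Nat.Coprimality as Coprime using (1-coprimeTo)
open import Data.Nat.ListAction using (sum)
import Data.Nat.Properties as ℕP
open import Data.Nat.Solver using (module +-*-Solver)
open +-*-Solver using (_:+_; _:=_) renaming (solve to nsolve)
open import Data.Product using (Σ; _,_; proj₁; proj₂; _×_)
open import Data.Rational as ℚ using (ℚ; mkℚ; 0ℚ; 1ℚ; _+_; _*_; -_; _-_; _≟_)
import Data.Rational.Properties as ℚP
import Data.Rational.Unnormalised as U
import Data.Rational.Unnormalised.Properties as UP
open import Data.Sum using (inj₁; inj₂)
open import Data.Vec using (Vec; []; _∷_)
open import Function using (_∘_)
open import Level using (0ℓ)
open import Relation.Binary.PropositionalEquality
open import Relation.Nullary using (yes; no; ¬_)
open import Relation.Nullary.Decidable using (T?)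
open import Relation.Nullary.Decidable.Core using (dec⇒maybe)
open import Tactic.RingSolver using (solve-∀)
open import Tactic.RingSolver.Core.AlmostCommutativeRing using (AlmostCommutativeRing; fromCommutativeRing)

open import Defs

R : AlmostCommutativeRing 0ℓ 0ℓ
R = fromCommutativeRing ℚP.+-*-commutativeRing (λ x → dec⇒maybe (0ℚ ℚP.≟ x))

-- The embedding toℚ : ℕ → ℚ of Defs is a semiring homomorphism.  First, toℚ k is the
-- normal form k/1 and 1 + k/1 = (k+1)/1 holds already for unnormalised fractions.
toℚ≡mkℚ : ∀ k → toℚ k ≡ mkℚ (ℤ.+ k) 0 (Coprime.sym (1-coprimeTo k))
toℚ≡mkℚ k = ℚP.normalize-coprime _

toℚᵘ-toℚ : ∀ k → ℚ.toℚᵘ (toℚ k) ≡ U.mkℚᵘ (ℤ.+ k) 0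
toℚᵘ-toℚ k = cong ℚ.toℚᵘ (toℚ≡mkℚ k)

toℚ-suc : ∀ k → toℚ (suc k) ≡ 1ℚ + toℚ k
toℚ-suc k = ℚP.toℚᵘ-injective (begin
  ℚ.toℚᵘ (toℚ (suc k))                    ≡⟨ toℚᵘ-toℚ (suc k) ⟩
  U.mkℚᵘ (ℤ.+ suc k) 0                    ≈⟨ U.*≡* (ring (ℤ.+ k)) ⟩
  ℚ.toℚᵘ 1ℚ U.+ U.mkℚᵘ (ℤ.+ k) 0          ≡⟨ cong (ℚ.toℚᵘ 1ℚ U.+_) (toℚᵘ-toℚ k) ⟨
  ℚ.toℚᵘ 1ℚ U.+ ℚ.toℚᵘ (toℚ k)            ≈⟨ ℚP.toℚᵘ-homo-+ 1ℚ (toℚ k) ⟨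
  ℚ.toℚᵘ (1ℚ + toℚ k)                     ∎)
  where
  open UP.≃-Reasoning
  ring : ∀ x → (ℤ.+ 1 ℤ.+ x) ℤ.* (ℤ.+ 1 ℤ.* ℤ.+ 1) ≡ (ℤ.+ 1 ℤ.* ℤ.+ 1 ℤ.+ x ℤ.* ℤ.+ 1) ℤ.* ℤ.+ 1
  ring = ℤ-Ring.solve-∀

toℚ-+ : ∀ a b → toℚ (a ℕ.+ b) ≡ toℚ a + toℚ b
toℚ-+ zero b = sym (ℚP.+-identityˡ (toℚ b))
toℚ-+ (suc a) b = begin
  toℚ (suc (a ℕ.+ b)) ≡⟨ toℚ-suc (a ℕ.+ b) ⟩
  1ℚ + toℚ (a ℕ.+ b) ≡⟨ cong (1ℚ +_) (toℚ-+ a b) ⟩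
  1ℚ + (toℚ a + toℚ b) ≡⟨ sym (ℚP.+-assoc 1ℚ (toℚ a) (toℚ b)) ⟩
  1ℚ + toℚ a + toℚ b ≡⟨ cong (_+ toℚ b) (sym (toℚ-suc a)) ⟩
  toℚ (suc a) + toℚ b ∎
  where open ≡-Reasoning

toℚ-* : ∀ a b → toℚ (a ℕ.* b) ≡ toℚ a * toℚ b
toℚ-* zero b = sym (ℚP.*-zeroˡ (toℚ b))
toℚ-* (suc a) b = begin
  toℚ (b ℕ.+ a ℕ.* b) ≡⟨ toℚ-+ b (a ℕ.* b) ⟩
  toℚ b + toℚ (a ℕ.* b) ≡⟨ cong (toℚ b +_) (toℚ-* a b) ⟩
  toℚ b + toℚ a * toℚ b ≡⟨ ring (toℚ a) (toℚ b) ⟩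
  (1ℚ + toℚ a) * toℚ b ≡⟨ cong (_* toℚ b) (sym (toℚ-suc a)) ⟩
  toℚ (suc a) * toℚ b ∎
  where
  open ≡-Reasoning
  ring : ∀ x y → y + x * y ≡ (1ℚ + x) * y
  ring = solve-∀ R

toℚ-^ : ∀ a b → toℚ (a ℕ.^ b) ≡ toℚ a ^ℚ b
toℚ-^ a zero = refl
toℚ-^ a (suc b) = trans (toℚ-* a (a ℕ.^ b)) (cong (toℚ a *_) (toℚ-^ a b))

^ℚ-+ : ∀ x a b → x ^ℚ (a ℕ.+ b) ≡ x ^ℚ a * x ^ℚ b
^ℚ-+ x zero b = sym (ℚP.*-identityˡ _)
^ℚ-+ x (suc a) b = trans (cong (x *_) (^ℚ-+ x a b)) (sym (ℚP.*-assoc x _ _))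

*-^ℚ : ∀ x y a → (x * y) ^ℚ a ≡ x ^ℚ a * y ^ℚ a
*-^ℚ x y zero = sym (ℚP.*-identityˡ 1ℚ)
*-^ℚ x y (suc a) = trans (cong ((x * y) *_) (*-^ℚ x y a)) (ring x y (x ^ℚ a) (y ^ℚ a))
  where
  ring : ∀ x y p q → (x * y) * (p * q) ≡ (x * p) * (y * q)
  ring = solve-∀ R

1^ℚ : ∀ a → 1ℚ ^ℚ a ≡ 1ℚ
1^ℚ zero = refl
1^ℚ (suc a) = trans (ℚP.*-identityˡ _) (1^ℚ a)

onlyIf : Bool → ℚ → ℚ
onlyIf true x = x
onlyIf false _ = 0ℚ

sumMap : {A : Set} → (A → ℚ) → List A → ℚ
sumMap f xs = foldr _+_ 0ℚ (map f xs)

sumMap-cong : {A : Set} {f g : A → ℚ} → (∀ x → f x ≡ g x) → ∀ xs → sumMap f xs ≡ sumMap g xs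
sumMap-cong e [] = refl
sumMap-cong e (x ∷ xs) = cong₂ _+_ (e x) (sumMap-cong e xs)

sumMap-+ : {A : Set} (f g : A → ℚ) → ∀ xs → sumMap (λ x → f x + g x) xs ≡ sumMap f xs + sumMap g xs
sumMap-+ f g [] = refl
sumMap-+ f g (x ∷ xs) = trans (cong ((f x + g x) +_) (sumMap-+ f g xs)) (ring (f x) (g x) _ _)
  where
  ring : ∀ a b c d → (a + b) + (c + d) ≡ (a + c) + (b + d)
  ring = solve-∀ R

sumMap-*ˡ : {A : Set} (c : ℚ) (f : A → ℚ) → ∀ xs → sumMap (λ x → c * f x) xs ≡ c * sumMap f xs
sumMap-*ˡ c f [] = sym (ℚP.*-zeroʳ c)
sumMap-*ˡ c f (x ∷ xs) = trans (cong ((c * f x) +_) (sumMap-*ˡ c f xs)) (sym (ℚP.*-distribˡ-+ c (f x) _))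

sumMap-0 : {A : Set} → ∀ (xs : List A) → sumMap (λ _ → 0ℚ) xs ≡ 0ℚ
sumMap-0 [] = refl
sumMap-0 (x ∷ xs) = trans (ℚP.+-identityˡ _) (sumMap-0 xs)

sumTo : ℕ → (ℕ → ℚ) → ℚ
sumTo zero f = 0ℚ
sumTo (suc n) f = sumTo n f + f n

sumTo-cong : ∀ n {f g : ℕ → ℚ} → (∀ i → i ℕ.< n → f i ≡ g i) → sumTo n f ≡ sumTo n g
sumTo-cong zero e = refl
sumTo-cong (suc n) e = cong₂ _+_ (sumTo-cong n (λ i i<n → e i (ℕP.m<n⇒m<1+n i<n))) (e n ℕP.≤-refl)

sumTo-+ : ∀ n (f g : ℕ → ℚ) → sumTo n (λ i → f i + g i) ≡ sumTo n f + sumTo n g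
sumTo-+ zero f g = refl
sumTo-+ (suc n) f g = trans (cong (_+ (f n + g n)) (sumTo-+ n f g)) (ring (sumTo n f) (sumTo n g) (f n) (g n))
  where
  ring : ∀ a b c d → (a + b) + (c + d) ≡ (a + c) + (b + d)
  ring = solve-∀ R

sumTo-*ˡ : ∀ n (c : ℚ) (f : ℕ → ℚ) → sumTo n (λ i → c * f i) ≡ c * sumTo n f
sumTo-*ˡ zero c f = sym (ℚP.*-zeroʳ c)
sumTo-*ˡ (suc n) c f = trans (cong (_+ (c * f n)) (sumTo-*ˡ n c f)) (sym (ℚP.*-distribˡ-+ c _ (f n)))

sumTo-0 : ∀ n → sumTo n (λ _ → 0ℚ) ≡ 0ℚ
sumTo-0 zero = refl
sumTo-0 (suc n) = trans (ℚP.+-identityʳ _) (sumTo-0 n)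

sumTo-front : ∀ n (f : ℕ → ℚ) → sumTo (suc n) f ≡ f 0 + sumTo n (f ∘ suc)
sumTo-front zero f = trans (ℚP.+-identityˡ (f 0)) (sym (ℚP.+-identityʳ (f 0)))
sumTo-front (suc n) f = trans (cong (_+ f (suc n)) (sumTo-front n f)) (ℚP.+-assoc (f 0) _ _)

sumTo-swap : ∀ n k (f : ℕ → ℕ → ℚ) → sumTo n (λ i → sumTo k (f i)) ≡ sumTo k (λ j → sumTo n (λ i → f i j))
sumTo-swap zero k f = sym (sumTo-0 k)
sumTo-swap (suc n) k f = trans (cong (_+ sumTo k (f n)) (sumTo-swap n k f)) (sym (sumTo-+ k (λ j → sumTo n (λ i → f i j)) (f n)))

sumTo-const : ∀ d c → sumTo d (λ _ → c) ≡ toℚ d * c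
sumTo-const zero c = sym (ℚP.*-zeroˡ c)
sumTo-const (suc d) c = trans (cong (_+ c) (sumTo-const d c)) (trans (ring (toℚ d) c) (cong (_* c) (sym (toℚ-suc d))))
  where
  ring : ∀ x c → x * c + c ≡ (1ℚ + x) * c
  ring = solve-∀ R

sumTo-product : ∀ N M (f g : ℕ → ℚ) → sumTo N f * sumTo M g ≡ sumTo N (λ i → sumTo M (λ j → f i * g j))
sumTo-product N M f g = trans (ℚP.*-comm (sumTo N f) (sumTo M g)) (trans (sym (sumTo-*ˡ N (sumTo M g) f))
  (sumTo-cong N (λ i _ → trans (ℚP.*-comm (sumTo M g) (f i)) (sym (sumTo-*ˡ M (f i) g)))))

sumMap-sumTo : {A : Set} (k : ℕ) (f : A → ℕ → ℚ) → ∀ xs → sumMap (λ x → sumTo k (f x)) xs ≡ sumTo k (λ j → sumMap (λ x → f x j) xs)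
sumMap-sumTo k f [] = sym (sumTo-0 k)
sumMap-sumTo k f (x ∷ xs) = trans (cong (sumTo k (f x) +_) (sumMap-sumTo k f xs)) (sym (sumTo-+ k (f x) (λ j → sumMap (λ x → f x j) xs)))

binom : ℕ → ℕ → ℕ
binom n zero = 1
binom zero (suc k) = 0
binom (suc n) (suc k) = binom n k ℕ.+ binom n (suc k)

binomℚ : ℕ → ℕ → ℚ
binomℚ n k = toℚ (binom n k)

binom-big : ∀ n k → n ℕ.< k → binom n k ≡ 0
binom-big zero (suc k) p = refl
binom-big (suc n) (suc k) (ℕ.s≤s p) = cong₂ ℕ._+_ (binom-big n k p) (binom-big n (suc k) (ℕP.m<n⇒m<1+n p))

binom-diag : ∀ n → binom n n ≡ 1
binom-diag zero = refl
binom-diag (suc n) = cong₂ ℕ._+_ (binom-diag n) (binom-big n (suc n) ℕP.≤-refl)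

binomℚ-suc : ∀ n k → binomℚ (suc n) (suc k) ≡ binomℚ n k + binomℚ n (suc k)
binomℚ-suc n k = toℚ-+ (binom n k) (binom n (suc k))

binomℚ-diag : ∀ a → binomℚ a a ≡ 1ℚ
binomℚ-diag a = cong toℚ (binom-diag a)

binomial-theorem : ∀ x y a → (x + y) ^ℚ a ≡ sumTo (suc a) (λ u → binomℚ a u * (x ^ℚ u * y ^ℚ (a ∸ u)))
binomial-theorem x y zero = refl
binomial-theorem x y (suc a) = begin
  (x + y) * (x + y) ^ℚ a
    ≡⟨ cong ((x + y) *_) (binomial-theorem x y a) ⟩
  (x + y) * sumTo (suc a) term
    ≡⟨ ℚP.*-distribʳ-+ (sumTo (suc a) term) x y ⟩
  x * sumTo (suc a) term + y * sumTo (suc a) term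
    ≡⟨ cong₂ _+_ (sym (sumTo-*ˡ (suc a) x term)) (sym (sumTo-*ˡ (suc a) y term)) ⟩
  sumTo (suc a) (λ u → x * term u) + sumTo (suc a) (λ u → y * term u)
    ≡⟨ cong₂ _+_ (sumTo-cong (suc a) (λ u _ → x-term u)) (sumTo-cong (suc a) y-term) ⟩
  sumTo (suc a) xTerm + sumTo (suc a) yTerm
    ≡⟨ cong (sumTo (suc a) xTerm +_) (trans (sym (ℚP.+-identityʳ _)) (cong (sumTo (suc a) yTerm +_) (sym yTerm-top))) ⟩
  sumTo (suc a) xTerm + sumTo (suc (suc a)) yTerm
    ≡⟨ cong (sumTo (suc a) xTerm +_) (sumTo-front (suc a) yTerm) ⟩
  sumTo (suc a) xTerm + (yTerm 0 + sumTo (suc a) (yTerm ∘ suc))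
    ≡⟨ ring (sumTo (suc a) xTerm) (yTerm 0) _ ⟩
  yTerm 0 + (sumTo (suc a) xTerm + sumTo (suc a) (yTerm ∘ suc))
    ≡⟨ cong (yTerm 0 +_) (sym (sumTo-+ (suc a) xTerm (yTerm ∘ suc))) ⟩
  yTerm 0 + sumTo (suc a) (λ u → xTerm u + yTerm (suc u))
    ≡⟨ cong (yTerm 0 +_) (sumTo-cong (suc a) (λ u _ → pascal-term u)) ⟩
  term′ 0 + sumTo (suc a) (term′ ∘ suc)
    ≡⟨ sym (sumTo-front (suc a) term′) ⟩
  sumTo (suc (suc a)) term′ ∎
  where
  open ≡-Reasoning
  term term′ xTerm yTerm : ℕ → ℚ
  term u = binomℚ a u * (x ^ℚ u * y ^ℚ (a ∸ u))
  term′ u = binomℚ (suc a) u * (x ^ℚ u * y ^ℚ (suc a ∸ u))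
  xTerm u = binomℚ a u * (x ^ℚ (suc u) * y ^ℚ (a ∸ u))
  yTerm u = binomℚ a u * (x ^ℚ u * y ^ℚ (suc a ∸ u))
  x-term : ∀ u → x * term u ≡ xTerm u
  x-term u = ring-x (binomℚ a u) x (x ^ℚ u) (y ^ℚ (a ∸ u))
    where
    ring-x : ∀ b x p q → x * (b * (p * q)) ≡ b * ((x * p) * q)
    ring-x = solve-∀ R
  y-term : ∀ u → u ℕ.< suc a → y * term u ≡ yTerm u
  y-term u (ℕ.s≤s u≤a) = trans (ring-y (binomℚ a u) y (x ^ℚ u) (y ^ℚ (a ∸ u)))
    (cong (λ z → binomℚ a u * (x ^ℚ u * y ^ℚ z)) (sym (ℕP.+-∸-assoc 1 u≤a)))
    where
    ring-y : ∀ b y p q → y * (b * (p * q)) ≡ b * (p * (y * q))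
    ring-y = solve-∀ R
  yTerm-top : yTerm (suc a) ≡ 0ℚ
  yTerm-top = trans (cong (λ z → toℚ z * (x ^ℚ suc a * y ^ℚ (suc a ∸ suc a))) (binom-big a (suc a) ℕP.≤-refl))
                    (ℚP.*-zeroˡ (x ^ℚ suc a * y ^ℚ (a ∸ a)))
  pascal-term : ∀ u → xTerm u + yTerm (suc u) ≡ term′ (suc u)
  pascal-term u = trans (sym (ℚP.*-distribʳ-+ (x ^ℚ suc u * y ^ℚ (a ∸ u)) (binomℚ a u) (binomℚ a (suc u))))
                        (cong (_* (x ^ℚ suc u * y ^ℚ (a ∸ u))) (sym (binomℚ-suc a u)))
  ring : ∀ p q r → p + (q + r) ≡ q + (p + r)
  ring = solve-∀ R

sumMap-++ : {A : Set} (f : A → ℚ) (xs ys : List A) → sumMap f (xs ++ ys) ≡ sumMap f xs + sumMap f ys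
sumMap-++ f [] ys = sym (ℚP.+-identityˡ _)
sumMap-++ f (x ∷ xs) ys = trans (cong (f x +_) (sumMap-++ f xs ys)) (sym (ℚP.+-assoc (f x) _ _))

sumMap-concatMap : {A B : Set} (f : B → ℚ) (g : A → List B) (xs : List A) → sumMap f (concatMap g xs) ≡ sumMap (λ x → sumMap f (g x)) xs
sumMap-concatMap f g [] = refl
sumMap-concatMap f g (x ∷ xs) = trans (sumMap-++ f (g x) (concatMap g xs)) (cong (sumMap f (g x) +_) (sumMap-concatMap f g xs))

sumMap-map : {A B : Set} (f : B → ℚ) (g : A → B) (xs : List A) → sumMap f (map g xs) ≡ sumMap (f ∘ g) xs
sumMap-map f g [] = refl
sumMap-map f g (x ∷ xs) = cong (f (g x) +_) (sumMap-map f g xs)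

sumMap-swap : {A B : Set} (f : A → B → ℚ) (xs : List A) (ys : List B) → sumMap (λ x → sumMap (f x) ys) xs ≡ sumMap (λ y → sumMap (λ x → f x y) xs) ys
sumMap-swap f [] ys = sym (sumMap-0 ys)
sumMap-swap f (x ∷ xs) ys = trans (cong (sumMap (f x) ys +_) (sumMap-swap f xs ys)) (sym (sumMap-+ (f x) (λ y → sumMap (λ x → f x y) xs) ys))

sumMap-allVecsOf : {A : Set} (xs : List A) (k : ℕ) (Φ : Vec A (suc k) → ℚ) → sumMap Φ (allVecsOf xs (suc k)) ≡ sumMap (λ v → sumMap (λ x → Φ (x ∷ v)) xs) (allVecsOf xs k)
sumMap-allVecsOf xs k Φ = trans (sumMap-concatMap Φ _ (allVecsOf xs k)) (sumMap-cong (λ v → sumMap-map Φ (λ x → x ∷ v) xs) (allVecsOf xs k))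

sumMap-allVecs : (k : ℕ) (Φ : Vec Bool (suc k) → ℚ) → sumMap Φ (allVecs (suc k)) ≡ sumMap (λ v → Φ (true ∷ v) + Φ (false ∷ v)) (allVecs k)
sumMap-allVecs k Φ = trans (sumMap-concatMap Φ _ (allVecs k)) (sumMap-cong (λ v → cong (Φ (true ∷ v) +_) (ℚP.+-identityʳ _)) (allVecs k))

prependColumn : ∀ {d n} → Vec Bool d → Subset d n → Subset d (suc n)
prependColumn [] [] = []
prependColumn (b ∷ c) (r ∷ I) = (b ∷ r) ∷ prependColumn c I

sumMap-allSubsets-suc : ∀ d n (Φ : Subset d (suc n) → ℚ) → sumMap Φ (allSubsets d (suc n)) ≡ sumMap (λ I → sumMap (λ c → Φ (prependColumn c I)) (allVecs d)) (allSubsets d n)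
sumMap-allSubsets-suc zero n Φ = sym (ℚP.+-identityʳ (Φ [] + 0ℚ))
sumMap-allSubsets-suc (suc d) n Φ = begin
  sumMap Φ (allVecsOf (allVecs (suc n)) (suc d)) ≡⟨ sumMap-allVecsOf (allVecs (suc n)) d Φ ⟩
  sumMap (λ v → sumMap (λ r → Φ (r ∷ v)) (allVecs (suc n))) (allSubsets d (suc n)) ≡⟨ sumMap-allSubsets-suc d n _ ⟩
  sumMap (λ I → sumMap (λ c → sumMap (λ r → Φ (r ∷ prependColumn c I)) (allVecs (suc n))) (allVecs d)) (allSubsets d n)
     ≡⟨ sumMap-cong (λ I → sumMap-cong (λ c → sumMap-allVecs n (λ r → Φ (r ∷ prependColumn c I))) (allVecs d)) (allSubsets d n) ⟩
  sumMap (λ I → sumMap (λ c → sumMap (λ r → Φ ((true ∷ r) ∷ prependColumn c I) + Φ ((false ∷ r) ∷ prependColumn c I)) (allVecs n)) (allVecs d)) (allSubsets d n)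
     ≡⟨ sumMap-cong (λ I → sumMap-swap (λ c r → Φ ((true ∷ r) ∷ prependColumn c I) + Φ ((false ∷ r) ∷ prependColumn c I)) (allVecs d) (allVecs n)) (allSubsets d n) ⟩
  sumMap (λ I → sumMap (λ r → sumMap (λ c → Φ ((true ∷ r) ∷ prependColumn c I) + Φ ((false ∷ r) ∷ prependColumn c I)) (allVecs d)) (allVecs n)) (allSubsets d n)
     ≡⟨ sumMap-cong (λ I → sumMap-cong (λ r → sym (sumMap-allVecs d (λ c → Φ (prependColumn c (r ∷ I))))) (allVecs n)) (allSubsets d n) ⟩
  sumMap (λ I → sumMap (λ r → sumMap (λ c → Φ (prependColumn c (r ∷ I))) (allVecs (suc d))) (allVecs n)) (allSubsets d n)
     ≡⟨ sym (sumMap-allVecsOf (allVecs n) d (λ Jc → sumMap (λ c → Φ (prependColumn c Jc)) (allVecs (suc d)))) ⟩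
  sumMap (λ Jc → sumMap (λ c → Φ (prependColumn c Jc)) (allVecs (suc d))) (allSubsets (suc d) n) ∎
  where open ≡-Reasoning

applyUpTo-map : {A : Set} (f : ℕ → A) (n : ℕ) → applyUpTo f n ≡ map f (upTo n)
applyUpTo-map f zero = refl
applyUpTo-map f (suc n) = cong (f 0 ∷_) (trans (applyUpTo-map (f ∘ suc) n) (trans (ListP.map-∘ (upTo n)) (cong (map f) (sym (applyUpTo-map suc n)))))

range1-suc : ∀ n → range1 (suc n) ≡ 1 ∷ map suc (range1 n)
range1-suc n = cong (λ z → 1 ∷ map suc z) (applyUpTo-map suc n)

allB-map : {A B : Set} (p : B → Bool) (f : A → B) (xs : List A) → allB p (map f xs) ≡ allB (p ∘ f) xs
allB-map p f [] = refl
allB-map p f (x ∷ xs) = cong (p (f x) ∧_) (allB-map p f xs)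

allB-cong : {A : Set} {p q : A → Bool} → (∀ x → p x ≡ q x) → (xs : List A) → allB p xs ≡ allB q xs
allB-cong e [] = refl
allB-cong e (x ∷ xs) = cong₂ _∧_ (e x) (allB-cong e xs)

∧-shuffle : ∀ a b c e → (a ∧ b) ∧ (c ∧ e) ≡ (a ∧ c) ∧ (b ∧ e)
∧-shuffle true true c e = refl
∧-shuffle true false true e = refl
∧-shuffle true false false e = refl
∧-shuffle false b c e = refl

allB-∧ : {A : Set} (p q : A → Bool) (xs : List A) → allB (λ x → p x ∧ q x) xs ≡ allB p xs ∧ allB q xs
allB-∧ p q [] = refl
allB-∧ p q (x ∷ xs) = trans (cong ((p x ∧ q x) ∧_) (allB-∧ p q xs)) (∧-shuffle (p x) (q x) _ _)

mem-prepend-first : ∀ {d n} (c : Vec Bool d) (I : Subset d n) i → mem (prependColumn c I) i 1 ≡ lookupB c i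
mem-prepend-first [] [] i = refl
mem-prepend-first (b ∷ c) (r ∷ I) zero = refl
mem-prepend-first (b ∷ c) (r ∷ I) (suc zero) = refl
mem-prepend-first (b ∷ c) (r ∷ I) (suc (suc i)) = mem-prepend-first c I (suc i)

mem-prepend-later : ∀ {d n} (c : Vec Bool d) (I : Subset d n) i j → mem (prependColumn c I) i (suc (suc j)) ≡ mem I i (suc j)
mem-prepend-later [] [] i j = refl
mem-prepend-later (b ∷ c) (r ∷ I) zero j = refl
mem-prepend-later (b ∷ c) (r ∷ I) (suc zero) j = refl
mem-prepend-later (b ∷ c) (r ∷ I) (suc (suc i)) j = mem-prepend-later c I (suc i) j

lookupB-empty : (v : Vec Bool 0) → ∀ j → lookupB v j ≡ false
lookupB-empty [] j = refl

mem-noColumns : ∀ {d} (I : Subset d 0) i j → mem I i j ≡ false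
mem-noColumns [] i j = refl
mem-noColumns (r ∷ I) zero j = refl
mem-noColumns (r ∷ I) (suc zero) j = lookupB-empty r j
mem-noColumns (r ∷ I) (suc (suc i)) j = mem-noColumns I (suc i) j

columnsNested : ∀ {d n} → Subset d n → Bool
columnsNested {d} {n} I = allB (λ i → allB (λ j → mem I (suc i) j ⇒b mem I i j) (range1 n)) (range1 (d ∸ 1))

rowOneSparse : ∀ {d n} → Subset d n → Bool
rowOneSparse {d} {n} I = allB (λ j → mem I 1 j ⇒b not (mem I 1 (suc j))) (range1 (n ∸ 1))

downClosed : ∀ {d} → Vec Bool d → Bool
downClosed {d} c = allB (λ i → lookupB c (suc i) ⇒b lookupB c i) (range1 (d ∸ 1))

columnsNested-prepend : ∀ {d n} (c : Vec Bool d) (I : Subset d n) → columnsNested (prependColumn c I) ≡ downClosed c ∧ columnsNested I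
columnsNested-prepend {d} {n} c I = begin
  columnsNested (prependColumn c I) ≡⟨ allB-cong inner (range1 (d ∸ 1)) ⟩
  allB (λ i → (lookupB c (suc i) ⇒b lookupB c i) ∧ allB (λ j → mem I (suc i) j ⇒b mem I i j) (range1 n)) (range1 (d ∸ 1))
     ≡⟨ allB-∧ _ _ (range1 (d ∸ 1)) ⟩
  downClosed c ∧ columnsNested I ∎
  where
  open ≡-Reasoning
  Jc = prependColumn c I
  inner : ∀ i → allB (λ j → mem Jc (suc i) j ⇒b mem Jc i j) (range1 (suc n)) ≡ (lookupB c (suc i) ⇒b lookupB c i) ∧ allB (λ j → mem I (suc i) j ⇒b mem I i j) (range1 n)
  inner i = begin
    allB (λ j → mem Jc (suc i) j ⇒b mem Jc i j) (range1 (suc n)) ≡⟨ cong (allB (λ j → mem Jc (suc i) j ⇒b mem Jc i j)) (range1-suc n) ⟩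
    (mem Jc (suc i) 1 ⇒b mem Jc i 1) ∧ allB (λ j → mem Jc (suc i) j ⇒b mem Jc i j) (map suc (map suc (upTo n)))
      ≡⟨ cong₂ _∧_ (cong₂ _⇒b_ (mem-prepend-first c I (suc i)) (mem-prepend-first c I i)) (trans (allB-map _ suc (map suc (upTo n))) (trans (allB-map _ suc (upTo n)) (allB-cong (λ k → cong₂ _⇒b_ (mem-prepend-later c I (suc i) k) (mem-prepend-later c I i k)) (upTo n)))) ⟩
    (lookupB c (suc i) ⇒b lookupB c i) ∧ allB (λ k → mem I (suc i) (suc k) ⇒b mem I i (suc k)) (upTo n)
      ≡⟨ cong ((lookupB c (suc i) ⇒b lookupB c i) ∧_) (sym (allB-map _ suc (upTo n))) ⟩
    (lookupB c (suc i) ⇒b lookupB c i) ∧ allB (λ j → mem I (suc i) j ⇒b mem I i j) (range1 n) ∎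

rowOneSparse-prepend : ∀ {d n} (c : Vec Bool d) (I : Subset d n) → rowOneSparse (prependColumn c I) ≡ (lookupB c 1 ⇒b not (mem I 1 1)) ∧ rowOneSparse I
rowOneSparse-prepend {d} {zero} c I rewrite mem-noColumns I 1 1 with lookupB c 1
... | true = refl
... | false = refl
rowOneSparse-prepend {d} {suc n} c I = begin
  allB (λ j → mem Jc 1 j ⇒b not (mem Jc 1 (suc j))) (range1 (suc n)) ≡⟨ cong (allB (λ j → mem Jc 1 j ⇒b not (mem Jc 1 (suc j)))) (range1-suc n) ⟩
  (mem Jc 1 1 ⇒b not (mem Jc 1 2)) ∧ allB (λ j → mem Jc 1 j ⇒b not (mem Jc 1 (suc j))) (map suc (map suc (upTo n)))
    ≡⟨ cong₂ _∧_ (cong₂ _⇒b_ (mem-prepend-first c I 1) (cong not (mem-prepend-later c I 1 0))) (trans (allB-map _ suc (map suc (upTo n))) (trans (allB-map _ suc (upTo n)) (allB-cong (λ k → cong₂ _⇒b_ (mem-prepend-later c I 1 k) (cong not (mem-prepend-later c I 1 (suc k)))) (upTo n)))) ⟩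
  (lookupB c 1 ⇒b not (mem I 1 1)) ∧ allB (λ k → mem I 1 (suc k) ⇒b not (mem I 1 (suc (suc k)))) (upTo n)
    ≡⟨ cong ((lookupB c 1 ⇒b not (mem I 1 1)) ∧_) (sym (allB-map _ suc (upTo n))) ⟩
  (lookupB c 1 ⇒b not (mem I 1 1)) ∧ rowOneSparse I ∎
  where
  open ≡-Reasoning
  Jc = prependColumn c I

isNice-prepend : ∀ {d n} (c : Vec Bool d) (I : Subset d n) → isNice (prependColumn c I) ≡ (downClosed c ∧ columnsNested I) ∧ ((lookupB c 1 ⇒b not (mem I 1 1)) ∧ rowOneSparse I)
isNice-prepend c I = cong₂ _∧_ (columnsNested-prepend c I) (rowOneSparse-prepend c I)

sumℕ-cong : {A : Set} {f g : A → ℕ} → (∀ x → f x ≡ g x) → ∀ xs → sum (map f xs) ≡ sum (map g xs)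
sumℕ-cong e [] = refl
sumℕ-cong e (x ∷ xs) = cong₂ ℕ._+_ (e x) (sumℕ-cong e xs)

sumℕ-+ : {A : Set} (f g : A → ℕ) → ∀ xs → sum (map (λ x → f x ℕ.+ g x) xs) ≡ sum (map f xs) ℕ.+ sum (map g xs)
sumℕ-+ f g [] = refl
sumℕ-+ f g (x ∷ xs) rewrite sumℕ-+ f g xs = ring (f x) (g x) (sum (map f xs)) (sum (map g xs))
  where
  ring : ∀ a b c e → a ℕ.+ b ℕ.+ (c ℕ.+ e) ≡ a ℕ.+ c ℕ.+ (b ℕ.+ e)
  ring = nsolve 4 (λ a b c e → a :+ b :+ (c :+ e) := a :+ c :+ (b :+ e)) refl

sumℕ-*ʳ : {A : Set} (f : A → ℕ) (k : ℕ) → ∀ xs → sum (map (λ x → f x ℕ.* k) xs) ≡ sum (map f xs) ℕ.* k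
sumℕ-*ʳ f k [] = refl
sumℕ-*ʳ f k (x ∷ xs) rewrite sumℕ-*ʳ f k xs = sym (ℕP.*-distribʳ-+ k (f x) _)

sumℕ-map : {A B : Set} (f : B → ℕ) (g : A → B) → ∀ xs → sum (map f (map g xs)) ≡ sum (map (f ∘ g) xs)
sumℕ-map f g xs = cong sum (sym (ListP.map-∘ xs))

ifℕ : Bool → ℕ → ℕ
ifℕ b x = if b then x else 0

ifℕ-+ : ∀ b x y → ifℕ b (x ℕ.+ y) ≡ ifℕ b x ℕ.+ ifℕ b y
ifℕ-+ true x y = refl
ifℕ-+ false x y = refl

-- Sums over the cells of a single column c ∈ {0,1}^d; 'columnSize' counts them and
-- 'columnWeight' is their contribution Σ ((i-1)m + 1) to σ when c is column 1.
columnSum : ∀ {d} → Vec Bool d → (ℕ → ℕ) → ℕ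
columnSum {d} c g = sum (map (λ i → ifℕ (lookupB c i) (g i)) (range1 d))

columnSum-cons : ∀ {d} (b : Bool) (v : Vec Bool d) g → columnSum (b ∷ v) g ≡ ifℕ b (g 1) ℕ.+ columnSum v (g ∘ suc)
columnSum-cons {d} b v g = begin
  sum (map (λ i → ifℕ (lookupB (b ∷ v) i) (g i)) (range1 (suc d))) ≡⟨ cong (λ z → sum (map (λ i → ifℕ (lookupB (b ∷ v) i) (g i)) z)) (range1-suc d) ⟩
  ifℕ b (g 1) ℕ.+ sum (map (λ i → ifℕ (lookupB (b ∷ v) i) (g i)) (map suc (map suc (upTo d))))
     ≡⟨ cong (ifℕ b (g 1) ℕ.+_) (trans (sumℕ-map _ suc (map suc (upTo d))) (trans (sumℕ-map _ suc (upTo d)) (sym (sumℕ-map _ suc (upTo d))))) ⟩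
  ifℕ b (g 1) ℕ.+ columnSum v (g ∘ suc) ∎
  where open ≡-Reasoning

columnSum-+ : ∀ {d} (v : Vec Bool d) g h → columnSum v (λ i → g i ℕ.+ h i) ≡ columnSum v g ℕ.+ columnSum v h
columnSum-+ {d} v g h = trans (sumℕ-cong (λ i → ifℕ-+ (lookupB v i) (g i) (h i)) (range1 d)) (sumℕ-+ _ _ (range1 d))

columnSum-cong : ∀ {d} (v : Vec Bool d) {g h} → (∀ i → g (suc i) ≡ h (suc i)) → columnSum v g ≡ columnSum v h
columnSum-cong {d} v e = trans (sumℕ-map _ suc (upTo d)) (trans (sumℕ-cong (λ k → cong (ifℕ (lookupB v (suc k))) (e k)) (upTo d)) (sym (sumℕ-map _ suc (upTo d))))

columnSize : ∀ {d} → Vec Bool d → ℕ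
columnSize c = columnSum c (λ _ → 1)

columnWeight : ∀ {d} → ℕ → Vec Bool d → ℕ
columnWeight m c = columnSum c (λ i → (i ∸ 1) ℕ.* m ℕ.+ 1)

columnSum-const : ∀ {d} (v : Vec Bool d) k → columnSum v (λ _ → k) ≡ columnSize v ℕ.* k
columnSum-const {d} v k = trans (sumℕ-cong (λ i → ifℕ-const (lookupB v i)) (range1 d)) (sumℕ-*ʳ _ k (range1 d))
  where
  ifℕ-const : ∀ b → ifℕ b k ≡ ifℕ b 1 ℕ.* k
  ifℕ-const true = sym (ℕP.+-identityʳ k)
  ifℕ-const false = refl

columnSize-cons : ∀ {d} b (v : Vec Bool d) → columnSize (b ∷ v) ≡ ifℕ b 1 ℕ.+ columnSize v
columnSize-cons b v = columnSum-cons b v (λ _ → 1)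

-- Removing the top cell of a column: each remaining cell moves up a row, which
-- lowers its weight by m.
columnWeight-cons : ∀ {d} m b (v : Vec Bool d) → columnWeight m (b ∷ v) ≡ ifℕ b 1 ℕ.+ (columnWeight m v ℕ.+ columnSize v ℕ.* m)
columnWeight-cons m b v = trans (columnSum-cons b v _) (cong (ifℕ b 1 ℕ.+_) (trans (columnSum-cong v (λ i → row-shift i)) (trans (columnSum-+ v _ (λ _ → m)) (cong (columnWeight m v ℕ.+_) (columnSum-const v m)))))
  where
  row-shift : ∀ i → suc i ℕ.* m ℕ.+ 1 ≡ (i ℕ.* m ℕ.+ 1) ℕ.+ m
  row-shift i = trans (cong (ℕ._+ 1) (ℕP.+-comm m (i ℕ.* m))) (trans (ℕP.+-assoc (i ℕ.* m) m 1) (trans (cong (i ℕ.* m ℕ.+_) (ℕP.+-comm m 1)) (sym (ℕP.+-assoc (i ℕ.* m) 1 m))))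

downClosed-cons : ∀ {d} b (v : Vec Bool d) → downClosed (b ∷ v) ≡ (lookupB v 1 ⇒b b) ∧ downClosed v
downClosed-cons {zero} b [] = refl
downClosed-cons {suc d} b v = begin
  allB (λ i → lookupB (b ∷ v) (suc i) ⇒b lookupB (b ∷ v) i) (range1 (suc d)) ≡⟨ cong (allB (λ i → lookupB (b ∷ v) (suc i) ⇒b lookupB (b ∷ v) i)) (range1-suc d) ⟩
  (lookupB v 1 ⇒b b) ∧ allB (λ i → lookupB (b ∷ v) (suc i) ⇒b lookupB (b ∷ v) i) (map suc (map suc (upTo d)))
    ≡⟨ cong ((lookupB v 1 ⇒b b) ∧_) (trans (allB-map _ suc (map suc (upTo d))) (trans (allB-map _ suc (upTo d)) (sym (allB-map _ suc (upTo d))))) ⟩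
  (lookupB v 1 ⇒b b) ∧ downClosed v ∎
  where open ≡-Reasoning

-- α_m(h) = Σ_{i=1}^{h} ((i-1)m + 1) = h + m·h(h-1)/2: the weight of the column
-- {1, …, h} placed in column 1.
fullColumnWeight : ℕ → ℕ → ℕ
fullColumnWeight m zero = 0
fullColumnWeight m (suc k) = suc (fullColumnWeight m k ℕ.+ k ℕ.* m)

onlyIf-⇒true : ∀ x y z → onlyIf ((x ⇒b true) ∧ y) z ≡ onlyIf y z
onlyIf-⇒true true y z = refl
onlyIf-⇒true false y z = refl

onlyIf-⇒false : ∀ x y z → onlyIf ((x ⇒b false) ∧ y) z ≡ onlyIf y (onlyIf (not x) z)
onlyIf-⇒false true true z = refl
onlyIf-⇒false true false z = refl
onlyIf-⇒false false true z = refl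
onlyIf-⇒false false false z = refl

-- The down-closed columns of height d are ∅ and {1..h} for 1 ≤ h ≤ d, so a sum over
-- down-closed columns is the empty-column term plus a sum over h.
sum-downClosedColumns : ∀ m d (Ψ : Bool → ℕ → ℕ → ℚ) → sumMap (λ c → onlyIf (downClosed c) (Ψ (lookupB c 1) (columnWeight m c) (columnSize c))) (allVecs d) ≡ Ψ false 0 0 + sumTo d (λ h → Ψ true (fullColumnWeight m (suc h)) (suc h))
sum-downClosedColumns m zero Ψ = refl
sum-downClosedColumns m (suc d) Ψ = begin
  sumMap summand (allVecs (suc d)) ≡⟨ sumMap-allVecs d summand ⟩
  sumMap (λ v → summand (true ∷ v) + summand (false ∷ v)) (allVecs d) ≡⟨ sumMap-cong (λ v → cong₂ _+_ (top-in v) (top-out v)) (allVecs d) ⟩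
  sumMap (λ v → withTop v + withoutTop v) (allVecs d) ≡⟨ sumMap-+ withTop withoutTop (allVecs d) ⟩
  sumMap withTop (allVecs d) + sumMap withoutTop (allVecs d) ≡⟨ cong₂ _+_ (sum-downClosedColumns m d Ψ-top) (sum-downClosedColumns m d Ψ-noTop) ⟩
  (Ψ true 1 1 + sumTo d (λ h → Ψ true (fullColumnWeight m (suc (suc h))) (suc (suc h)))) + (Ψ false 0 0 + sumTo d (λ _ → 0ℚ))
    ≡⟨ cong (λ z → (Ψ true 1 1 + sumTo d (λ h → Ψ true (fullColumnWeight m (suc (suc h))) (suc (suc h)))) + (Ψ false 0 0 + z)) (sumTo-0 d) ⟩
  (Ψ true 1 1 + rest) + (Ψ false 0 0 + 0ℚ) ≡⟨ ring (Ψ true 1 1) rest (Ψ false 0 0) ⟩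
  Ψ false 0 0 + (Ψ true 1 1 + rest) ≡⟨ cong (Ψ false 0 0 +_) (sym (sumTo-front d (λ h → Ψ true (fullColumnWeight m (suc h)) (suc h)))) ⟩
  Ψ false 0 0 + sumTo (suc d) (λ h → Ψ true (fullColumnWeight m (suc h)) (suc h)) ∎
  where
  open ≡-Reasoning
  summand = λ (c : Vec Bool (suc d)) → onlyIf (downClosed c) (Ψ (lookupB c 1) (columnWeight m c) (columnSize c))
  Ψ-top : Bool → ℕ → ℕ → ℚ
  Ψ-top x s k = Ψ true (suc (s ℕ.+ k ℕ.* m)) (suc k)
  Ψ-noTop : Bool → ℕ → ℕ → ℚ
  Ψ-noTop x s k = onlyIf (not x) (Ψ false (s ℕ.+ k ℕ.* m) k)
  withTop = λ (v : Vec Bool d) → onlyIf (downClosed v) (Ψ-top (lookupB v 1) (columnWeight m v) (columnSize v))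
  withoutTop = λ (v : Vec Bool d) → onlyIf (downClosed v) (Ψ-noTop (lookupB v 1) (columnWeight m v) (columnSize v))
  rest = sumTo d (λ h → Ψ true (fullColumnWeight m (suc (suc h))) (suc (suc h)))
  top-in : ∀ v → summand (true ∷ v) ≡ withTop v
  top-in v rewrite downClosed-cons true v | columnWeight-cons m true v | columnSize-cons true v = onlyIf-⇒true (lookupB v 1) (downClosed v) _
  top-out : ∀ v → summand (false ∷ v) ≡ withoutTop v
  top-out v rewrite downClosed-cons false v | columnWeight-cons m false v | columnSize-cons false v = onlyIf-⇒false (lookupB v 1) (downClosed v) _
  ring : ∀ a b c → (a + b) + (c + 0ℚ) ≡ c + (a + b)
  ring = solve-∀ R

sumOver-cong : ∀ {d n} (I : Subset d n) {f g : ℕ → ℕ → ℕ} → (∀ i j → f i j ≡ g i j) → sumOver I f ≡ sumOver I g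
sumOver-cong {d} {n} I e = sumℕ-cong (λ i → sumℕ-cong (λ j → cong (ifℕ (mem I i j)) (e i j)) (range1 n)) (range1 d)

sumOver-+ : ∀ {d n} (I : Subset d n) (f g : ℕ → ℕ → ℕ) → sumOver I (λ i j → f i j ℕ.+ g i j) ≡ sumOver I f ℕ.+ sumOver I g
sumOver-+ {d} {n} I f g = trans (sumℕ-cong (λ i → trans (sumℕ-cong (λ j → ifℕ-+ (mem I i j) (f i j) (g i j)) (range1 n)) (sumℕ-+ _ _ (range1 n))) (range1 d)) (sumℕ-+ _ _ (range1 d))

sumOver-prepend : ∀ {d n} (c : Vec Bool d) (I : Subset d n) f → sumOver (prependColumn c I) f ≡ columnSum c (λ i → f i 1) ℕ.+ sumOver I (λ i j → f i (suc j))
sumOver-prepend {d} {n} c I f = trans (sumℕ-cong inner (range1 d)) (sumℕ-+ _ _ (range1 d))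
  where
  Jc = prependColumn c I
  inner : ∀ i → sum (map (λ j → ifℕ (mem Jc i j) (f i j)) (range1 (suc n))) ≡ ifℕ (lookupB c i) (f i 1) ℕ.+ sum (map (λ j → ifℕ (mem I i j) (f i (suc j))) (range1 n))
  inner i = trans (cong (λ z → sum (map (λ j → ifℕ (mem Jc i j) (f i j)) z)) (range1-suc n))
                  (cong₂ ℕ._+_ (cong (λ z → ifℕ z (f i 1)) (mem-prepend-first c I i))
                    (trans (sumℕ-map _ suc (map suc (upTo n))) (trans (sumℕ-map _ suc (upTo n))
                      (trans (sumℕ-cong (λ k → cong (λ z → ifℕ z (f i (suc (suc k)))) (mem-prepend-later c I i k)) (upTo n)) (sym (sumℕ-map _ suc (upTo n)))))))

card-prepend : ∀ {d n} (c : Vec Bool d) (I : Subset d n) → card (prependColumn c I) ≡ columnSize c ℕ.+ card I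
card-prepend c I = sumOver-prepend c I (λ _ _ → 1)

-- σ(c | I) = weight(c) + σ(I) + |I|, since shifting I one column right adds 1 to
-- the weight of each of its cells.
σ-prepend : ∀ {d n} m (c : Vec Bool d) (I : Subset d n) → σ m (prependColumn c I) ≡ columnWeight m c ℕ.+ (σ m I ℕ.+ card I)
σ-prepend m c I = trans (sumOver-prepend c I _) (cong (columnWeight m c ℕ.+_) (trans (sumOver-cong I column-shift) (sumOver-+ I _ (λ _ _ → 1))))
  where
  column-shift : ∀ i j → (i ∸ 1) ℕ.* m ℕ.+ suc j ≡ ((i ∸ 1) ℕ.* m ℕ.+ j) ℕ.+ 1
  column-shift i j = trans (ℕP.+-suc _ j) (sym (ℕP.+-comm _ 1))

niceSum : ℕ → ℕ → (ℕ → ℕ → ℚ) → ℕ → ℚ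
niceSum d m F n = sumMap (λ I → onlyIf (isNice I) (F (σ m I) (card I))) (allSubsets d n)

niceSum′ : ℕ → ℕ → (ℕ → ℕ → ℚ) → ℕ → ℚ
niceSum′ d m F n = sumMap (λ I → onlyIf (isNice I ∧ not (mem I 1 1)) (F (σ m I) (card I))) (allSubsets d n)

onlyIf-split-nice : ∀ a b c e x → onlyIf ((a ∧ b) ∧ (c ∧ e)) x ≡ onlyIf a (onlyIf c (onlyIf (b ∧ e) x))
onlyIf-split-nice true b true e x = refl
onlyIf-split-nice true true false e x = refl
onlyIf-split-nice true false false e x = refl
onlyIf-split-nice false b c e x = refl

onlyIf-⇒sparse : ∀ y b x → onlyIf (true ⇒b y) (onlyIf b x) ≡ onlyIf (b ∧ y) x
onlyIf-⇒sparse true true x = refl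
onlyIf-⇒sparse true false x = refl
onlyIf-⇒sparse false true x = refl
onlyIf-⇒sparse false false x = refl

-- A nice subset of A_{d,n+1} has as first column either ∅
-- (the rest being any nice I) or {1..h}, h ≥ 1 (the rest being nice with (1,1) ∉ I):
--   niceSum F (n+1) = niceSum (F(s+k,k)) n + Σ_{h=1}^{d} niceSum′ (F(α_h+s+k, h+k)) n.
niceSum-suc : ∀ d m F n → niceSum d m F (suc n) ≡ niceSum d m (λ s k → F (s ℕ.+ k) k) n + sumTo d (λ h → niceSum′ d m (λ s k → F (fullColumnWeight m (suc h) ℕ.+ (s ℕ.+ k)) (suc h ℕ.+ k)) n)
niceSum-suc d m F n = begin
  niceSum d m F (suc n) ≡⟨ sumMap-allSubsets-suc d n _ ⟩
  sumMap (λ I → sumMap (λ c → onlyIf (isNice (prependColumn c I)) (F (σ m (prependColumn c I)) (card (prependColumn c I)))) (allVecs d)) (allSubsets d n)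
    ≡⟨ sumMap-cong (λ I → sumMap-cong (λ c → prepend-split I c) (allVecs d)) (allSubsets d n) ⟩
  sumMap (λ I → sumMap (λ c → onlyIf (downClosed c) (Ψ I (lookupB c 1) (columnWeight m c) (columnSize c))) (allVecs d)) (allSubsets d n)
    ≡⟨ sumMap-cong (λ I → sum-downClosedColumns m d (Ψ I)) (allSubsets d n) ⟩
  sumMap (λ I → Ψ I false 0 0 + sumTo d (λ h → Ψ I true (fullColumnWeight m (suc h)) (suc h))) (allSubsets d n)
    ≡⟨ sumMap-+ _ _ (allSubsets d n) ⟩
  niceSum d m (λ s k → F (s ℕ.+ k) k) n + sumMap (λ I → sumTo d (λ h → Ψ I true (fullColumnWeight m (suc h)) (suc h))) (allSubsets d n)
    ≡⟨ cong (niceSum d m (λ s k → F (s ℕ.+ k) k) n +_) (trans (sumMap-sumTo d _ (allSubsets d n)) (sumTo-cong d (λ h _ → sumMap-cong (λ I → onlyIf-⇒sparse (not (mem I 1 1)) (isNice I) _) (allSubsets d n)))) ⟩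
  niceSum d m (λ s k → F (s ℕ.+ k) k) n + sumTo d (λ h → niceSum′ d m (λ s k → F (fullColumnWeight m (suc h) ℕ.+ (s ℕ.+ k)) (suc h ℕ.+ k)) n) ∎
  where
  open ≡-Reasoning
  Ψ : Subset d n → Bool → ℕ → ℕ → ℚ
  Ψ I x s k = onlyIf (x ⇒b not (mem I 1 1)) (onlyIf (isNice I) (F (s ℕ.+ (σ m I ℕ.+ card I)) (k ℕ.+ card I)))
  prepend-split : ∀ I c → onlyIf (isNice (prependColumn c I)) (F (σ m (prependColumn c I)) (card (prependColumn c I))) ≡ onlyIf (downClosed c) (Ψ I (lookupB c 1) (columnWeight m c) (columnSize c))
  prepend-split I c rewrite isNice-prepend c I | σ-prepend m c I | card-prepend c I = onlyIf-split-nice (downClosed c) (columnsNested I) _ (rowOneSparse I) _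

onlyIf-split-nice′ : ∀ a b x y e z → onlyIf (((a ∧ b) ∧ ((x ⇒b y) ∧ e)) ∧ not x) z ≡ onlyIf a (onlyIf (not x) (onlyIf (x ⇒b y) (onlyIf (b ∧ e) z)))
onlyIf-split-nice′ false b x y e z = refl
onlyIf-split-nice′ true true true true true z = refl
onlyIf-split-nice′ true true true true false z = refl
onlyIf-split-nice′ true true true false e z = refl
onlyIf-split-nice′ true false true y e z = refl
onlyIf-split-nice′ true true false y true z = refl
onlyIf-split-nice′ true true false y false z = refl
onlyIf-split-nice′ true false false y e z = refl

-- If (1,1) ∉ I, the first column of I (being down-closed) is empty:
--   niceSum′ F (n+1) = niceSum (F(s+k,k)) n.
niceSum′-suc : ∀ d m F n → niceSum′ d m F (suc n) ≡ niceSum d m (λ s k → F (s ℕ.+ k) k) n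
niceSum′-suc d m F n = begin
  niceSum′ d m F (suc n) ≡⟨ sumMap-allSubsets-suc d n _ ⟩
  sumMap (λ I → sumMap (λ c → onlyIf (isNice (prependColumn c I) ∧ not (mem (prependColumn c I) 1 1)) (F (σ m (prependColumn c I)) (card (prependColumn c I)))) (allVecs d)) (allSubsets d n)
    ≡⟨ sumMap-cong (λ I → sumMap-cong (λ c → prepend-split I c) (allVecs d)) (allSubsets d n) ⟩
  sumMap (λ I → sumMap (λ c → onlyIf (downClosed c) (Ψ I (lookupB c 1) (columnWeight m c) (columnSize c))) (allVecs d)) (allSubsets d n)
    ≡⟨ sumMap-cong (λ I → trans (sum-downClosedColumns m d (Ψ I)) (trans (cong (Ψ I false 0 0 +_) (sumTo-0 d)) (ℚP.+-identityʳ _))) (allSubsets d n) ⟩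
  niceSum d m (λ s k → F (s ℕ.+ k) k) n ∎
  where
  open ≡-Reasoning
  Ψ : Subset d n → Bool → ℕ → ℕ → ℚ
  Ψ I x s k = onlyIf (not x) (onlyIf (x ⇒b not (mem I 1 1)) (onlyIf (isNice I) (F (s ℕ.+ (σ m I ℕ.+ card I)) (k ℕ.+ card I))))
  prepend-split : ∀ I c → onlyIf (isNice (prependColumn c I) ∧ not (mem (prependColumn c I) 1 1)) (F (σ m (prependColumn c I)) (card (prependColumn c I))) ≡ onlyIf (downClosed c) (Ψ I (lookupB c 1) (columnWeight m c) (columnSize c))
  prepend-split I c rewrite isNice-prepend c I | σ-prepend m c I | card-prepend c I | mem-prepend-first c I 1 = onlyIf-split-nice′ (downClosed c) (columnsNested I) (lookupB c 1) _ (rowOneSparse I) _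

noColumns : ∀ d → Subset d 0
noColumns zero = []
noColumns (suc d) = [] ∷ noColumns d

sumMap-allSubsets0 : ∀ d (Φ : Subset d 0 → ℚ) → sumMap Φ (allSubsets d 0) ≡ Φ (noColumns d)
sumMap-allSubsets0 zero Φ = ℚP.+-identityʳ _
sumMap-allSubsets0 (suc d) Φ = trans (sumMap-allVecsOf (allVecs 0) d Φ) (trans (sumMap-allSubsets0 d _) (ℚP.+-identityʳ _))

allB-true : {A : Set} (xs : List A) → allB (λ _ → true) xs ≡ true
allB-true [] = refl
allB-true (x ∷ xs) = allB-true xs

sumℕ-0 : {A : Set} (xs : List A) → sum (map (λ _ → 0) xs) ≡ 0
sumℕ-0 [] = refl
sumℕ-0 (x ∷ xs) = sumℕ-0 xs

isNice-noColumns : ∀ d → isNice (noColumns d) ≡ true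
isNice-noColumns d = cong (_∧ true) (allB-true (range1 (d ∸ 1)))

sumOver-noColumns : ∀ d f → sumOver (noColumns d) f ≡ 0
sumOver-noColumns d f = sumℕ-0 (range1 d)

niceSum-zero : ∀ d m F → niceSum d m F 0 ≡ F 0 0
niceSum-zero d m F = trans (sumMap-allSubsets0 d _) (trans (cong (λ z → onlyIf z (F (σ m (noColumns d)) (card (noColumns d)))) (isNice-noColumns d)) (cong₂ F (sumOver-noColumns d (λ i j → (i ∸ 1) ℕ.* m ℕ.+ j)) (sumOver-noColumns d (λ _ _ → 1))))

niceSum′-zero : ∀ d m F → niceSum′ d m F 0 ≡ F 0 0
niceSum′-zero d m F = trans (sumMap-allSubsets0 d _) (trans (cong (λ z → onlyIf z (F (σ m (noColumns d)) (card (noColumns d)))) (cong₂ _∧_ (isNice-noColumns d) (cong not (mem-noColumns (noColumns d) 1 1)))) (cong₂ F (sumOver-noColumns d (λ i j → (i ∸ 1) ℕ.* m ℕ.+ j)) (sumOver-noColumns d (λ _ _ → 1))))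

toℚ-sum-filter : {A : Set} (g : A → ℕ) (p : A → Bool) (xs : List A) → toℚ (sum (map g (filter (λ x → T? (p x)) xs))) ≡ sumMap (λ x → onlyIf (p x) (toℚ (g x))) xs
toℚ-sum-filter g p [] = refl
toℚ-sum-filter g p (x ∷ xs) with p x
... | true = trans (toℚ-+ (g x) _) (cong (toℚ (g x) +_) (toℚ-sum-filter g p xs))
... | false = trans (toℚ-sum-filter g p xs) (sym (ℚP.+-identityˡ _))

G+-niceSum : ∀ d m a b n → toℚ (G+ d m a b n) ≡ niceSum d m (λ s k → toℚ s ^ℚ a * toℚ k ^ℚ b) n
G+-niceSum d m a b n = trans (toℚ-sum-filter _ isNice (allSubsets d n)) (sumMap-cong (λ I → cong (onlyIf (isNice I)) (trans (toℚ-* (σ m I ℕ.^ a) (card I ℕ.^ b)) (cong₂ _*_ (toℚ-^ (σ m I) a) (toℚ-^ (card I) b)))) (allSubsets d n))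

onlyIf-+ : ∀ b x y → onlyIf b (x + y) ≡ onlyIf b x + onlyIf b y
onlyIf-+ true x y = refl
onlyIf-+ false x y = sym (ℚP.+-identityˡ 0ℚ)

onlyIf-* : ∀ b c x → onlyIf b (c * x) ≡ c * onlyIf b x
onlyIf-* true c x = refl
onlyIf-* false c x = sym (ℚP.*-zeroʳ c)

onlyIf-sumTo : ∀ b N (f : ℕ → ℚ) → onlyIf b (sumTo N f) ≡ sumTo N (λ i → onlyIf b (f i))
onlyIf-sumTo true N f = refl
onlyIf-sumTo false N f = sym (sumTo-0 N)

niceSum-cong : ∀ d m {F G : ℕ → ℕ → ℚ} → (∀ s k → F s k ≡ G s k) → ∀ n → niceSum d m F n ≡ niceSum d m G n
niceSum-cong d m e n = sumMap-cong (λ I → cong (onlyIf (isNice I)) (e (σ m I) (card I))) (allSubsets d n)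

niceSum-+ : ∀ d m (F G : ℕ → ℕ → ℚ) n → niceSum d m (λ s k → F s k + G s k) n ≡ niceSum d m F n + niceSum d m G n
niceSum-+ d m F G n = trans (sumMap-cong (λ I → onlyIf-+ (isNice I) (F (σ m I) (card I)) (G (σ m I) (card I))) (allSubsets d n)) (sumMap-+ (λ I → onlyIf (isNice I) (F (σ m I) (card I))) (λ I → onlyIf (isNice I) (G (σ m I) (card I))) (allSubsets d n))

niceSum-* : ∀ d m c (F : ℕ → ℕ → ℚ) n → niceSum d m (λ s k → c * F s k) n ≡ c * niceSum d m F n
niceSum-* d m c F n = trans (sumMap-cong (λ I → onlyIf-* (isNice I) c (F (σ m I) (card I))) (allSubsets d n)) (sumMap-*ˡ c (λ I → onlyIf (isNice I) (F (σ m I) (card I))) (allSubsets d n))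

niceSum-sumTo : ∀ d m N (F : ℕ → ℕ → ℕ → ℚ) n → niceSum d m (λ s k → sumTo N (λ i → F i s k)) n ≡ sumTo N (λ i → niceSum d m (F i) n)
niceSum-sumTo d m N F n = trans (sumMap-cong (λ I → onlyIf-sumTo (isNice I) N (λ i → F i (σ m I) (card I))) (allSubsets d n)) (sumMap-sumTo N (λ I i → onlyIf (isNice I) (F i (σ m I) (card I))) (allSubsets d n))

inv-l : ∀ x → ¬ (x ≡ 0ℚ) → inv x * x ≡ 1ℚ
inv-l x x≢0 with x ≟ 0ℚ
... | yes p = ⊥-elim (x≢0 p)
... | no p = ℚP.*-inverseˡ x {{ℚ.≢-nonZero p}}

inv-r : ∀ x → ¬ (x ≡ 0ℚ) → x * inv x ≡ 1ℚ
inv-r x nz = trans (ℚP.*-comm x (inv x)) (inv-l x nz)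

*-≢0ℚ : ∀ x y → ¬ (x ≡ 0ℚ) → ¬ (y ≡ 0ℚ) → ¬ (x * y ≡ 0ℚ)
*-≢0ℚ x y nx ny xy0 = ny (begin
  y ≡⟨ sym (ℚP.*-identityˡ y) ⟩
  1ℚ * y ≡⟨ cong (_* y) (sym (inv-l x nx)) ⟩
  inv x * x * y ≡⟨ ℚP.*-assoc (inv x) x y ⟩
  inv x * (x * y) ≡⟨ cong (inv x *_) xy0 ⟩
  inv x * 0ℚ ≡⟨ ℚP.*-zeroʳ (inv x) ⟩
  0ℚ ∎)
  where open ≡-Reasoning

inv-* : ∀ x y → ¬ (x ≡ 0ℚ) → ¬ (y ≡ 0ℚ) → inv (x * y) ≡ inv x * inv y
inv-* x y nx ny = begin
  inv (x * y) ≡⟨ sym (ℚP.*-identityʳ _) ⟩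
  inv (x * y) * 1ℚ ≡⟨ cong (inv (x * y) *_) (sym (trans (cong₂ _*_ (inv-r x nx) (inv-r y ny)) (ℚP.*-identityˡ 1ℚ))) ⟩
  inv (x * y) * ((x * inv x) * (y * inv y)) ≡⟨ ring (inv (x * y)) x y (inv x) (inv y) ⟩
  (inv (x * y) * (x * y)) * (inv x * inv y) ≡⟨ cong (_* (inv x * inv y)) (inv-l (x * y) (*-≢0ℚ x y nx ny)) ⟩
  1ℚ * (inv x * inv y) ≡⟨ ℚP.*-identityˡ _ ⟩
  inv x * inv y ∎
  where
  open ≡-Reasoning
  ring : ∀ w x y u v → w * ((x * u) * (y * v)) ≡ (w * (x * y)) * (u * v)
  ring = solve-∀ R

inv-1 : inv 1ℚ ≡ 1ℚ
inv-1 = trans (sym (ℚP.*-identityʳ (inv 1ℚ))) (inv-l 1ℚ (λ ()))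

toℚ-suc≢0ℚ : ∀ k → ¬ (toℚ (suc k) ≡ 0ℚ)
toℚ-suc≢0ℚ k e with trans (sym (toℚ≡mkℚ (suc k))) (trans e (toℚ≡mkℚ 0))
... | ()

polyAdd : Poly → Poly → Poly
polyAdd [] q = q
polyAdd (a ∷ p) [] = a ∷ p
polyAdd (a ∷ p) (b ∷ q) = (a + b) ∷ polyAdd p q

polyScale : ℚ → Poly → Poly
polyScale c = map (c *_)

polyMul : Poly → Poly → Poly
polyMul [] q = []
polyMul (a ∷ p) q = polyAdd (polyScale a q) (0ℚ ∷ polyMul p q)

eval-polyAdd : ∀ p q x → evalPoly (polyAdd p q) x ≡ evalPoly p x + evalPoly q x
eval-polyAdd [] q x = sym (ℚP.+-identityˡ (evalPoly q x))
eval-polyAdd (a ∷ p) [] x = sym (ℚP.+-identityʳ (evalPoly (a ∷ p) x))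
eval-polyAdd (a ∷ p) (b ∷ q) x = trans (cong (λ z → (a + b) + x * z) (eval-polyAdd p q x)) (ring a b x _ _)
  where
  ring : ∀ a b x u v → (a + b) + x * (u + v) ≡ (a + x * u) + (b + x * v)
  ring = solve-∀ R

eval-polyScale : ∀ c p x → evalPoly (polyScale c p) x ≡ c * evalPoly p x
eval-polyScale c [] x = sym (ℚP.*-zeroʳ c)
eval-polyScale c (a ∷ p) x = trans (cong (λ z → c * a + x * z) (eval-polyScale c p x)) (ring c a x _)
  where
  ring : ∀ c a x u → c * a + x * (c * u) ≡ c * (a + x * u)
  ring = solve-∀ R

eval-polyMul : ∀ p q x → evalPoly (polyMul p q) x ≡ evalPoly p x * evalPoly q x
eval-polyMul [] q x = sym (ℚP.*-zeroˡ (evalPoly q x))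
eval-polyMul (a ∷ p) q x = trans (eval-polyAdd (polyScale a q) (0ℚ ∷ polyMul p q) x) (trans (cong₂ _+_ (eval-polyScale a q x) (cong (λ z → 0ℚ + x * z) (eval-polyMul p q x))) (ring a x _ _))
  where
  ring : ∀ a x u v → a * v + (0ℚ + x * (u * v)) ≡ (a + x * u) * v
  ring = solve-∀ R

PosRatFun : Set
PosRatFun = Σ RatFun (λ r → ∀ d → 1 ≤ d → ¬ (evalPoly (den r) (toℚ d) ≡ 0ℚ))

evalR : PosRatFun → ℕ → ℚ
evalR r d = evalRF (proj₁ r) (toℚ d)

eval-one : ∀ x → evalPoly (1ℚ ∷ []) x ≡ 1ℚ
eval-one x = trans (cong (1ℚ +_) (ℚP.*-zeroʳ x)) (ℚP.+-identityʳ 1ℚ)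

polyR : Poly → PosRatFun
polyR p = (p // (1ℚ ∷ [])) , (λ d _ e → ℚP.1≢0 (trans (sym (eval-one (toℚ d))) e))

polyR-eval : ∀ p d → evalR (polyR p) d ≡ evalPoly p (toℚ d)
polyR-eval p d = trans (cong (λ z → evalPoly p (toℚ d) * inv z) (eval-one (toℚ d))) (trans (cong (evalPoly p (toℚ d) *_) inv-1) (ℚP.*-identityʳ _))

constR : ℚ → PosRatFun
constR q = polyR (q ∷ [])

constR-eval : ∀ q d → evalR (constR q) d ≡ q
constR-eval q d = trans (polyR-eval (q ∷ []) d) (trans (cong (q +_) (ℚP.*-zeroʳ (toℚ d))) (ℚP.+-identityʳ q))

recipR : (p : Poly) → (∀ d → 1 ≤ d → ¬ (evalPoly p (toℚ d) ≡ 0ℚ)) → PosRatFun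
recipR p nz = ((1ℚ ∷ []) // p) , nz

recipR-eval : ∀ p nz d → evalR (recipR p nz) d ≡ inv (evalPoly p (toℚ d))
recipR-eval p nz d = trans (cong (_* inv (evalPoly p (toℚ d))) (eval-one (toℚ d))) (ℚP.*-identityˡ _)

addR : PosRatFun → PosRatFun → PosRatFun
addR ((num₁ // den₁) , nz₁) ((num₂ // den₂) , nz₂) = (polyAdd (polyMul num₁ den₂) (polyMul num₂ den₁) // polyMul den₁ den₂) ,
  (λ d h e → *-≢0ℚ _ _ (nz₁ d h) (nz₂ d h) (trans (sym (eval-polyMul den₁ den₂ (toℚ d))) e))

addR-eval : ∀ r1 r2 d → 1 ≤ d → evalR (addR r1 r2) d ≡ evalR r1 d + evalR r2 d
addR-eval ((num₁ // den₁) , nz₁) ((num₂ // den₂) , nz₂) d h = begin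
  evalPoly (polyAdd (polyMul num₁ den₂) (polyMul num₂ den₁)) x * inv (evalPoly (polyMul den₁ den₂) x)
    ≡⟨ cong₂ (λ u v → u * inv v) (trans (eval-polyAdd (polyMul num₁ den₂) (polyMul num₂ den₁) x) (cong₂ _+_ (eval-polyMul num₁ den₂ x) (eval-polyMul num₂ den₁ x))) (eval-polyMul den₁ den₂ x) ⟩
  (N1 * D2 + N2 * D1) * inv (D1 * D2) ≡⟨ cong ((N1 * D2 + N2 * D1) *_) (inv-* D1 D2 (nz₁ d h) (nz₂ d h)) ⟩
  (N1 * D2 + N2 * D1) * (inv D1 * inv D2) ≡⟨ ring N1 N2 D1 D2 (inv D1) (inv D2) ⟩
  N1 * inv D1 * (D2 * inv D2) + N2 * inv D2 * (D1 * inv D1) ≡⟨ cong₂ (λ u v → N1 * inv D1 * u + N2 * inv D2 * v) (inv-r D2 (nz₂ d h)) (inv-r D1 (nz₁ d h)) ⟩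
  N1 * inv D1 * 1ℚ + N2 * inv D2 * 1ℚ ≡⟨ cong₂ _+_ (ℚP.*-identityʳ (N1 * inv D1)) (ℚP.*-identityʳ (N2 * inv D2)) ⟩
  N1 * inv D1 + N2 * inv D2 ∎
  where
  open ≡-Reasoning
  x = toℚ d
  N1 = evalPoly num₁ x
  N2 = evalPoly num₂ x
  D1 = evalPoly den₁ x
  D2 = evalPoly den₂ x
  ring : ∀ a b c e u v → (a * e + b * c) * (u * v) ≡ a * u * (e * v) + b * v * (c * u)
  ring = solve-∀ R

mulR : PosRatFun → PosRatFun → PosRatFun
mulR ((num₁ // den₁) , nz₁) ((num₂ // den₂) , nz₂) = (polyMul num₁ num₂ // polyMul den₁ den₂) ,
  (λ d h e → *-≢0ℚ _ _ (nz₁ d h) (nz₂ d h) (trans (sym (eval-polyMul den₁ den₂ (toℚ d))) e))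

mulR-eval : ∀ r1 r2 d → 1 ≤ d → evalR (mulR r1 r2) d ≡ evalR r1 d * evalR r2 d
mulR-eval ((num₁ // den₁) , nz₁) ((num₂ // den₂) , nz₂) d h = begin
  evalPoly (polyMul num₁ num₂) x * inv (evalPoly (polyMul den₁ den₂) x) ≡⟨ cong₂ (λ u v → u * inv v) (eval-polyMul num₁ num₂ x) (eval-polyMul den₁ den₂ x) ⟩
  (N1 * N2) * inv (D1 * D2) ≡⟨ cong ((N1 * N2) *_) (inv-* D1 D2 (nz₁ d h) (nz₂ d h)) ⟩
  (N1 * N2) * (inv D1 * inv D2) ≡⟨ ring N1 N2 (inv D1) (inv D2) ⟩
  N1 * inv D1 * (N2 * inv D2) ∎
  where
  open ≡-Reasoning
  x = toℚ d
  N1 = evalPoly num₁ x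
  N2 = evalPoly num₂ x
  D1 = evalPoly den₁ x
  D2 = evalPoly den₂ x
  ring : ∀ a b u v → (a * b) * (u * v) ≡ a * u * (b * v)
  ring = solve-∀ R

IsPoly : (ℕ → ℚ) → Set
IsPoly f = Σ Poly (λ p → ∀ x → evalPoly p (toℚ x) ≡ f x)

isPoly-const : ∀ q → IsPoly (λ _ → q)
isPoly-const q = (q ∷ []) , (λ x → trans (cong (q +_) (ℚP.*-zeroʳ (toℚ x))) (ℚP.+-identityʳ q))

isPoly-id : IsPoly toℚ
isPoly-id = (0ℚ ∷ 1ℚ ∷ []) , (λ x → trans (cong (λ z → 0ℚ + toℚ x * z) (eval-one (toℚ x))) (trans (ℚP.+-identityˡ _) (ℚP.*-identityʳ _)))

isPoly-ext : ∀ {f g} → (∀ x → f x ≡ g x) → IsPoly f → IsPoly g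
isPoly-ext e (p , h) = p , (λ x → trans (h x) (e x))

isPoly-+ : ∀ {f g} → IsPoly f → IsPoly g → IsPoly (λ x → f x + g x)
isPoly-+ (p , hp) (q , hq) = polyAdd p q , (λ x → trans (eval-polyAdd p q (toℚ x)) (cong₂ _+_ (hp x) (hq x)))

isPoly-* : ∀ {f g} → IsPoly f → IsPoly g → IsPoly (λ x → f x * g x)
isPoly-* (p , hp) (q , hq) = polyMul p q , (λ x → trans (eval-polyMul p q (toℚ x)) (cong₂ _*_ (hp x) (hq x)))

isPoly-^ : ∀ {f} → IsPoly f → ∀ k → IsPoly (λ x → f x ^ℚ k)
isPoly-^ pf zero = isPoly-const 1ℚ
isPoly-^ pf (suc k) = isPoly-* pf (isPoly-^ pf k)

isPoly-sumTo : ∀ k {F : ℕ → ℕ → ℚ} → (∀ i → i < k → IsPoly (F i)) → IsPoly (λ x → sumTo k (λ i → F i x))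
isPoly-sumTo zero h = isPoly-const 0ℚ
isPoly-sumTo (suc k) h = isPoly-+ (isPoly-sumTo k (λ i i<k → h i (ℕP.m<n⇒m<1+n i<k))) (h k ℕP.≤-refl)

powerSum : ℕ → ℕ → ℚ
powerSum i d = sumTo d (λ h → toℚ h ^ℚ i)

telescope : ∀ (g : ℕ → ℚ) d → sumTo d (λ h → g (suc h) - g h) ≡ g d - g 0
telescope g zero = sym (ℚP.+-inverseʳ (g 0))
telescope g (suc d) = trans (cong (_+ (g (suc d) - g d)) (telescope g d)) (ring (g d) (g 0) (g (suc d)))
  where
  ring : ∀ a b c → (a - b) + (c - a) ≡ c - b
  ring = solve-∀ R

-- d^(k+1) = Σ_{i≤k} C(k+1,i) S_i(d), by telescoping (h+1)^(k+1) - h^(k+1).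
pow-powerSums : ∀ k d → toℚ d ^ℚ suc k ≡ sumTo (suc k) (λ i → binomℚ (suc k) i * powerSum i d)
pow-powerSums k d = begin
  toℚ d ^ℚ suc k ≡⟨ minus-zero (toℚ d ^ℚ suc k) ⟩
  toℚ d ^ℚ suc k - toℚ 0 ^ℚ suc k ≡⟨ sym (telescope (λ h → toℚ h ^ℚ suc k) d) ⟩
  sumTo d (λ h → toℚ (suc h) ^ℚ suc k - toℚ h ^ℚ suc k) ≡⟨ sumTo-cong d (λ h _ → binomial-difference h) ⟩
  sumTo d (λ h → sumTo (suc k) (λ i → binomℚ (suc k) i * toℚ h ^ℚ i)) ≡⟨ sumTo-swap d (suc k) _ ⟩
  sumTo (suc k) (λ i → sumTo d (λ h → binomℚ (suc k) i * toℚ h ^ℚ i)) ≡⟨ sumTo-cong (suc k) (λ i _ → sumTo-*ˡ d (binomℚ (suc k) i) (λ h → toℚ h ^ℚ i)) ⟩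
  sumTo (suc k) (λ i → binomℚ (suc k) i * powerSum i d) ∎
  where
  open ≡-Reasoning
  minus-zero : ∀ a → a ≡ a - 0ℚ * 0ℚ ^ℚ k
  minus-zero a = sym (trans (cong (λ z → a - z) (ℚP.*-zeroˡ (0ℚ ^ℚ k))) (ℚP.+-identityʳ a))
  binomial-difference : ∀ h → toℚ (suc h) ^ℚ suc k - toℚ h ^ℚ suc k ≡ sumTo (suc k) (λ i → binomℚ (suc k) i * toℚ h ^ℚ i)
  binomial-difference h = begin
    toℚ (suc h) ^ℚ suc k - toℚ h ^ℚ suc k ≡⟨ cong (λ z → z ^ℚ suc k - toℚ h ^ℚ suc k) (trans (toℚ-suc h) (ℚP.+-comm 1ℚ (toℚ h))) ⟩
    (toℚ h + 1ℚ) ^ℚ suc k - toℚ h ^ℚ suc k ≡⟨ cong (_- toℚ h ^ℚ suc k) (binomial-theorem (toℚ h) 1ℚ (suc k)) ⟩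
    (sumTo (suc k) t + t (suc k)) - toℚ h ^ℚ suc k ≡⟨ cong (λ z → (sumTo (suc k) t + z) - toℚ h ^ℚ suc k) tlast ⟩
    (sumTo (suc k) t + toℚ h ^ℚ suc k) - toℚ h ^ℚ suc k ≡⟨ ringc (sumTo (suc k) t) (toℚ h ^ℚ suc k) ⟩
    sumTo (suc k) t ≡⟨ sumTo-cong (suc k) (λ i _ → cong (binomℚ (suc k) i *_) (trans (cong (toℚ h ^ℚ i *_) (1^ℚ (suc k ∸ i))) (ℚP.*-identityʳ _))) ⟩
    sumTo (suc k) (λ i → binomℚ (suc k) i * toℚ h ^ℚ i) ∎
    where
    t : ℕ → ℚ
    t u = binomℚ (suc k) u * (toℚ h ^ℚ u * 1ℚ ^ℚ (suc k ∸ u))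
    tlast : t (suc k) ≡ toℚ h ^ℚ suc k
    tlast = trans (cong₂ _*_ (cong toℚ (binom-diag (suc k))) (trans (cong (toℚ h ^ℚ suc k *_) (1^ℚ (suc k ∸ suc k))) (ℚP.*-identityʳ (toℚ h ^ℚ suc k)))) (ℚP.*-identityˡ (toℚ h ^ℚ suc k))
    ringc : ∀ a b → (a + b) - b ≡ a
    ringc = solve-∀ R

-- Each S_i is a polynomial in d (solving the previous identity for S_k).
isPoly-powerSum : ∀ k → ∀ i → i ≤ k → IsPoly (powerSum i)
isPoly-powerSum zero zero _ = isPoly-ext (λ x → sym (trans (sumTo-cong x (λ _ _ → refl)) (sum-ones x))) (isPoly-id)
  where
  sum-ones : ∀ x → sumTo x (λ _ → 1ℚ) ≡ toℚ x
  sum-ones zero = refl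
  sum-ones (suc x) = trans (cong (_+ 1ℚ) (sum-ones x)) (trans (ℚP.+-comm (toℚ x) 1ℚ) (sym (toℚ-suc x)))
isPoly-powerSum (suc k) i i≤ with ℕP.m≤n⇒m<n∨m≡n i≤
... | inj₁ i<sk = isPoly-powerSum k i (ℕP.≤-pred i<sk)
... | inj₂ refl = isPoly-ext solve-for-top (isPoly-* (isPoly-const c) (isPoly-+ (isPoly-^ isPoly-id (suc (suc k))) (isPoly-* (isPoly-const (- 1ℚ)) (isPoly-sumTo (suc k) (λ j j< → isPoly-* (isPoly-const (binomℚ (suc (suc k)) j)) (isPoly-powerSum k j (ℕP.≤-pred j<)))))))
  where
  c = inv (toℚ (suc (suc k)))
  solve-for-top : ∀ x → c * (toℚ x ^ℚ suc (suc k) + (- 1ℚ) * sumTo (suc k) (λ j → binomℚ (suc (suc k)) j * powerSum j x)) ≡ powerSum (suc k) x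
  solve-for-top x = begin
    c * (P + (- 1ℚ) * Rest) ≡⟨ cong (λ z → c * (z + (- 1ℚ) * Rest)) (pow-powerSums (suc k) x) ⟩
    c * ((Rest + binomℚ (suc (suc k)) (suc k) * powerSum (suc k) x) + (- 1ℚ) * Rest) ≡⟨ ringE c Rest (binomℚ (suc (suc k)) (suc k)) (powerSum (suc k) x) ⟩
    (c * binomℚ (suc (suc k)) (suc k)) * powerSum (suc k) x ≡⟨ cong (λ z → (c * z) * powerSum (suc k) x) bqk ⟩
    (c * toℚ (suc (suc k))) * powerSum (suc k) x ≡⟨ cong (_* powerSum (suc k) x) (inv-l (toℚ (suc (suc k))) (toℚ-suc≢0ℚ (suc k))) ⟩
    1ℚ * powerSum (suc k) x ≡⟨ ℚP.*-identityˡ _ ⟩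
    powerSum (suc k) x ∎
    where
    open ≡-Reasoning
    P = toℚ x ^ℚ suc (suc k)
    Rest = sumTo (suc k) (λ j → binomℚ (suc (suc k)) j * powerSum j x)
    ringE : ∀ c r b s → c * ((r + b * s) + (- 1ℚ) * r) ≡ (c * b) * s
    ringE = solve-∀ R
    binom-sub : ∀ n → binom (suc n) n ≡ suc n
    binom-sub zero = refl
    binom-sub (suc n) = trans (cong₂ ℕ._+_ (binom-sub n) (binom-diag (suc n))) (ℕP.+-comm (suc n) 1)
    bqk : binomℚ (suc (suc k)) (suc k) ≡ toℚ (suc (suc k))
    bqk = cong toℚ (binom-sub (suc k))
isPoly-powerSum zero (suc i) ()

isPoly-sum-monomial : ∀ p i → IsPoly (λ d → sumTo d (λ h → evalPoly p (toℚ h) * toℚ h ^ℚ i))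
isPoly-sum-monomial [] i = isPoly-ext (λ d → sym (trans (sumTo-cong d (λ h _ → ℚP.*-zeroˡ (toℚ h ^ℚ i))) (sumTo-0 d))) (isPoly-const 0ℚ)
isPoly-sum-monomial (a ∷ p) i = isPoly-ext split-constant (isPoly-+ (isPoly-* (isPoly-const a) (isPoly-powerSum i i ℕP.≤-refl)) (isPoly-sum-monomial p (suc i)))
  where
  split-constant : ∀ d → a * powerSum i d + sumTo d (λ h → evalPoly p (toℚ h) * toℚ h ^ℚ suc i) ≡ sumTo d (λ h → evalPoly (a ∷ p) (toℚ h) * toℚ h ^ℚ i)
  split-constant d = trans (cong (_+ _) (sym (sumTo-*ˡ d a _))) (trans (sym (sumTo-+ d _ _)) (sumTo-cong d (λ h _ → ring a (toℚ h) (evalPoly p (toℚ h)) (toℚ h ^ℚ i))))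
    where
    ring : ∀ a x e y → a * y + e * (x * y) ≡ (a + x * e) * y
    ring = solve-∀ R

isPoly-sum : ∀ {f} → IsPoly f → IsPoly (λ d → sumTo d f)
isPoly-sum {f} (p , hp) = isPoly-ext (λ d → sumTo-cong d (λ h _ → trans (ℚP.*-identityʳ _) (hp h))) (isPoly-sum-monomial p 0)

-- 'MN D': polynomials in m and n of total degree ≤ D with coefficients in
-- 'PosRatFun', given syntactically; '⟦ e ⟧ d m n' evaluates one.
infixl 6 _⊕_
data MN : ℕ → Set where
  const : ∀ {D} → PosRatFun → MN D
  _⊕_ : ∀ {D} → MN D → MN D → MN D
  m· : ∀ {D} → MN D → MN (suc D)
  n· : ∀ {D} → MN D → MN (suc D)
  raise : ∀ {D} → MN D → MN (suc D)

⟦_⟧ : ∀ {D} → MN D → ℕ → ℚ → ℚ → ℚ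
⟦ const r ⟧ d m n = evalR r d
⟦ e ⊕ f ⟧ d m n = ⟦ e ⟧ d m n + ⟦ f ⟧ d m n
⟦ m· e ⟧ d m n = m * ⟦ e ⟧ d m n
⟦ n· e ⟧ d m n = n * ⟦ e ⟧ d m n
⟦ raise e ⟧ d m n = ⟦ e ⟧ d m n

zeroMN : ∀ {D} → MN D
zeroMN = const (constR 0ℚ)

scaleMN : ∀ {D} → PosRatFun → MN D → MN D
scaleMN r (const r') = const (mulR r r')
scaleMN r (e ⊕ f) = scaleMN r e ⊕ scaleMN r f
scaleMN r (m· e) = m· (scaleMN r e)
scaleMN r (n· e) = n· (scaleMN r e)
scaleMN r (raise e) = raise (scaleMN r e)

scaleMN-eval : ∀ {D} r (e : MN D) d → 1 ≤ d → ∀ m n → ⟦ scaleMN r e ⟧ d m n ≡ evalR r d * ⟦ e ⟧ d m n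
scaleMN-eval r (const r') d h m n = mulR-eval r r' d h
scaleMN-eval r (e ⊕ f) d h m n = trans (cong₂ _+_ (scaleMN-eval r e d h m n) (scaleMN-eval r f d h m n)) (sym (ℚP.*-distribˡ-+ (evalR r d) _ _))
scaleMN-eval r (m· e) d h m n = trans (cong (m *_) (scaleMN-eval r e d h m n)) (ring m (evalR r d) _)
  where
  ring : ∀ a b c → a * (b * c) ≡ b * (a * c)
  ring = solve-∀ R
scaleMN-eval r (n· e) d h m n = trans (cong (n *_) (scaleMN-eval r e d h m n)) (ring n (evalR r d) _)
  where
  ring : ∀ a b c → a * (b * c) ≡ b * (a * c)
  ring = solve-∀ R
scaleMN-eval r (raise e) d h m n = scaleMN-eval r e d h m n

scaleℚ : ∀ {D} → ℚ → MN D → MN D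
scaleℚ q = scaleMN (constR q)

scaleℚ-eval : ∀ {D} q (e : MN D) d → 1 ≤ d → ∀ m n → ⟦ scaleℚ q e ⟧ d m n ≡ q * ⟦ e ⟧ d m n
scaleℚ-eval q e d h m n = trans (scaleMN-eval (constR q) e d h m n) (cong (_* ⟦ e ⟧ d m n) (constR-eval q d))

raiseBy : ∀ {D} k → MN D → MN (k ℕ.+ D)
raiseBy zero e = e
raiseBy (suc k) e = raise (raiseBy k e)

raiseBy-eval : ∀ {D} k (e : MN D) d m n → ⟦ raiseBy k e ⟧ d m n ≡ ⟦ e ⟧ d m n
raiseBy-eval zero e d m n = refl
raiseBy-eval (suc k) e d m n = raiseBy-eval k e d m n

mulMN : ∀ {a b} → MN a → MN b → MN (a ℕ.+ b)
mulMN {a} (const r) y = scaleMN r (raiseBy a y)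
mulMN (x ⊕ x') y = mulMN x y ⊕ mulMN x' y
mulMN (m· x) y = m· (mulMN x y)
mulMN (n· x) y = n· (mulMN x y)
mulMN (raise x) y = raise (mulMN x y)

mulMN-eval : ∀ {a b} (x : MN a) (y : MN b) d → 1 ≤ d → ∀ m n → ⟦ mulMN x y ⟧ d m n ≡ ⟦ x ⟧ d m n * ⟦ y ⟧ d m n
mulMN-eval {a} (const r) y d h m n = trans (scaleMN-eval r (raiseBy a y) d h m n) (cong (evalR r d *_) (raiseBy-eval a y d m n))
mulMN-eval (x ⊕ x') y d h m n = trans (cong₂ _+_ (mulMN-eval x y d h m n) (mulMN-eval x' y d h m n)) (sym (ℚP.*-distribʳ-+ (⟦ y ⟧ d m n) (⟦ x ⟧ d m n) (⟦ x' ⟧ d m n)))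
mulMN-eval (m· x) y d h m n = trans (cong (m *_) (mulMN-eval x y d h m n)) (sym (ℚP.*-assoc m _ _))
mulMN-eval (n· x) y d h m n = trans (cong (n *_) (mulMN-eval x y d h m n)) (sym (ℚP.*-assoc n _ _))
mulMN-eval (raise x) y d h m n = mulMN-eval x y d h m n

atN0 : ∀ {D} → MN D → MN D
atN0 (const r) = const r
atN0 (e ⊕ f) = atN0 e ⊕ atN0 f
atN0 (m· e) = m· (atN0 e)
atN0 (n· e) = zeroMN
atN0 (raise e) = raise (atN0 e)

atN0-eval : ∀ {D} (e : MN D) d m n → ⟦ atN0 e ⟧ d m n ≡ ⟦ e ⟧ d m 0ℚ
atN0-eval (const r) d m n = refl
atN0-eval (e ⊕ f) d m n = cong₂ _+_ (atN0-eval e d m n) (atN0-eval f d m n)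
atN0-eval (m· e) d m n = cong (m *_) (atN0-eval e d m n)
atN0-eval (n· e) d m n = trans (constR-eval 0ℚ d) (sym (ℚP.*-zeroˡ (⟦ e ⟧ d m 0ℚ)))
atN0-eval (raise e) d m n = atN0-eval e d m n

castMN : ∀ {a b} → a ≡ b → MN a → MN b
castMN refl e = e

castMN-eval : ∀ {a b} (p : a ≡ b) (e : MN a) d m n → ⟦ castMN p e ⟧ d m n ≡ ⟦ e ⟧ d m n
castMN-eval refl e d m n = refl

raiseTo : ∀ {D D'} → D ≤ D' → MN D → MN D'
raiseTo {D} {D'} p e = castMN (ℕP.m∸n+n≡m p) (raiseBy (D' ∸ D) e)

raiseTo-eval : ∀ {D D'} (p : D ≤ D') (e : MN D) d m n → ⟦ raiseTo p e ⟧ d m n ≡ ⟦ e ⟧ d m n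
raiseTo-eval {D} {D'} p e d m n = trans (castMN-eval (ℕP.m∸n+n≡m p) (raiseBy (D' ∸ D) e) d m n) (raiseBy-eval (D' ∸ D) e d m n)

-- (l+1)·C(n,l+1) = (n-l)·C(n,l): the recursion that makes C(n,l) a polynomial in n.
binom-step : ∀ n l → toℚ (suc l) * binomℚ n (suc l) ≡ (toℚ n - toℚ l) * binomℚ n l
binom-step zero zero = trans (ℚP.*-zeroʳ 1ℚ) (sym (trans (cong (_* 1ℚ) (ℚP.+-inverseʳ 0ℚ)) (ℚP.*-zeroˡ 1ℚ)))
binom-step zero (suc l) = trans (ℚP.*-zeroʳ (toℚ (suc (suc l)))) (sym (ℚP.*-zeroʳ (toℚ 0 - toℚ (suc l))))
binom-step (suc n) zero = begin
  toℚ 1 * binomℚ (suc n) 1 ≡⟨ cong (toℚ 1 *_) (binomℚ-suc n 0) ⟩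
  toℚ 1 * (binomℚ n 0 + binomℚ n 1) ≡⟨ cong (toℚ 1 *_) (cong (binomℚ n 0 +_) (trans (sym (ℚP.*-identityˡ (binomℚ n 1))) (binom-step n 0))) ⟩
  toℚ 1 * (toℚ 1 + (toℚ n - toℚ 0) * toℚ 1) ≡⟨ ring (toℚ n) ⟩
  (1ℚ + toℚ n) * toℚ 1 ≡⟨ cong (λ z → z * toℚ 1) (add-zero (toℚ n) (sym (toℚ-suc n))) ⟩
  (toℚ (suc n) - toℚ 0) * toℚ 1 ∎
  where
  open ≡-Reasoning
  ring : ∀ x → 1ℚ * (1ℚ + (x - 0ℚ) * 1ℚ) ≡ (1ℚ + x) * 1ℚ
  ring = solve-∀ R
  add-zero : ∀ x {y} → 1ℚ + x ≡ y → 1ℚ + x ≡ y - 0ℚ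
  add-zero x {y} e = trans e (sym (trans (cong (y +_) refl) (ℚP.+-identityʳ y)))
binom-step (suc n) (suc l) = begin
  toℚ (suc (suc l)) * binomℚ (suc n) (suc (suc l)) ≡⟨ cong (toℚ (suc (suc l)) *_) (binomℚ-suc n (suc l)) ⟩
  toℚ (suc (suc l)) * (binomℚ n (suc l) + binomℚ n (suc (suc l))) ≡⟨ distrib (toℚ (suc (suc l))) (binomℚ n (suc l)) (binomℚ n (suc (suc l))) ⟩
  toℚ (suc (suc l)) * binomℚ n (suc l) + toℚ (suc (suc l)) * binomℚ n (suc (suc l)) ≡⟨ cong₂ _+_ (cong (_* binomℚ n (suc l)) (toℚ-suc (suc l))) (binom-step n (suc l)) ⟩
  (1ℚ + toℚ (suc l)) * binomℚ n (suc l) + (toℚ n - toℚ (suc l)) * binomℚ n (suc l) ≡⟨ ringB (toℚ (suc l)) (toℚ n) (binomℚ n (suc l)) ⟩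
  (1ℚ + toℚ n) * binomℚ n (suc l) ≡⟨ pascal-rescale (toℚ n) (toℚ l) (binomℚ n l) (binomℚ n (suc l)) (trans (cong (_* binomℚ n (suc l)) (sym (toℚ-suc l))) (binom-step n l)) ⟩
  ((1ℚ + toℚ n) - (1ℚ + toℚ l)) * (binomℚ n l + binomℚ n (suc l)) ≡⟨ cong₂ (λ u v → (u - v) * (binomℚ n l + binomℚ n (suc l))) (sym (toℚ-suc n)) (sym (toℚ-suc l)) ⟩
  (toℚ (suc n) - toℚ (suc l)) * (binomℚ n l + binomℚ n (suc l)) ≡⟨ cong ((toℚ (suc n) - toℚ (suc l)) *_) (sym (binomℚ-suc n l)) ⟩
  (toℚ (suc n) - toℚ (suc l)) * binomℚ (suc n) (suc l) ∎
  where
  open ≡-Reasoning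
  distrib : ∀ a b c → a * (b + c) ≡ a * b + a * c
  distrib = solve-∀ R
  ringB : ∀ s n b → (1ℚ + s) * b + (n - s) * b ≡ (1ℚ + n) * b
  ringB = solve-∀ R
  pascal-rescale : ∀ n l b c → (1ℚ + l) * c ≡ (n - l) * b → (1ℚ + n) * c ≡ ((1ℚ + n) - (1ℚ + l)) * (b + c)
  pascal-rescale n l b c e = trans (ringD n l c) (trans (cong (_+ (n - l) * c) e) (ringE n l b c))
    where
    ringD : ∀ n l c → (1ℚ + n) * c ≡ (1ℚ + l) * c + (n - l) * c
    ringD = solve-∀ R
    ringE : ∀ n l b c → (n - l) * b + (n - l) * c ≡ ((1ℚ + n) - (1ℚ + l)) * (b + c)
    ringE = solve-∀ R

binomMN : (l : ℕ) → MN l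
binomMN zero = const (constR 1ℚ)
binomMN (suc l) = scaleℚ (inv (toℚ (suc l))) (n· (binomMN l) ⊕ scaleℚ (- toℚ l) (raise (binomMN l)))

binomMN-eval : ∀ l d → 1 ≤ d → ∀ m n → ⟦ binomMN l ⟧ d m (toℚ n) ≡ binomℚ n l
binomMN-eval zero d h m n = constR-eval 1ℚ d
binomMN-eval (suc l) d h m n = begin
  ⟦ scaleℚ c (n· (binomMN l) ⊕ scaleℚ (- toℚ l) (raise (binomMN l))) ⟧ d m (toℚ n) ≡⟨ scaleℚ-eval c (n· (binomMN l) ⊕ scaleℚ (- toℚ l) (raise (binomMN l))) d h m (toℚ n) ⟩
  c * (toℚ n * B + ⟦ scaleℚ (- toℚ l) (raise (binomMN l)) ⟧ d m (toℚ n)) ≡⟨ cong (λ z → c * (toℚ n * B + z)) (scaleℚ-eval (- toℚ l) (raise (binomMN l)) d h m (toℚ n)) ⟩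
  c * (toℚ n * B + (- toℚ l) * B) ≡⟨ cong (λ z → c * (toℚ n * z + (- toℚ l) * z)) (binomMN-eval l d h m n) ⟩
  c * (toℚ n * binomℚ n l + (- toℚ l) * binomℚ n l) ≡⟨ cong (c *_) (ring (toℚ n) (toℚ l) (binomℚ n l)) ⟩
  c * ((toℚ n - toℚ l) * binomℚ n l) ≡⟨ cong (c *_) (sym (binom-step n l)) ⟩
  c * (toℚ (suc l) * binomℚ n (suc l)) ≡⟨ sym (ℚP.*-assoc c _ _) ⟩
  (c * toℚ (suc l)) * binomℚ n (suc l) ≡⟨ cong (_* binomℚ n (suc l)) (inv-l (toℚ (suc l)) (toℚ-suc≢0ℚ l)) ⟩
  1ℚ * binomℚ n (suc l) ≡⟨ ℚP.*-identityˡ _ ⟩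
  binomℚ n (suc l) ∎
  where
  open ≡-Reasoning
  c = inv (toℚ (suc l))
  B = ⟦ binomMN l ⟧ d m (toℚ n)
  ring : ∀ n l b → n * b + (- l) * b ≡ (n - l) * b
  ring = solve-∀ R

sumMap-upTo : ∀ N (f : ℕ → ℚ) → foldr _+_ 0ℚ (map f (upTo N)) ≡ sumTo N f
sumMap-upTo zero f = refl
sumMap-upTo (suc N) f = trans (cong (λ z → f 0 + foldr _+_ 0ℚ (map f z)) (applyUpTo-map suc N))
  (trans (cong (f 0 +_) (trans (sumMap-map f suc (upTo N)) (sumMap-upTo N (f ∘ suc)))) (sym (sumTo-front N f)))

evalCoeffs : ℕ → (ℕ → ℕ → ℚ) → ℚ → ℚ → ℚ
evalCoeffs D c m n = sumTo (suc D) (λ k → sumTo (suc (D ∸ k)) (λ l → c k l * m ^ℚ k * n ^ℚ l))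

evalPoly2-evalCoeffs : ∀ D A m n d → evalPoly2 D A m n d ≡ evalCoeffs D (λ k l → evalRF (A k l) d) m n
evalPoly2-evalCoeffs D A m n d = trans (cong (foldr _+_ 0ℚ) (ListP.map-cong (λ k → sumMap-upTo (suc (D ∸ k)) _) (upTo (suc D)))) (sumMap-upTo (suc D) _)

sumTo-vanish : ∀ N (f : ℕ → ℚ) → (∀ i → i < N → f i ≡ 0ℚ) → sumTo N f ≡ 0ℚ
sumTo-vanish N f h = trans (sumTo-cong N h) (sumTo-0 N)

evalCoeffs-cong : ∀ D {c c'} m n → (∀ k l → c k l ≡ c' k l) → evalCoeffs D c m n ≡ evalCoeffs D c' m n
evalCoeffs-cong D m n e = sumTo-cong (suc D) (λ k _ → sumTo-cong (suc (D ∸ k)) (λ l _ → cong (λ z → z * m ^ℚ k * n ^ℚ l) (e k l)))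

evalCoeffs-+ : ∀ D c c' m n → evalCoeffs D (λ k l → c k l + c' k l) m n ≡ evalCoeffs D c m n + evalCoeffs D c' m n
evalCoeffs-+ D c c' m n = trans (sumTo-cong (suc D) (λ k _ → trans (sumTo-cong (suc (D ∸ k)) (λ l _ → ring (c k l) (c' k l) (m ^ℚ k) (n ^ℚ l))) (sumTo-+ (suc (D ∸ k)) _ _))) (sumTo-+ (suc D) _ _)
  where
  ring : ∀ a b x y → (a + b) * x * y ≡ a * x * y + b * x * y
  ring = solve-∀ R

evalCoeffs-const : ∀ D c m n → (∀ k l → c (suc k) l ≡ 0ℚ) → (∀ l → c 0 (suc l) ≡ 0ℚ) → evalCoeffs D c m n ≡ c 0 0
evalCoeffs-const D c m n h1 h2 = begin
  evalCoeffs D c m n ≡⟨ sumTo-front D _ ⟩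
  sumTo (suc D) (λ l → c 0 l * 1ℚ * n ^ℚ l) + sumTo D (λ k → sumTo (suc (D ∸ suc k)) (λ l → c (suc k) l * m ^ℚ suc k * n ^ℚ l))
    ≡⟨ cong₂ _+_ (sumTo-front D _) (sumTo-vanish D _ (λ k _ → sumTo-vanish (suc (D ∸ suc k)) _ (λ l _ → trans (cong (λ z → z * m ^ℚ suc k * n ^ℚ l) (h1 k l)) (trans (cong (_* n ^ℚ l) (ℚP.*-zeroˡ (m ^ℚ suc k))) (ℚP.*-zeroˡ (n ^ℚ l)))))) ⟩
  (c 0 0 * 1ℚ * 1ℚ + sumTo D (λ l → c 0 (suc l) * 1ℚ * n ^ℚ suc l)) + 0ℚ
    ≡⟨ cong (λ z → (c 0 0 * 1ℚ * 1ℚ + z) + 0ℚ) (sumTo-vanish D _ (λ l _ → trans (cong (λ z → z * 1ℚ * n ^ℚ suc l) (h2 l)) (trans (cong (_* n ^ℚ suc l) (ℚP.*-zeroˡ 1ℚ)) (ℚP.*-zeroˡ (n ^ℚ suc l))))) ⟩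
  (c 0 0 * 1ℚ * 1ℚ + 0ℚ) + 0ℚ ≡⟨ ring (c 0 0) ⟩
  c 0 0 ∎
  where
  open ≡-Reasoning
  ring : ∀ a → (a * 1ℚ * 1ℚ + 0ℚ) + 0ℚ ≡ a
  ring = solve-∀ R

evalCoeffs-m· : ∀ D c c' m n → (∀ l → c' 0 l ≡ 0ℚ) → (∀ k l → c' (suc k) l ≡ c k l) → evalCoeffs (suc D) c' m n ≡ m * evalCoeffs D c m n
evalCoeffs-m· D c c' m n h0 hs = begin
  evalCoeffs (suc D) c' m n ≡⟨ sumTo-front (suc D) _ ⟩
  sumTo (suc (suc D)) (λ l → c' 0 l * 1ℚ * n ^ℚ l) + sumTo (suc D) (λ k → sumTo (suc (D ∸ k)) (λ l → c' (suc k) l * m ^ℚ suc k * n ^ℚ l))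
    ≡⟨ cong₂ _+_ (sumTo-vanish (suc (suc D)) _ (λ l _ → trans (cong (λ z → z * 1ℚ * n ^ℚ l) (h0 l)) (trans (cong (_* n ^ℚ l) (ℚP.*-zeroˡ 1ℚ)) (ℚP.*-zeroˡ (n ^ℚ l)))))
                 (sumTo-cong (suc D) (λ k _ → trans (sumTo-cong (suc (D ∸ k)) (λ l _ → trans (cong (λ z → z * m ^ℚ suc k * n ^ℚ l) (hs k l)) (ring m (c k l) (m ^ℚ k) (n ^ℚ l)))) (sumTo-*ˡ (suc (D ∸ k)) m _))) ⟩
  0ℚ + sumTo (suc D) (λ k → m * sumTo (suc (D ∸ k)) (λ l → c k l * m ^ℚ k * n ^ℚ l)) ≡⟨ trans (ℚP.+-identityˡ _) (sumTo-*ˡ (suc D) m _) ⟩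
  m * evalCoeffs D c m n ∎
  where
  open ≡-Reasoning
  ring : ∀ m a x y → a * (m * x) * y ≡ m * (a * x * y)
  ring = solve-∀ R

evalCoeffs-n· : ∀ D c c' m n → (∀ k → c' k 0 ≡ 0ℚ) → (∀ k l → c' k (suc l) ≡ c k l) → evalCoeffs (suc D) c' m n ≡ n * evalCoeffs D c m n
evalCoeffs-n· D c c' m n h0 hs = begin
  evalCoeffs (suc D) c' m n ≡⟨ sumTo-cong (suc (suc D)) (λ k _ → shift-row k (suc D ∸ k)) ⟩
  sumTo (suc D) (λ k → n * sumTo (suc D ∸ k) (term k)) + n * sumTo (D ∸ D) (term (suc D))
    ≡⟨ cong₂ _+_ (sumTo-cong (suc D) (λ k k< → cong (λ z → n * sumTo z (term k)) (ℕP.+-∸-assoc 1 (ℕP.≤-pred k<)))) (cong (λ z → n * sumTo z (term (suc D))) (ℕP.n∸n≡0 D)) ⟩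
  sumTo (suc D) (λ k → n * sumTo (suc (D ∸ k)) (term k)) + n * 0ℚ ≡⟨ trans (cong (sumTo (suc D) (λ k → n * sumTo (suc (D ∸ k)) (term k)) +_) (ℚP.*-zeroʳ n)) (ℚP.+-identityʳ _) ⟩
  sumTo (suc D) (λ k → n * sumTo (suc (D ∸ k)) (term k)) ≡⟨ sumTo-*ˡ (suc D) n _ ⟩
  n * evalCoeffs D c m n ∎
  where
  open ≡-Reasoning
  term : ℕ → ℕ → ℚ
  term k l = c k l * m ^ℚ k * n ^ℚ l
  ring : ∀ n a x y → a * x * (n * y) ≡ n * (a * x * y)
  ring = solve-∀ R
  shift-row : ∀ k X → sumTo (suc X) (λ l → c' k l * m ^ℚ k * n ^ℚ l) ≡ n * sumTo X (term k)
  shift-row k X = begin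
    sumTo (suc X) (λ l → c' k l * m ^ℚ k * n ^ℚ l) ≡⟨ sumTo-front X _ ⟩
    c' k 0 * m ^ℚ k * 1ℚ + sumTo X (λ l → c' k (suc l) * m ^ℚ k * n ^ℚ suc l)
      ≡⟨ cong₂ _+_ (trans (cong (λ z → z * m ^ℚ k * 1ℚ) (h0 k)) (trans (cong (_* 1ℚ) (ℚP.*-zeroˡ (m ^ℚ k))) (ℚP.*-zeroˡ 1ℚ)))
                   (trans (sumTo-cong X (λ l _ → trans (cong (λ z → z * m ^ℚ k * n ^ℚ suc l) (hs k l)) (ring n (c k l) (m ^ℚ k) (n ^ℚ l)))) (sumTo-*ˡ X n _)) ⟩
    0ℚ + n * sumTo X (term k) ≡⟨ ℚP.+-identityˡ _ ⟩
    n * sumTo X (term k) ∎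

evalCoeffs-raise : ∀ D c m n → (∀ k l → D < k ℕ.+ l → c k l ≡ 0ℚ) → evalCoeffs (suc D) c m n ≡ evalCoeffs D c m n
evalCoeffs-raise D c m n hz = begin
  evalCoeffs (suc D) c m n ≡⟨ cong₂ _+_ (sumTo-cong (suc D) (λ k k< → cong (λ z → sumTo (suc z) (term k)) (ℕP.+-∸-assoc 1 (ℕP.≤-pred k<)))) (sumTo-vanish (suc (D ∸ D)) _ (λ l _ → term-vanishes (suc D) l (ℕP.m≤m+n (suc D) l))) ⟩
  sumTo (suc D) (λ k → sumTo (suc (suc (D ∸ k))) (term k)) + 0ℚ ≡⟨ trans (ℚP.+-identityʳ _) (sumTo-cong (suc D) (λ k k< → trans (cong (sumTo (suc (D ∸ k)) (term k) +_) (term-vanishes k (suc (D ∸ k)) (beyond-bound k (ℕP.≤-pred k<)))) (ℚP.+-identityʳ _))) ⟩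
  evalCoeffs D c m n ∎
  where
  open ≡-Reasoning
  term : ℕ → ℕ → ℚ
  term k l = c k l * m ^ℚ k * n ^ℚ l
  term-vanishes : ∀ k l → D < k ℕ.+ l → term k l ≡ 0ℚ
  term-vanishes k l p = trans (cong (λ z → z * m ^ℚ k * n ^ℚ l) (hz k l p)) (trans (cong (_* n ^ℚ l) (ℚP.*-zeroˡ (m ^ℚ k))) (ℚP.*-zeroˡ (n ^ℚ l)))
  beyond-bound : ∀ k → k ≤ D → D < k ℕ.+ suc (D ∸ k)
  beyond-bound k k≤D = ℕP.≤-reflexive (sym (trans (ℕP.+-suc k (D ∸ k)) (cong suc (ℕP.m+[n∸m]≡n k≤D))))

coeffs : ∀ {D} → MN D → ℕ → ℕ → PosRatFun
coeffs (const r) zero zero = r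
coeffs (const r) zero (suc l) = constR 0ℚ
coeffs (const r) (suc k) l = constR 0ℚ
coeffs (e ⊕ f) k l = addR (coeffs e k l) (coeffs f k l)
coeffs (m· e) zero l = constR 0ℚ
coeffs (m· e) (suc k) l = coeffs e k l
coeffs (n· e) k zero = constR 0ℚ
coeffs (n· e) k (suc l) = coeffs e k l
coeffs (raise e) k l = coeffs e k l

coeffs-highDegree : ∀ {D} (e : MN D) k l d → 1 ≤ d → D < k ℕ.+ l → evalR (coeffs e k l) d ≡ 0ℚ
coeffs-highDegree (const r) zero zero d h ()
coeffs-highDegree (const r) zero (suc l) d h p = constR-eval 0ℚ d
coeffs-highDegree (const r) (suc k) l d h p = constR-eval 0ℚ d
coeffs-highDegree (e ⊕ f) k l d h p = trans (addR-eval (coeffs e k l) (coeffs f k l) d h) (trans (cong₂ _+_ (coeffs-highDegree e k l d h p) (coeffs-highDegree f k l d h p)) (ℚP.+-identityˡ 0ℚ))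
coeffs-highDegree (m· e) zero l d h p = constR-eval 0ℚ d
coeffs-highDegree (m· e) (suc k) l d h (s≤s p) = coeffs-highDegree e k l d h p
coeffs-highDegree (n· e) k zero d h p = constR-eval 0ℚ d
coeffs-highDegree (n· e) k (suc l) d h p = coeffs-highDegree e k l d h (ℕP.≤-pred (ℕP.≤-trans p (ℕP.≤-reflexive (ℕP.+-suc k l))))
coeffs-highDegree (raise e) k l d h p = coeffs-highDegree e k l d h (ℕP.<-trans ℕP.≤-refl p)

coeffs-sound : ∀ {D} (e : MN D) d → 1 ≤ d → ∀ m n → evalCoeffs D (λ k l → evalR (coeffs e k l) d) m n ≡ ⟦ e ⟧ d m n
coeffs-sound {D} (const r) d h m n = evalCoeffs-const D (λ k l → evalR (coeffs (const r) k l) d) m n (λ k l → constR-eval 0ℚ d) (λ l → constR-eval 0ℚ d)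
coeffs-sound {D} (e ⊕ f) d h m n = trans (evalCoeffs-cong D m n (λ k l → addR-eval (coeffs e k l) (coeffs f k l) d h)) (trans (evalCoeffs-+ D (λ k l → evalR (coeffs e k l) d) (λ k l → evalR (coeffs f k l) d) m n) (cong₂ _+_ (coeffs-sound e d h m n) (coeffs-sound f d h m n)))
coeffs-sound {suc D} (m· e) d h m n = trans (evalCoeffs-m· D (λ k l → evalR (coeffs e k l) d) (λ k l → evalR (coeffs (m· e) k l) d) m n (λ l → constR-eval 0ℚ d) (λ k l → refl)) (cong (m *_) (coeffs-sound e d h m n))
coeffs-sound {suc D} (n· e) d h m n = trans (evalCoeffs-n· D (λ k l → evalR (coeffs e k l) d) (λ k l → evalR (coeffs (n· e) k l) d) m n (λ k → constR-eval 0ℚ d) (λ k l → refl)) (cong (n *_) (coeffs-sound e d h m n))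
coeffs-sound {suc D} (raise e) d h m n = trans (evalCoeffs-raise D (λ k l → evalR (coeffs e k l) d) m n (λ k l p → coeffs-highDegree e k l d h p)) (coeffs-sound e d h m n)

evalPoly2-coeffs : ∀ {D} (e : MN D) d → 1 ≤ d → ∀ m n → evalPoly2 D (λ k l → proj₁ (coeffs e k l)) m n (toℚ d) ≡ ⟦ e ⟧ d m n
evalPoly2-coeffs {D} e d h m n = trans (evalPoly2-evalCoeffs D (λ k l → proj₁ (coeffs e k l)) m n (toℚ d)) (coeffs-sound e d h m n)

Mℚ : ℕ → ℕ → ℚ
Mℚ d t = toℚ (M d t)

Mℚ-rec : ∀ d t → Mℚ d (suc (suc t)) ≡ Mℚ d (suc t) + toℚ d * Mℚ d t
Mℚ-rec d t = trans (toℚ-+ (M d (suc t)) (d ℕ.* M d t)) (cong (Mℚ d (suc t) +_) (toℚ-* d (M d t)))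

valM : ∀ {D} → MN D → ℕ → ℚ → ℚ
valM e d m = ⟦ e ⟧ d m 0ℚ

-- A pair (A, B) of polynomials in m stands for the sequence
--   φ (A , B) t = A·M(t) + B·M(t+1),
-- which satisfies the recurrence of M; the operations below act on such pairs.
Comb : ℕ → Set
Comb D = MN D × MN D

φ : ∀ {D} → Comb D → ℕ → ℚ → ℕ → ℚ
φ (a , b) d m t = valM a d m * Mℚ d t + valM b d m * Mℚ d (suc t)

dR : PosRatFun
dR = polyR (0ℚ ∷ 1ℚ ∷ [])

dR-eval : ∀ d → evalR dR d ≡ toℚ d
dR-eval d = trans (polyR-eval (0ℚ ∷ 1ℚ ∷ []) d) (ring (toℚ d))
  where
  ring : ∀ x → 0ℚ + x * (1ℚ + x * 0ℚ) ≡ x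
  ring = solve-∀ R

addC : ∀ {D} → Comb D → Comb D → Comb D
addC (a , b) (a' , b') = (a ⊕ a') , (b ⊕ b')

scaleC : ∀ {D} → PosRatFun → Comb D → Comb D
scaleC r (a , b) = scaleMN r a , scaleMN r b

shiftC : ∀ {D} → Comb D → Comb D
shiftC (a , b) = scaleMN dR b , (a ⊕ b)

zeroC : ∀ {D} → Comb D
zeroC = zeroMN , zeroMN

raiseC : ∀ {D} → Comb D → Comb (suc D)
raiseC (a , b) = raise a , raise b

m·C : ∀ {D} → Comb D → Comb (suc D)
m·C (a , b) = m· a , m· b

negC : ∀ {D} → Comb D → Comb D
negC = scaleC (constR (- 1ℚ))

valM-scale : ∀ {D} r (e : MN D) d → 1 ≤ d → ∀ m → valM (scaleMN r e) d m ≡ evalR r d * valM e d m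
valM-scale r e d h m = scaleMN-eval r e d h m 0ℚ

φ-addC : ∀ {D} (u v : Comb D) d m t → φ (addC u v) d m t ≡ φ u d m t + φ v d m t
φ-addC (a , b) (a' , b') d m t = ring (valM a d m) (valM a' d m) (valM b d m) (valM b' d m) (Mℚ d t) (Mℚ d (suc t))
  where
  ring : ∀ a a' b b' x y → (a + a') * x + (b + b') * y ≡ (a * x + b * y) + (a' * x + b' * y)
  ring = solve-∀ R

φ-scaleC : ∀ {D} r (u : Comb D) d → 1 ≤ d → ∀ m t → φ (scaleC r u) d m t ≡ evalR r d * φ u d m t
φ-scaleC r (a , b) d h m t = trans (cong₂ (λ p q → p * Mℚ d t + q * Mℚ d (suc t)) (valM-scale r a d h m) (valM-scale r b d h m)) (ring (evalR r d) (valM a d m) (valM b d m) (Mℚ d t) (Mℚ d (suc t)))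
  where
  ring : ∀ c a b x y → c * a * x + c * b * y ≡ c * (a * x + b * y)
  ring = solve-∀ R

φ-negC : ∀ {D} (u : Comb D) d → 1 ≤ d → ∀ m t → φ (negC u) d m t ≡ - φ u d m t
φ-negC u d h m t = trans (φ-scaleC (constR (- 1ℚ)) u d h m t) (trans (cong (_* φ u d m t) (constR-eval (- 1ℚ) d)) (ring (φ u d m t)))
  where
  ring : ∀ a → (- 1ℚ) * a ≡ - a
  ring = solve-∀ R

φ-shiftC : ∀ {D} (u : Comb D) d → 1 ≤ d → ∀ m t → φ (shiftC u) d m t ≡ φ u d m (suc t)
φ-shiftC (a , b) d h m t = begin
  valM (scaleMN dR b) d m * Mℚ d t + (valM a d m + valM b d m) * Mℚ d (suc t) ≡⟨ cong (λ z → z * Mℚ d t + (valM a d m + valM b d m) * Mℚ d (suc t)) (trans (valM-scale dR b d h m) (cong (_* valM b d m) (dR-eval d))) ⟩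
  toℚ d * valM b d m * Mℚ d t + (valM a d m + valM b d m) * Mℚ d (suc t) ≡⟨ ring (toℚ d) (valM a d m) (valM b d m) (Mℚ d t) (Mℚ d (suc t)) ⟩
  valM a d m * Mℚ d (suc t) + valM b d m * (Mℚ d (suc t) + toℚ d * Mℚ d t) ≡⟨ cong (λ z → valM a d m * Mℚ d (suc t) + valM b d m * z) (sym (Mℚ-rec d t)) ⟩
  valM a d m * Mℚ d (suc t) + valM b d m * Mℚ d (suc (suc t)) ∎
  where
  open ≡-Reasoning
  ring : ∀ d a b x y → d * b * x + (a + b) * y ≡ a * y + b * (y + d * x)
  ring = solve-∀ R

φ-zeroC : ∀ {D} d m t → φ (zeroC {D}) d m t ≡ 0ℚ
φ-zeroC d m t = trans (cong₂ (λ p q → p * Mℚ d t + q * Mℚ d (suc t)) (constR-eval 0ℚ d) (constR-eval 0ℚ d)) (ring (Mℚ d t) (Mℚ d (suc t)))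
  where
  ring : ∀ x y → 0ℚ * x + 0ℚ * y ≡ 0ℚ
  ring = solve-∀ R

φ-m·C : ∀ {D} (u : Comb D) d m t → φ (m·C u) d m t ≡ m * φ u d m t
φ-m·C (a , b) d m t = ring m (valM a d m) (valM b d m) (Mℚ d t) (Mℚ d (suc t))
  where
  ring : ∀ m a b x y → m * a * x + m * b * y ≡ m * (a * x + b * y)
  ring = solve-∀ R

φ-rec : ∀ {D} (u : Comb D) d m t → φ u d m (suc (suc t)) ≡ φ u d m (suc t) + toℚ d * φ u d m t
φ-rec (a , b) d m t = trans (cong (λ z → valM a d m * Mℚ d (suc (suc t)) + valM b d m * z) (Mℚ-rec d (suc t)))
  (trans (cong (λ z → valM a d m * z + valM b d m * (Mℚ d (suc (suc t)) + toℚ d * Mℚ d (suc t))) (Mℚ-rec d t))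
    (ring (valM a d m) (valM b d m) (toℚ d) (Mℚ d t) (Mℚ d (suc t)) (Mℚ d (suc (suc t)))))
  where
  ring : ∀ a b d x y z → a * (y + d * x) + b * (z + d * y) ≡ (a * y + b * z) + d * (a * x + b * y)
  ring = solve-∀ R

-- 'BinExp D' is a list of pairs c₀, c₁, …, c_D with deg c_j ≤ D - j, standing for
--   binSum q t n k = Σ_j C(n, k+j)·φ c_j (t),  and its value  binVal q n = binSum q n n 0.
-- These are the functions f(n) = Σ_j C(n,j)(A_j M(n) + B_j M(n+1)) of total degree ≤ D.
infixr 5 _∷b_
data BinExp : ℕ → Set where
  single : Comb 0 → BinExp 0
  _∷b_ : ∀ {D} → Comb (suc D) → BinExp D → BinExp (suc D)

binSum : ∀ {D} → BinExp D → ℕ → ℚ → ℕ → ℕ → ℕ → ℚ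
binSum (single c) d m t n k = binomℚ n k * φ c d m t
binSum (c ∷b r) d m t n k = binomℚ n k * φ c d m t + binSum r d m t n (suc k)

binVal : ∀ {D} → BinExp D → ℕ → ℚ → ℕ → ℚ
binVal q d m n = binSum q d m n n 0

addB : ∀ {D} → BinExp D → BinExp D → BinExp D
addB (single c) (single c') = single (addC c c')
addB (c ∷b r) (c' ∷b r') = addC c c' ∷b addB r r'

scaleB : ∀ {D} → PosRatFun → BinExp D → BinExp D
scaleB s (single c) = single (scaleC s c)
scaleB s (c ∷b r) = scaleC s c ∷b scaleB s r

shiftB : ∀ {D} → BinExp D → BinExp D
shiftB (single c) = single (shiftC c)
shiftB (c ∷b r) = shiftC c ∷b shiftB r

zeroB : ∀ {D} → BinExp D
zeroB {zero} = single zeroC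
zeroB {suc D} = zeroC ∷b zeroB

raiseB : ∀ {D} → BinExp D → BinExp (suc D)
raiseB (single c) = raiseC c ∷b single zeroC
raiseB (c ∷b r) = raiseC c ∷b raiseB r

tailB : ∀ {D} → BinExp D → BinExp D
tailB (single c) = single zeroC
tailB (c ∷b r) = raiseB r

m·B : ∀ {D} → BinExp D → BinExp (suc D)
m·B (single c) = m·C c ∷b single zeroC
m·B (c ∷b r) = m·C c ∷b m·B r

headB : ∀ {D} → BinExp D → Comb D
headB (single c) = c
headB (c ∷b r) = c

binSum-addB : ∀ {D} (q q' : BinExp D) d m t n k → binSum (addB q q') d m t n k ≡ binSum q d m t n k + binSum q' d m t n k
binSum-addB (single c) (single c') d m t n k = trans (cong (binomℚ n k *_) (φ-addC c c' d m t)) (ℚP.*-distribˡ-+ (binomℚ n k) _ _)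
binSum-addB (c ∷b r) (c' ∷b r') d m t n k = trans (cong₂ _+_ (cong (binomℚ n k *_) (φ-addC c c' d m t)) (binSum-addB r r' d m t n (suc k))) (ring (binomℚ n k) (φ c d m t) (φ c' d m t) _ _)
  where
  ring : ∀ b x y u v → b * (x + y) + (u + v) ≡ (b * x + u) + (b * y + v)
  ring = solve-∀ R

binSum-scaleB : ∀ {D} s (q : BinExp D) d → 1 ≤ d → ∀ m t n k → binSum (scaleB s q) d m t n k ≡ evalR s d * binSum q d m t n k
binSum-scaleB s (single c) d h m t n k = trans (cong (binomℚ n k *_) (φ-scaleC s c d h m t)) (ring (binomℚ n k) (evalR s d) _)
  where
  ring : ∀ b c x → b * (c * x) ≡ c * (b * x)
  ring = solve-∀ R
binSum-scaleB s (c ∷b r) d h m t n k = trans (cong₂ _+_ (cong (binomℚ n k *_) (φ-scaleC s c d h m t)) (binSum-scaleB s r d h m t n (suc k))) (ring (binomℚ n k) (evalR s d) _ _)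
  where
  ring : ∀ b c x u → b * (c * x) + c * u ≡ c * (b * x + u)
  ring = solve-∀ R

binSum-shiftB : ∀ {D} (q : BinExp D) d → 1 ≤ d → ∀ m t n k → binSum (shiftB q) d m t n k ≡ binSum q d m (suc t) n k
binSum-shiftB (single c) d h m t n k = cong (binomℚ n k *_) (φ-shiftC c d h m t)
binSum-shiftB (c ∷b r) d h m t n k = cong₂ _+_ (cong (binomℚ n k *_) (φ-shiftC c d h m t)) (binSum-shiftB r d h m t n (suc k))

binSum-zeroB : ∀ {D} d m t n k → binSum (zeroB {D}) d m t n k ≡ 0ℚ
binSum-zeroB {zero} d m t n k = trans (cong (binomℚ n k *_) (φ-zeroC {0} d m t)) (ℚP.*-zeroʳ (binomℚ n k))
binSum-zeroB {suc D} d m t n k = trans (cong₂ _+_ (trans (cong (binomℚ n k *_) (φ-zeroC {suc D} d m t)) (ℚP.*-zeroʳ (binomℚ n k))) (binSum-zeroB {D} d m t n (suc k))) (ℚP.+-identityˡ 0ℚ)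

binSum-raiseB : ∀ {D} (q : BinExp D) d m t n k → binSum (raiseB q) d m t n k ≡ binSum q d m t n k
binSum-raiseB (single c) d m t n k = trans (cong (binomℚ n k * φ c d m t +_) (trans (cong (binomℚ n (suc k) *_) (φ-zeroC {0} d m t)) (ℚP.*-zeroʳ (binomℚ n (suc k))))) (ℚP.+-identityʳ (binomℚ n k * φ c d m t))
binSum-raiseB (c ∷b r) d m t n k = cong (binomℚ n k * φ c d m t +_) (binSum-raiseB r d m t n (suc k))

binSum-m·B : ∀ {D} (q : BinExp D) d m t n k → binSum (m·B q) d m t n k ≡ m * binSum q d m t n k
binSum-m·B (single c) d m t n k = trans (cong₂ _+_ (cong (binomℚ n k *_) (φ-m·C c d m t)) (trans (cong (binomℚ n (suc k) *_) (φ-zeroC {0} d m t)) (ℚP.*-zeroʳ (binomℚ n (suc k))))) (ring (binomℚ n k) m (φ c d m t))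
  where
  ring : ∀ b m x → b * (m * x) + 0ℚ ≡ m * (b * x)
  ring = solve-∀ R
binSum-m·B (c ∷b r) d m t n k = trans (cong₂ _+_ (cong (binomℚ n k *_) (φ-m·C c d m t)) (binSum-m·B r d m t n (suc k))) (ring (binomℚ n k) m (φ c d m t) _)
  where
  ring : ∀ b m x u → b * (m * x) + m * u ≡ m * (b * x + u)
  ring = solve-∀ R

binSum-rec : ∀ {D} (q : BinExp D) d m t n k → binSum q d m (suc (suc t)) n k ≡ binSum q d m (suc t) n k + toℚ d * binSum q d m t n k
binSum-rec (single c) d m t n k = trans (cong (binomℚ n k *_) (φ-rec c d m t)) (ring (binomℚ n k) (toℚ d) _ _)
  where
  ring : ∀ b d x y → b * (y + d * x) ≡ b * y + d * (b * x)
  ring = solve-∀ R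
binSum-rec (c ∷b r) d m t n k = trans (cong₂ _+_ (cong (binomℚ n k *_) (φ-rec c d m t)) (binSum-rec r d m t n (suc k))) (ring (binomℚ n k) (toℚ d) _ _ _ _)
  where
  ring : ∀ b d x y u v → b * (y + d * x) + (v + d * u) ≡ (b * y + v) + d * (b * x + u)
  ring = solve-∀ R

binSum-pascal : ∀ {D} (q : BinExp D) d m t n k → binSum q d m t (suc n) (suc k) ≡ binSum q d m t n (suc k) + binSum q d m t n k
binSum-pascal (single c) d m t n k = trans (cong (_* φ c d m t) (binomℚ-suc n k)) (ring (binomℚ n k) (binomℚ n (suc k)) (φ c d m t))
  where
  ring : ∀ a b x → (a + b) * x ≡ b * x + a * x
  ring = solve-∀ R
binSum-pascal (c ∷b r) d m t n k = trans (cong₂ _+_ (cong (_* φ c d m t) (binomℚ-suc n k)) (binSum-pascal r d m t n (suc k))) (ring (binomℚ n k) (binomℚ n (suc k)) (φ c d m t) _ _)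
  where
  ring : ∀ a b x u v → (a + b) * x + (u + v) ≡ (b * x + u) + (a * x + v)
  ring = solve-∀ R

binSum-pascal₀ : ∀ {D} (q : BinExp D) d m t n → binSum q d m t (suc n) 0 ≡ binSum q d m t n 0 + binSum (tailB q) d m t n 0
binSum-pascal₀ (single c) d m t n = trans (sym (ℚP.+-identityʳ (binomℚ (suc n) 0 * φ c d m t))) (cong (binomℚ (suc n) 0 * φ c d m t +_) (sym (trans (cong (binomℚ n 0 *_) (φ-zeroC {0} d m t)) (ℚP.*-zeroʳ (binomℚ n 0)))))
binSum-pascal₀ (c ∷b r) d m t n = trans (cong (binomℚ (suc n) 0 * φ c d m t +_) (binSum-pascal r d m t n 0)) (trans (sym (ℚP.+-assoc (binomℚ (suc n) 0 * φ c d m t) (binSum r d m t n 1) (binSum r d m t n 0))) (cong ((binomℚ (suc n) 0 * φ c d m t + binSum r d m t n 1) +_) (sym (binSum-raiseB r d m t n 0))))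

binSum-atZero : ∀ {D} (q : BinExp D) d m t k → binSum q d m t 0 (suc k) ≡ 0ℚ
binSum-atZero (single c) d m t k = ℚP.*-zeroˡ (φ c d m t)
binSum-atZero (c ∷b r) d m t k = trans (cong₂ _+_ (ℚP.*-zeroˡ (φ c d m t)) (binSum-atZero r d m t (suc k))) (ℚP.+-identityˡ 0ℚ)

binSum-atZero₀ : ∀ {D} (q : BinExp D) d m t → binSum q d m t 0 0 ≡ φ (headB q) d m t
binSum-atZero₀ (single c) d m t = ℚP.*-identityˡ (φ c d m t)
binSum-atZero₀ (c ∷b r) d m t = trans (cong₂ _+_ (ℚP.*-identityˡ (φ c d m t)) (binSum-atZero r d m t 0)) (ℚP.+-identityʳ (φ c d m t))

binSum-headB : ∀ {D} (q : BinExp D) d m t n k → binSum q d m t n k ≡ binomℚ n k * φ (headB q) d m t + binSum (tailB q) d m t n (suc k)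
binSum-headB (single c) d m t n k = sym (trans (cong (binomℚ n k * φ c d m t +_) (trans (cong (binomℚ n (suc k) *_) (φ-zeroC {0} d m t)) (ℚP.*-zeroʳ (binomℚ n (suc k))))) (ℚP.+-identityʳ (binomℚ n k * φ c d m t)))
binSum-headB (c ∷b r) d m t n k = cong (binomℚ n k * φ c d m t +_) (sym (binSum-raiseB r d m t n (suc k)))

binSum-tail-raise : ∀ {D} (q : BinExp D) d m t n k → binSum (tailB (raiseB q)) d m t n k ≡ binSum (tailB q) d m t n k
binSum-tail-raise (single c) d m t n k = binSum-raiseB (single zeroC) d m t n k
binSum-tail-raise (c ∷b r) d m t n k = binSum-raiseB (raiseB r) d m t n k

-- binVal q fails the recurrence of M by 'defect q', which depends only on tailB q:
--   binVal q (n+2) = binVal q (n+1) + d·binVal q n + defect q n.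
defect : ∀ {D} → BinExp D → ℕ → ℚ → ℕ → ℚ
defect q d m n = ((binSum (tailB q) d m (suc (suc n)) n 0 + binSum (tailB q) d m (suc (suc n)) n 0) - binSum (tailB q) d m (suc n) n 0) + binSum (tailB (tailB q)) d m (suc (suc n)) n 0

binVal-rec : ∀ {D} (q : BinExp D) d m n → binVal q d m (suc (suc n)) ≡ binVal q d m (suc n) + toℚ d * binVal q d m n + defect q d m n
binVal-rec q d m n = begin
  binSum q d m (2+ n) (2+ n) 0 ≡⟨ binSum-pascal₀ q d m (2+ n) (suc n) ⟩
  binSum q d m (2+ n) (suc n) 0 + binSum (tailB q) d m (2+ n) (suc n) 0 ≡⟨ cong₂ _+_ (binSum-pascal₀ q d m (2+ n) n) (binSum-pascal₀ (tailB q) d m (2+ n) n) ⟩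
  (binSum q d m (2+ n) n 0 + binSum (tailB q) d m (2+ n) n 0) + (binSum (tailB q) d m (2+ n) n 0 + binSum (tailB (tailB q)) d m (2+ n) n 0)
    ≡⟨ cong (λ z → (z + binSum (tailB q) d m (2+ n) n 0) + (binSum (tailB q) d m (2+ n) n 0 + binSum (tailB (tailB q)) d m (2+ n) n 0)) (binSum-rec q d m n n 0) ⟩
  ((binSum q d m (suc n) n 0 + toℚ d * binSum q d m n n 0) + binSum (tailB q) d m (2+ n) n 0) + (binSum (tailB q) d m (2+ n) n 0 + binSum (tailB (tailB q)) d m (2+ n) n 0)
    ≡⟨ ring (binSum q d m (suc n) n 0) (toℚ d) (binSum q d m n n 0) (binSum (tailB q) d m (2+ n) n 0) (binSum (tailB (tailB q)) d m (2+ n) n 0) (binSum (tailB q) d m (suc n) n 0) ⟩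
  ((binSum q d m (suc n) n 0 + binSum (tailB q) d m (suc n) n 0) + toℚ d * binSum q d m n n 0) + defect q d m n
    ≡⟨ cong (λ z → (z + toℚ d * binSum q d m n n 0) + defect q d m n) (sym (binSum-pascal₀ q d m (suc n) n)) ⟩
  binVal q d m (suc n) + toℚ d * binVal q d m n + defect q d m n ∎
  where
  open ≡-Reasoning
  2+ : ℕ → ℕ
  2+ x = suc (suc x)
  ring : ∀ a d b c e f → ((a + d * b) + c) + (c + e) ≡ ((a + f) + d * b) + (((c + c) - f) + e)
  ring = solve-∀ R

two : ℚ
two = 1ℚ + 1ℚ

oneTwoDR : PosRatFun
oneTwoDR = polyR (1ℚ ∷ two ∷ [])

oneTwoDR-eval : ∀ d → evalR oneTwoDR d ≡ 1ℚ + two * toℚ d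
oneTwoDR-eval d = trans (polyR-eval (1ℚ ∷ two ∷ []) d) (ring (toℚ d))
  where
  ring : ∀ x → 1ℚ + x * ((1ℚ + 1ℚ) + x * 0ℚ) ≡ 1ℚ + (1ℚ + 1ℚ) * x
  ring = solve-∀ R

twoDR : PosRatFun
twoDR = polyR (0ℚ ∷ two ∷ [])

twoDR-eval : ∀ d → evalR twoDR d ≡ two * toℚ d
twoDR-eval d = trans (polyR-eval (0ℚ ∷ two ∷ []) d) (ring (toℚ d))
  where
  ring : ∀ x → 0ℚ + x * ((1ℚ + 1ℚ) + x * 0ℚ) ≡ (1ℚ + 1ℚ) * x
  ring = solve-∀ R

oneDR : PosRatFun
oneDR = polyR (1ℚ ∷ 1ℚ ∷ [])

oneDR-eval : ∀ d → evalR oneDR d ≡ 1ℚ + toℚ d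
oneDR-eval d = trans (polyR-eval (1ℚ ∷ 1ℚ ∷ []) d) (ring (toℚ d))
  where
  ring : ∀ x → 1ℚ + x * (1ℚ + x * 0ℚ) ≡ 1ℚ + x
  ring = solve-∀ R

discPoly : Poly
discPoly = 0ℚ ∷ 1ℚ ∷ toℚ 4 ∷ []

discPoly-eval : ∀ d → evalPoly discPoly (toℚ d) ≡ toℚ (d ℕ.* (1 ℕ.+ d ℕ.* 4))
discPoly-eval d = trans (ring (toℚ d) (toℚ 4)) (sym (trans (toℚ-* d (1 ℕ.+ d ℕ.* 4)) (cong (toℚ d *_) (trans (toℚ-+ 1 (d ℕ.* 4)) (cong (1ℚ +_) (toℚ-* d 4))))))
  where
  ring : ∀ x c → 0ℚ + x * (1ℚ + x * (c + x * 0ℚ)) ≡ x * (1ℚ + x * c)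
  ring = solve-∀ R

discPoly≢0 : ∀ d → 1 ≤ d → ¬ (evalPoly discPoly (toℚ d) ≡ 0ℚ)
discPoly≢0 (suc d) _ e = toℚ-suc≢0ℚ (suc d ℕ.* 4 ℕ.+ d ℕ.* (1 ℕ.+ suc d ℕ.* 4)) (trans (sym (discPoly-eval (suc d))) e)

discInvR : PosRatFun
discInvR = recipR discPoly discPoly≢0

discInvR-inv : ∀ d → 1 ≤ d → evalR discInvR d * (toℚ d + toℚ 4 * (toℚ d * toℚ d)) ≡ 1ℚ
discInvR-inv d h = trans (cong₂ _*_ (recipR-eval discPoly discPoly≢0 d) (sym (ring (toℚ d) (toℚ 4)))) (inv-l _ (discPoly≢0 d h))
  where
  ring : ∀ x c → 0ℚ + x * (1ℚ + x * (c + x * 0ℚ)) ≡ x + c * (x * x)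
  ring = solve-∀ R

dPoly : Poly
dPoly = 0ℚ ∷ 1ℚ ∷ []

dPoly-eval : ∀ x → evalPoly dPoly x ≡ x
dPoly-eval = ring
  where
  ring : ∀ x → 0ℚ + x * (1ℚ + x * 0ℚ) ≡ x
  ring = solve-∀ R

dPoly≢0 : ∀ d → 1 ≤ d → ¬ (evalPoly dPoly (toℚ d) ≡ 0ℚ)
dPoly≢0 (suc d) _ e = toℚ-suc≢0ℚ d (trans (sym (dPoly-eval (toℚ (suc d)))) e)

dInvR : PosRatFun
dInvR = recipR dPoly dPoly≢0

dInvR-inv : ∀ d → 1 ≤ d → evalR dInvR d * toℚ d ≡ 1ℚ
dInvR-inv d h = trans (cong₂ _*_ (recipR-eval dPoly dPoly≢0 d) (sym (dPoly-eval (toℚ d)))) (inv-l _ (dPoly≢0 d h))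

toℚ4 : toℚ 4 ≡ two * two
toℚ4 = refl

discInvR-inv′ : ∀ d → 1 ≤ d → evalR discInvR d * (toℚ d + two * two * (toℚ d * toℚ d)) ≡ 1ℚ
discInvR-inv′ d h = trans (cong (λ z → evalR discInvR d * (toℚ d + z * (toℚ d * toℚ d))) (sym toℚ4)) (discInvR-inv d h)

minusOneR : PosRatFun
minusOneR = constR (- 1ℚ)

-- The map x ↦ 2·x(t+2) - x(t+1) on sequences φ c is invertible: on pairs it is a
-- linear map with determinant d + 4d², and 'invC' is its inverse.
invC : ∀ {E} → Comb E → Comb E
invC (a , b) = scaleMN discInvR (scaleMN oneTwoDR a ⊕ scaleMN minusOneR (scaleMN dR b)) , scaleMN discInvR (scaleMN twoDR b ⊕ scaleMN minusOneR a)

subC : ∀ {E} → Comb E → Comb E → Comb E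
subC u v = addC u (negC v)

shift2C : ∀ {E} → Comb E → Comb E
shift2C u = shiftC (shiftC u)

valM-invC₁ : ∀ {E} (a b : MN E) d → 1 ≤ d → ∀ m → valM (proj₁ (invC (a , b))) d m ≡ evalR discInvR d * ((1ℚ + two * toℚ d) * valM a d m + (- 1ℚ) * (toℚ d * valM b d m))
valM-invC₁ a b d h m = trans (valM-scale discInvR (scaleMN oneTwoDR a ⊕ scaleMN minusOneR (scaleMN dR b)) d h m) (cong (evalR discInvR d *_) (cong₂ _+_
  (trans (valM-scale oneTwoDR a d h m) (cong (_* valM a d m) (oneTwoDR-eval d)))
  (trans (valM-scale minusOneR (scaleMN dR b) d h m) (cong₂ _*_ (constR-eval (- 1ℚ) d) (trans (valM-scale dR b d h m) (cong (_* valM b d m) (dR-eval d)))))))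

valM-invC₂ : ∀ {E} (a b : MN E) d → 1 ≤ d → ∀ m → valM (proj₂ (invC (a , b))) d m ≡ evalR discInvR d * (two * toℚ d * valM b d m + (- 1ℚ) * valM a d m)
valM-invC₂ a b d h m = trans (valM-scale discInvR (scaleMN twoDR b ⊕ scaleMN minusOneR a) d h m) (cong (evalR discInvR d *_) (cong₂ _+_
  (trans (valM-scale twoDR b d h m) (cong (_* valM b d m) (twoDR-eval d)))
  (trans (valM-scale minusOneR a d h m) (cong (_* valM a d m) (constR-eval (- 1ℚ) d)))))

defectCombo : ℚ → ℚ → ℚ → ℚ → ℚ → ℚ
defectCombo c1 c2 y1 y2 y3 = ((c1 * y2 + c2 * y3) + (c1 * y2 + c2 * y3)) - (c1 * y1 + c2 * y2)

invC-spec : ∀ {E} (u : Comb E) d → 1 ≤ d → ∀ m t → (φ (invC u) d m (suc (suc t)) + φ (invC u) d m (suc (suc t))) - φ (invC u) d m (suc t) ≡ φ u d m t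
invC-spec (a , b) d h m t = begin
  defectCombo C1 C2 (Mℚ d (suc t)) (Mℚ d (suc (suc t))) (Mℚ d (suc (suc (suc t))))
    ≡⟨ cong (λ z → defectCombo C1 C2 (Mℚ d (suc t)) (Mℚ d (suc (suc t))) z) (Mℚ-rec d (suc t)) ⟩
  defectCombo C1 C2 (Mℚ d (suc t)) (Mℚ d (suc (suc t))) (Mℚ d (suc (suc t)) + toℚ d * Mℚ d (suc t))
    ≡⟨ cong (λ z → defectCombo C1 C2 (Mℚ d (suc t)) z (z + toℚ d * Mℚ d (suc t))) (Mℚ-rec d t) ⟩
  defectCombo C1 C2 (Mℚ d (suc t)) x2 (x2 + toℚ d * Mℚ d (suc t))
    ≡⟨ cong₂ (λ p q → defectCombo p q (Mℚ d (suc t)) x2 (x2 + toℚ d * Mℚ d (suc t))) (valM-invC₁ a b d h m) (valM-invC₂ a b d h m) ⟩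
  defectCombo (W * ((1ℚ + two * D) * A + (- 1ℚ) * (D * B))) (W * (two * D * B + (- 1ℚ) * A)) (Mℚ d (suc t)) x2 (x2 + D * Mℚ d (suc t))
    ≡⟨ ring-defectCombo W D A B (Mℚ d t) (Mℚ d (suc t)) ⟩
  (W * (D + two * two * (D * D))) * (A * Mℚ d t + B * Mℚ d (suc t)) ≡⟨ cong (_* (A * Mℚ d t + B * Mℚ d (suc t))) (discInvR-inv′ d h) ⟩
  1ℚ * (A * Mℚ d t + B * Mℚ d (suc t)) ≡⟨ ℚP.*-identityˡ _ ⟩
  φ (a , b) d m t ∎
  where
  open ≡-Reasoning
  C1 = valM (proj₁ (invC (a , b))) d m
  C2 = valM (proj₂ (invC (a , b))) d m
  D = toℚ d
  A = valM a d m
  B = valM b d m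
  W = evalR discInvR d
  x2 = Mℚ d (suc t) + toℚ d * Mℚ d t
  ring : ∀ W D A B x0 x1 → (((W * ((1ℚ + (1ℚ + 1ℚ) * D) * A + (- 1ℚ) * (D * B))) * (x1 + D * x0) + (W * ((1ℚ + 1ℚ) * D * B + (- 1ℚ) * A)) * ((x1 + D * x0) + D * x1))
                        + ((W * ((1ℚ + (1ℚ + 1ℚ) * D) * A + (- 1ℚ) * (D * B))) * (x1 + D * x0) + (W * ((1ℚ + 1ℚ) * D * B + (- 1ℚ) * A)) * ((x1 + D * x0) + D * x1)))
                        - ((W * ((1ℚ + (1ℚ + 1ℚ) * D) * A + (- 1ℚ) * (D * B))) * x1 + (W * ((1ℚ + 1ℚ) * D * B + (- 1ℚ) * A)) * (x1 + D * x0))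
                              ≡ (W * (D + (1ℚ + 1ℚ) * (1ℚ + 1ℚ) * (D * D))) * (A * x0 + B * x1)
  ring = solve-∀ R
  ring-defectCombo : ∀ W D A B x0 x1 → defectCombo (W * ((1ℚ + (1ℚ + 1ℚ) * D) * A + (- 1ℚ) * (D * B))) (W * ((1ℚ + 1ℚ) * D * B + (- 1ℚ) * A)) x1 (x1 + D * x0) ((x1 + D * x0) + D * x1)
                              ≡ (W * (D + (1ℚ + 1ℚ) * (1ℚ + 1ℚ) * (D * D))) * (A * x0 + B * x1)
  ring-defectCombo = ring

-- The coefficient equation solved at each position of 'solveB'.
invC-cancel : ∀ {E} (r0 h : Comb E) d → 1 ≤ d → ∀ m t →
  ((φ (invC (subC r0 (shift2C h))) d m (suc (suc t)) + φ (invC (subC r0 (shift2C h))) d m (suc (suc t))) - φ (invC (subC r0 (shift2C h))) d m (suc t)) + φ h d m (suc (suc t)) ≡ φ r0 d m t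
invC-cancel r0 h d hd m t = trans (cong (_+ φ h d m (suc (suc t))) (invC-spec (subC r0 (shift2C h)) d hd m t))
  (trans (cong (_+ φ h d m (suc (suc t))) (trans (φ-addC r0 (negC (shift2C h)) d m t) (cong (φ r0 d m t +_) (trans (φ-negC (shift2C h) d hd m t) (cong -_ (trans (φ-shiftC (shiftC h) d hd m t) (φ-shiftC h d hd m (suc t))))))))
    (ring (φ r0 d m t) (φ h d m (suc (suc t)))))
  where
  ring : ∀ a b → (a + - b) + b ≡ a
  ring = solve-∀ R

-- 'solveB r' solves  defectAt s = r  for s, position by position from the last pair.
solveStep : ∀ {D} → Comb (suc D) → BinExp D → BinExp (suc D)
solveStep r0 s' = invC (subC r0 (shift2C (raiseC (headB s')))) ∷b s'

solveB : ∀ {D} → BinExp D → BinExp D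
solveB (single r0) = single (invC (subC r0 (shift2C zeroC)))
solveB (r0 ∷b r') = solveStep r0 (solveB r')

-- The expression whose value at t = n, k = 0 is 'defect' of a pair prepended to s.
defectAt : ∀ {D} → BinExp D → ℕ → ℚ → ℕ → ℕ → ℕ → ℚ
defectAt s d m t n k = ((binSum s d m (suc (suc t)) n k + binSum s d m (suc (suc t)) n k) - binSum s d m (suc t) n k) + binSum (tailB s) d m (suc (suc t)) n k

solveB-spec : ∀ {D} (r : BinExp D) d → 1 ≤ d → ∀ m t n k → defectAt (solveB r) d m t n k ≡ binSum r d m t n k
solveB-spec (single r0) d hd m t n k = trans (ring (binomℚ n k) (φ c d m (suc (suc t))) (φ c d m (suc t)) (φ (zeroC {0}) d m (suc (suc t)))) (cong (binomℚ n k *_) (invC-cancel r0 zeroC d hd m t))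
  where
  c = invC (subC r0 (shift2C zeroC))
  ring : ∀ b x1 x2 z → ((b * x1 + b * x1) - b * x2) + b * z ≡ b * (((x1 + x1) - x2) + z)
  ring = solve-∀ R
solveB-spec (r0 ∷b r') d hd m t n k = begin
  defectAt (c ∷b s') d m t n k ≡⟨ cong (((binSum (c ∷b s') d m (suc (suc t)) n k + binSum (c ∷b s') d m (suc (suc t)) n k) - binSum (c ∷b s') d m (suc t) n k) +_) (trans (binSum-raiseB s' d m (suc (suc t)) n k) (binSum-headB s' d m (suc (suc t)) n k)) ⟩
  ((( b * X1 + P) + (b * X1 + P)) - (b * X2 + Q)) + (b * H + Z) ≡⟨ ring b X1 X2 H P Q Z ⟩
  b * (((X1 + X1) - X2) + H) + (((P + P) - Q) + Z) ≡⟨ cong₂ _+_ (cong (b *_) (invC-cancel r0 (raiseC (headB s')) d hd m t)) (solveB-spec r' d hd m t n (suc k)) ⟩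
  b * φ r0 d m t + binSum r' d m t n (suc k) ∎
  where
  open ≡-Reasoning
  s' = solveB r'
  c = invC (subC r0 (shift2C (raiseC (headB s'))))
  b = binomℚ n k
  X1 = φ c d m (suc (suc t))
  X2 = φ c d m (suc t)
  H = φ (headB s') d m (suc (suc t))
  P = binSum s' d m (suc (suc t)) n (suc k)
  Q = binSum s' d m (suc t) n (suc k)
  Z = binSum (tailB s') d m (suc (suc t)) n (suc k)
  ring : ∀ b x1 x2 h p q z → (((b * x1 + p) + (b * x1 + p)) - (b * x2 + q)) + (b * h + z) ≡ b * (((x1 + x1) - x2) + h) + (((p + p) - q) + z)
  ring = solve-∀ R

Expressible : ℕ → (ℕ → ℕ → ℕ → ℚ) → Set
Expressible D f = Σ (BinExp D) (λ q → ∀ d → 1 ≤ d → ∀ m n → binVal q d (toℚ m) n ≡ f d m n)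

PolyInM : ℕ → (ℕ → ℕ → ℚ) → Set
PolyInM D g = Σ (MN D) (λ e → ∀ d → 1 ≤ d → ∀ m → valM e d (toℚ m) ≡ g d m)

headB-raiseB : ∀ {D} (s : BinExp D) → headB (raiseB s) ≡ raiseC (headB s)
headB-raiseB (single c) = refl
headB-raiseB (c ∷b r) = refl

defect-prepend : ∀ {D} (c : Comb (suc D)) (s : BinExp D) d m n → defect (c ∷b s) d m n ≡ defectAt s d m n n 0
defect-prepend c s d m n = trans
  (cong₂ (λ u v → ((u + u) - v) + binSum (tailB (raiseB s)) d m (suc (suc n)) n 0)
         (binSum-raiseB s d m (suc (suc n)) n 0) (binSum-raiseB s d m (suc n) n 0))
  (cong (((binSum s d m (suc (suc n)) n 0 + binSum s d m (suc (suc n)) n 0) - binSum s d m (suc n) n 0) +_)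
        (binSum-tail-raise s d m (suc (suc n)) n 0))

recurrence-determined : (c : ℚ) (h u v : ℕ → ℚ) →
  (∀ n → u (suc (suc n)) ≡ u (suc n) + c * u n + h n) →
  (∀ n → v (suc (suc n)) ≡ v (suc n) + c * v n + h n) →
  u 0 ≡ v 0 → u 1 ≡ v 1 → ∀ n → u n ≡ v n
recurrence-determined c h u v u-rec v-rec u0 u1 n = proj₁ (consecutive n)
  where
  consecutive : ∀ n → (u n ≡ v n) × (u (suc n) ≡ v (suc n))
  consecutive zero = u0 , u1
  consecutive (suc n) with consecutive n
  ... | un , usn = usn , trans (u-rec n) (trans (cong₂ (λ x y → x + c * y + h n) usn un) (sym (v-rec n)))

Mℚ-2 : ∀ d → Mℚ d 2 ≡ 1ℚ + toℚ d
Mℚ-2 d = trans (Mℚ-rec d 0) (cong (1ℚ +_) (ℚP.*-identityʳ (toℚ d)))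

negMN : ∀ {D} → MN D → MN D
negMN = scaleMN minusOneR

valM-neg : ∀ {D} (e : MN D) d → 1 ≤ d → ∀ m → valM (negMN e) d m ≡ (- 1ℚ) * valM e d m
valM-neg e d h m = trans (valM-scale minusOneR e d h m) (cong (_* valM e d m) (constR-eval (- 1ℚ) d))

headAtOne : ∀ {D} → BinExp D → MN D
headAtOne s = proj₁ (headB s) ⊕ scaleMN oneDR (proj₂ (headB s))

headAtOne-eval : ∀ {D} (s : BinExp D) d → 1 ≤ d → ∀ m → valM (headAtOne s) d m ≡ valM (proj₁ (headB s)) d m + valM (proj₂ (headB s)) d m * (1ℚ + toℚ d)
headAtOne-eval s d hd m = cong (valM (proj₁ (headB s)) d m +_)
  (trans (valM-scale oneDR (proj₂ (headB s)) d hd m) (trans (cong (_* valM (proj₂ (headB s)) d m) (oneDR-eval d)) (ℚP.*-comm (1ℚ + toℚ d) (valM (proj₂ (headB s)) d m))))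

-- The leading pair (U₀ - β, β) with β = (U₁ - U₀ - headAtOne s)/d makes (U₀ - β, β) ∷ s take
-- the values U₀ and U₁ at n = 0 and n = 1, since M(0) = M(1) = 1 and M(2) = 1 + d.
leadingβ : ∀ {D} → BinExp D → MN (suc D) → MN (suc D) → MN (suc D)
leadingβ s U0 U1 = scaleMN dInvR ((U1 ⊕ negMN (raise (headAtOne s))) ⊕ negMN U0)

withInitial : ∀ {D} → BinExp D → MN (suc D) → MN (suc D) → BinExp (suc D)
withInitial s U0 U1 = (U0 ⊕ negMN (leadingβ s U0 U1) , leadingβ s U0 U1) ∷b s

leadingβ-eval : ∀ {D} (s : BinExp D) U0 U1 d → 1 ≤ d → ∀ m →
  valM (leadingβ s U0 U1) d m ≡ evalR dInvR d * ((valM U1 d m + (- 1ℚ) * valM (headAtOne s) d m) + (- 1ℚ) * valM U0 d m)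
leadingβ-eval s U0 U1 d hd m =
  trans (valM-scale dInvR ((U1 ⊕ negMN (raise (headAtOne s))) ⊕ negMN U0) d hd m)
        (cong (evalR dInvR d *_) (cong₂ _+_ (cong (valM U1 d m +_) (valM-neg (raise (headAtOne s)) d hd m)) (valM-neg U0 d hd m)))

withInitial-0 : ∀ {D} (s : BinExp D) U0 U1 d → 1 ≤ d → ∀ m → binVal (withInitial s U0 U1) d m 0 ≡ valM U0 d m
withInitial-0 s U0 U1 d hd m =
  trans (binSum-atZero₀ (withInitial s U0 U1) d m 0)
        (trans (cong (λ z → z * 1ℚ + B * 1ℚ) (cong (valM U0 d m +_) (valM-neg (leadingβ s U0 U1) d hd m))) (ring (valM U0 d m) B))
  where
  B = valM (leadingβ s U0 U1) d m
  ring : ∀ u b → (u + (- 1ℚ) * b) * 1ℚ + b * 1ℚ ≡ u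
  ring = solve-∀ R

withInitial-1 : ∀ {D} (s : BinExp D) U0 U1 d → 1 ≤ d → ∀ m → binVal (withInitial s U0 U1) d m 1 ≡ valM U1 d m
withInitial-1 s U0 U1 d hd m = begin
  binSum q d m 1 1 0
    ≡⟨ binSum-pascal₀ q d m 1 0 ⟩
  binSum q d m 1 0 0 + binSum (raiseB s) d m 1 0 0
    ≡⟨ cong₂ _+_ (binSum-atZero₀ q d m 1) (trans (binSum-atZero₀ (raiseB s) d m 1) (cong (λ z → φ z d m 1) (headB-raiseB s))) ⟩
  (valM (U0 ⊕ negMN β) d m * 1ℚ + B * Mℚ d 2) + (HA * 1ℚ + HB * Mℚ d 2)
    ≡⟨ cong₂ (λ u v → (u * 1ℚ + B * v) + (HA * 1ℚ + HB * v)) (cong (U₀ +_) (valM-neg β d hd m)) (Mℚ-2 d) ⟩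
  ((U₀ + (- 1ℚ) * B) * 1ℚ + B * (1ℚ + D)) + (HA * 1ℚ + HB * (1ℚ + D))
    ≡⟨ cong (λ z → ((U₀ + (- 1ℚ) * z) * 1ℚ + z * (1ℚ + D)) + (HA * 1ℚ + HB * (1ℚ + D))) (leadingβ-eval s U0 U1 d hd m) ⟩
  ((U₀ + (- 1ℚ) * (w * Y)) * 1ℚ + (w * Y) * (1ℚ + D)) + (HA * 1ℚ + HB * (1ℚ + D))
    ≡⟨ ring₁ U₀ w Y HA HB D ⟩
  (U₀ + (HA + HB * (1ℚ + D))) + (w * D) * Y
    ≡⟨ cong (λ z → (U₀ + (HA + HB * (1ℚ + D))) + z * Y) (dInvR-inv d hd) ⟩
  (U₀ + (HA + HB * (1ℚ + D))) + 1ℚ * Y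
    ≡⟨ cong (λ z → (U₀ + (HA + HB * (1ℚ + D))) + 1ℚ * ((U₁ + (- 1ℚ) * z) + (- 1ℚ) * U₀)) (headAtOne-eval s d hd m) ⟩
  (U₀ + (HA + HB * (1ℚ + D))) + 1ℚ * ((U₁ + (- 1ℚ) * (HA + HB * (1ℚ + D))) + (- 1ℚ) * U₀)
    ≡⟨ ring₂ U₀ (HA + HB * (1ℚ + D)) U₁ ⟩
  U₁ ∎
  where
  open ≡-Reasoning
  q = withInitial s U0 U1
  β = leadingβ s U0 U1
  B = valM β d m
  U₀ = valM U0 d m
  U₁ = valM U1 d m
  D = toℚ d
  HA = valM (proj₁ (headB s)) d m
  HB = valM (proj₂ (headB s)) d m
  w = evalR dInvR d
  Y = (U₁ + (- 1ℚ) * valM (headAtOne s) d m) + (- 1ℚ) * U₀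
  ring₁ : ∀ u w y a b D → ((u + (- 1ℚ) * (w * y)) * 1ℚ + (w * y) * (1ℚ + D)) + (a * 1ℚ + b * (1ℚ + D)) ≡ (u + (a + b * (1ℚ + D))) + (w * D) * y
  ring₁ = solve-∀ R
  ring₂ : ∀ u x v → (u + x) + 1ℚ * ((v + (- 1ℚ) * x) + (- 1ℚ) * u) ≡ v
  ring₂ = solve-∀ R

-- If g(n+2) = g(n+1) + d·g(n) + h(n) with h expressible of degree D and
-- g(0), g(1) polynomial of degree D+1 in m, then g is expressible of degree D+1: the expansion
-- 'withInitial (solveB r) g(0) g(1)' satisfies the same recurrence and has the same initial values.
solve-recurrence : ∀ D (h g : ℕ → ℕ → ℕ → ℚ) → Expressible D h
  → (∀ d → 1 ≤ d → ∀ m n → g d m (suc (suc n)) ≡ g d m (suc n) + toℚ d * g d m n + h d m n)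
  → PolyInM (suc D) (λ d m → g d m 0) → PolyInM (suc D) (λ d m → g d m 1) → Expressible (suc D) g
solve-recurrence D h g (r , r≡h) g-rec (U0 , U0≡g0) (U1 , U1≡g1) = q , q≡g
  where
  q : BinExp (suc D)
  q = withInitial (solveB r) U0 U1
  q-rec : ∀ d → 1 ≤ d → ∀ m n → binVal q d (toℚ m) (suc (suc n)) ≡ binVal q d (toℚ m) (suc n) + toℚ d * binVal q d (toℚ m) n + h d m n
  q-rec d hd m n = trans (binVal-rec q d (toℚ m) n)
    (cong (binVal q d (toℚ m) (suc n) + toℚ d * binVal q d (toℚ m) n +_)
      (trans (defect-prepend (U0 ⊕ negMN (leadingβ (solveB r) U0 U1) , leadingβ (solveB r) U0 U1) (solveB r) d (toℚ m) n) (trans (solveB-spec r d hd (toℚ m) n n 0) (r≡h d hd m n))))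
  q≡g : ∀ d → 1 ≤ d → ∀ m n → binVal q d (toℚ m) n ≡ g d m n
  q≡g d hd m = recurrence-determined (toℚ d) (h d m) (binVal q d (toℚ m)) (g d m) (q-rec d hd m) (g-rec d hd m)
    (trans (withInitial-0 (solveB r) U0 U1 d hd (toℚ m)) (U0≡g0 d hd m))
    (trans (withInitial-1 (solveB r) U0 U1 d hd (toℚ m)) (U1≡g1 d hd m))

expr-ext : ∀ {D f f'} → (∀ d → 1 ≤ d → ∀ m n → f d m n ≡ f' d m n) → Expressible D f → Expressible D f'
expr-ext e (q , h) = q , (λ d hd m n → trans (h d hd m n) (e d hd m n))

expr-+ : ∀ {D f f'} → Expressible D f → Expressible D f' → Expressible D (λ d m n → f d m n + f' d m n)
expr-+ (q , h) (q' , h') = addB q q' , (λ d hd m n → trans (binSum-addB q q' d (toℚ m) n n 0) (cong₂ _+_ (h d hd m n) (h' d hd m n)))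

expr-scale : ∀ {D f} c → Expressible D f → Expressible D (λ d m n → c * f d m n)
expr-scale c (q , h) = scaleB (constR c) q , (λ d hd m n → trans (binSum-scaleB (constR c) q d hd (toℚ m) n n 0) (cong₂ _*_ (constR-eval c d) (h d hd m n)))

expr-0 : ∀ {D} → Expressible D (λ _ _ _ → 0ℚ)
expr-0 {D} = zeroB , (λ d hd m n → binSum-zeroB {D} d (toℚ m) n n 0)

expr-raise : ∀ {D f} → Expressible D f → Expressible (suc D) f
expr-raise (q , h) = raiseB q , (λ d hd m n → trans (binSum-raiseB q d (toℚ m) n n 0) (h d hd m n))

expr-mono′ : ∀ {D D' f} → D ≤′ D' → Expressible D f → Expressible D' f
expr-mono′ ≤′-refl v = v
expr-mono′ (≤′-step p) v = expr-raise (expr-mono′ p v)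

expr-mono : ∀ {D D' f} → D ≤ D' → Expressible D f → Expressible D' f
expr-mono p v = expr-mono′ (ℕP.≤⇒≤′ p) v

expr-shift : ∀ {D f} → Expressible D f → Expressible D (λ d m n → f d m (suc n))
expr-shift (q , h) = addB (shiftB q) (shiftB (tailB q)) , (λ d hd m n → trans (binSum-addB (shiftB q) (shiftB (tailB q)) d (toℚ m) n n 0)
  (trans (cong₂ _+_ (binSum-shiftB q d hd (toℚ m) n n 0) (binSum-shiftB (tailB q) d hd (toℚ m) n n 0)) (trans (sym (binSum-pascal₀ q d (toℚ m) (suc n) n)) (h d hd m (suc n)))))

expr-sumTo : ∀ {D} N {F : ℕ → ℕ → ℕ → ℕ → ℚ} → (∀ i → i < N → Expressible D (F i)) → Expressible D (λ d m n → sumTo N (λ i → F i d m n))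
expr-sumTo zero h = expr-0
expr-sumTo (suc N) h = expr-+ (expr-sumTo N (λ i i< → h i (ℕP.m<n⇒m<1+n i<))) (h N ℕP.≤-refl)

raiseBⁿ : ∀ {D} k → BinExp D → BinExp (k ℕ.+ D)
raiseBⁿ zero q = q
raiseBⁿ (suc k) q = raiseB (raiseBⁿ k q)

binSum-raiseBⁿ : ∀ {D} k (q : BinExp D) d m t n j → binSum (raiseBⁿ k q) d m t n j ≡ binSum q d m t n j
binSum-raiseBⁿ zero q d m t n j = refl
binSum-raiseBⁿ (suc k) q d m t n j = trans (binSum-raiseB (raiseBⁿ k q) d m t n j) (binSum-raiseBⁿ k q d m t n j)

mulMB : ∀ {e D} → MN e → BinExp D → BinExp (e ℕ.+ D)
mulMB {e} (const r) q = scaleB r (raiseBⁿ e q)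
mulMB (x ⊕ y) q = addB (mulMB x q) (mulMB y q)
mulMB (m· x) q = m·B (mulMB x q)
mulMB (n· x) q = zeroB
mulMB (raise x) q = raiseB (mulMB x q)

binSum-mulMB : ∀ {e D} (x : MN e) (q : BinExp D) d → 1 ≤ d → ∀ m t n j → binSum (mulMB x q) d m t n j ≡ valM x d m * binSum q d m t n j
binSum-mulMB {e} (const r) q d hd m t n j = trans (binSum-scaleB r (raiseBⁿ e q) d hd m t n j) (cong (evalR r d *_) (binSum-raiseBⁿ e q d m t n j))
binSum-mulMB (x ⊕ y) q d hd m t n j = trans (binSum-addB (mulMB x q) (mulMB y q) d m t n j) (trans (cong₂ _+_ (binSum-mulMB x q d hd m t n j) (binSum-mulMB y q d hd m t n j)) (sym (ℚP.*-distribʳ-+ _ (valM x d m) (valM y d m))))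
binSum-mulMB (m· x) q d hd m t n j = trans (binSum-m·B (mulMB x q) d m t n j) (trans (cong (m *_) (binSum-mulMB x q d hd m t n j)) (sym (ℚP.*-assoc m (valM x d m) _)))
binSum-mulMB {suc e} {D} (n· x) q d hd m t n j = trans (binSum-zeroB {suc (e ℕ.+ D)} d m t n j) (sym (trans (cong (_* binSum q d m t n j) (ℚP.*-zeroˡ (valM x d m))) (ℚP.*-zeroˡ (binSum q d m t n j))))
binSum-mulMB (raise x) q d hd m t n j = trans (binSum-raiseB (mulMB x q) d m t n j) (binSum-mulMB x q d hd m t n j)

expr-*polyM : ∀ {e D f g} → PolyInM e g → Expressible D f → Expressible (e ℕ.+ D) (λ d m n → g d m * f d m n)
expr-*polyM (x , hx) (q , h) = mulMB x q , (λ d hd m n → trans (binSum-mulMB x q d hd (toℚ m) n n 0) (cong₂ _*_ (hx d hd m) (h d hd m n)))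

polyM-ext : ∀ {D g g'} → (∀ d → 1 ≤ d → ∀ m → g d m ≡ g' d m) → PolyInM D g → PolyInM D g'
polyM-ext e (x , h) = x , (λ d hd m → trans (h d hd m) (e d hd m))

polyM-+ : ∀ {D g g'} → PolyInM D g → PolyInM D g' → PolyInM D (λ d m → g d m + g' d m)
polyM-+ (x , h) (x' , h') = (x ⊕ x') , (λ d hd m → cong₂ _+_ (h d hd m) (h' d hd m))

polyM-scale : ∀ {D g} c → PolyInM D g → PolyInM D (λ d m → c * g d m)
polyM-scale c (x , h) = scaleℚ c x , (λ d hd m → trans (scaleℚ-eval c x d hd (toℚ m) 0ℚ) (cong (c *_) (h d hd m)))

polyM-m* : ∀ {D g} → PolyInM D g → PolyInM (suc D) (λ d m → toℚ m * g d m)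
polyM-m* (x , h) = m· x , (λ d hd m → cong (toℚ m *_) (h d hd m))

polyM-mono : ∀ {D D' g} → D ≤ D' → PolyInM D g → PolyInM D' g
polyM-mono p (x , h) = raiseTo p x , (λ d hd m → trans (raiseTo-eval p x d (toℚ m) 0ℚ) (h d hd m))

polyM-0 : ∀ {D} → PolyInM D (λ _ _ → 0ℚ)
polyM-0 = zeroMN , (λ d hd m → constR-eval 0ℚ d)

polyM-poly : ∀ {f} → IsPoly f → PolyInM 0 (λ d m → f d)
polyM-poly (p , h) = const (polyR p) , (λ d hd m → trans (polyR-eval p d) (h d))

polyM-sumTo : ∀ {D} N {G : ℕ → ℕ → ℕ → ℚ} → (∀ i → i < N → PolyInM D (G i)) → PolyInM D (λ d m → sumTo N (λ i → G i d m))
polyM-sumTo zero h = polyM-0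
polyM-sumTo (suc N) h = polyM-+ (polyM-sumTo N (λ i i< → h i (ℕP.m<n⇒m<1+n i<))) (h N ℕP.≤-refl)

-- Converting a binomial expansion into an explicit pair of polynomials in m and n:
-- ψ (A , B) n = A(m,n)·M(n) + B(m,n)·M(n+1), with C(n,k) expanded by 'binomMN'.
ψ : ∀ {D} → Comb D → ℕ → ℚ → ℕ → ℚ
ψ (a , b) d m n = ⟦ a ⟧ d m (toℚ n) * Mℚ d n + ⟦ b ⟧ d m (toℚ n) * Mℚ d (suc n)

binomTimes : ∀ {E} k → Comb E → Comb (k ℕ.+ E)
binomTimes k (a , b) = mulMN (binomMN k) (atN0 a) , mulMN (binomMN k) (atN0 b)

ψ-binomTimes : ∀ {E} k (c : Comb E) d → 1 ≤ d → ∀ m n → ψ (binomTimes k c) d m n ≡ binomℚ n k * φ c d m n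
ψ-binomTimes k (a , b) d hd m n = trans (cong₂ (λ u v → u * Mℚ d n + v * Mℚ d (suc n)) (coefficient a) (coefficient b)) (ring (binomℚ n k) (valM a d m) (valM b d m) (Mℚ d n) (Mℚ d (suc n)))
  where
  coefficient : ∀ x → ⟦ mulMN (binomMN k) (atN0 x) ⟧ d m (toℚ n) ≡ binomℚ n k * valM x d m
  coefficient x = trans (mulMN-eval (binomMN k) (atN0 x) d hd m (toℚ n)) (cong₂ _*_ (binomMN-eval k d hd m n) (atN0-eval x d m (toℚ n)))
  ring : ∀ b x y u v → b * x * u + b * y * v ≡ b * (x * u + y * v)
  ring = solve-∀ R

castC : ∀ {a b} → a ≡ b → Comb a → Comb b
castC refl c = c

ψ-castC : ∀ {a b} (p : a ≡ b) (c : Comb a) d m n → ψ (castC p c) d m n ≡ ψ c d m n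
ψ-castC refl c d m n = refl

ψ-addC : ∀ {D} (u v : Comb D) d m n → ψ (addC u v) d m n ≡ ψ u d m n + ψ v d m n
ψ-addC (a , b) (a' , b') d m n = ring (⟦ a ⟧ d m (toℚ n)) (⟦ a' ⟧ d m (toℚ n)) (⟦ b ⟧ d m (toℚ n)) (⟦ b' ⟧ d m (toℚ n)) (Mℚ d n) (Mℚ d (suc n))
  where
  ring : ∀ a a' b b' x y → (a + a') * x + (b + b') * y ≡ (a * x + b * y) + (a' * x + b' * y)
  ring = solve-∀ R

toPair : ∀ {D} → BinExp D → (k : ℕ) → Comb (k ℕ.+ D)
toPair (single c) k = binomTimes k c
toPair {suc D} (c ∷b r) k = addC (binomTimes k c) (castC (sym (ℕP.+-suc k D)) (toPair r (suc k)))

toPair-spec : ∀ {D} (q : BinExp D) k d → 1 ≤ d → ∀ m n → ψ (toPair q k) d m n ≡ binSum q d m n n k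
toPair-spec (single c) k d hd m n = ψ-binomTimes k c d hd m n
toPair-spec {suc D} (c ∷b r) k d hd m n = trans (ψ-addC (binomTimes k c) (castC (sym (ℕP.+-suc k D)) (toPair r (suc k))) d m n) (cong₂ _+_ (ψ-binomTimes k c d hd m n) (trans (ψ-castC (sym (ℕP.+-suc k D)) (toPair r (suc k)) d m n) (toPair-spec r (suc k) d hd m n)))

-- A weight F d m s k assigns a value to (σ, |I|) = (s, k); it is good of degree D if
-- n ↦ niceSum d m (F d m) n is expressible of degree D.
Weight : Set
Weight = ℕ → ℕ → ℕ → ℕ → ℚ

Good : ℕ → Weight → Set
Good D F = Expressible D (λ d m n → niceSum d m (F d m) n)

good-ext : ∀ {D F G} → (∀ d m s k → F d m s k ≡ G d m s k) → Good D F → Good D G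
good-ext e = expr-ext (λ d hd m n → niceSum-cong d m (e d m) n)

good-+ : ∀ {D F G} → Good D F → Good D G → Good D (λ d m s k → F d m s k + G d m s k)
good-+ {D} {F} {G} gF gG = expr-ext (λ d hd m n → sym (niceSum-+ d m (F d m) (G d m) n)) (expr-+ gF gG)

good-scale : ∀ {D F} c → Good D F → Good D (λ d m s k → c * F d m s k)
good-scale {D} {F} c gF = expr-ext (λ d hd m n → sym (niceSum-* d m c (F d m) n)) (expr-scale c gF)

good-*polyM : ∀ {e D F g} → PolyInM e g → Good D F → Good (e ℕ.+ D) (λ d m s k → g d m * F d m s k)
good-*polyM {e} {D} {F} {g} w gF = expr-ext (λ d hd m n → sym (niceSum-* d m (g d m) (F d m) n)) (expr-*polyM w gF)

good-sumTo : ∀ {D} N {F : ℕ → Weight} → (∀ i → i < N → Good D (F i)) → Good D (λ d m s k → sumTo N (λ i → F i d m s k))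
good-sumTo N {F} h = expr-ext (λ d hd m n → sym (niceSum-sumTo d m N (λ i → F i d m) n)) (expr-sumTo N h)

good-mono : ∀ {D D' F} → D ≤ D' → Good D F → Good D' F
good-mono = expr-mono

triangle : ℕ → ℚ
triangle x = sumTo x toℚ

fullColumnWeight-ℚ : ∀ m x → toℚ (fullColumnWeight m x) ≡ toℚ m * triangle x + toℚ x
fullColumnWeight-ℚ m zero = sym (trans (cong (_+ 0ℚ) (ℚP.*-zeroʳ (toℚ m))) (ℚP.+-identityˡ 0ℚ))
fullColumnWeight-ℚ m (suc x) = begin
  toℚ (suc (fullColumnWeight m x ℕ.+ x ℕ.* m)) ≡⟨ toℚ-suc (fullColumnWeight m x ℕ.+ x ℕ.* m) ⟩
  1ℚ + toℚ (fullColumnWeight m x ℕ.+ x ℕ.* m) ≡⟨ cong (1ℚ +_) (trans (toℚ-+ (fullColumnWeight m x) (x ℕ.* m)) (cong₂ _+_ (fullColumnWeight-ℚ m x) (toℚ-* x m))) ⟩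
  1ℚ + ((toℚ m * triangle x + toℚ x) + toℚ x * toℚ m) ≡⟨ ring (toℚ m) (triangle x) (toℚ x) ⟩
  toℚ m * (triangle x + toℚ x) + (1ℚ + toℚ x) ≡⟨ cong (toℚ m * (triangle x + toℚ x) +_) (sym (toℚ-suc x)) ⟩
  toℚ m * triangle (suc x) + toℚ (suc x) ∎
  where
  open ≡-Reasoning
  ring : ∀ m t x → 1ℚ + ((m * t + x) + x * m) ≡ m * (t + x) + (1ℚ + x)
  ring = solve-∀ R

isPoly-triangle : IsPoly triangle
isPoly-triangle = isPoly-sum isPoly-id

isPoly-triangle-suc : IsPoly (λ h → triangle (suc h))
isPoly-triangle-suc = isPoly-+ isPoly-triangle isPoly-id

isPoly-suc : IsPoly (λ h → toℚ (suc h))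
isPoly-suc = isPoly-ext (λ x → sym (toℚ-suc x)) (isPoly-+ (isPoly-const 1ℚ) isPoly-id)

-- The column moments Σ_{h=1}^{d} α_m(h)^e h^f.  Expanding α_m(h)^e binomially shows
-- they are polynomials of degree e in m with coefficients polynomial in d.
columnMoment : ℕ → ℕ → ℕ → ℕ → ℚ
columnMoment e f d m = sumTo d (λ h → toℚ (fullColumnWeight m (suc h)) ^ℚ e * toℚ (suc h) ^ℚ f)

polyM-m^ : ∀ {D g} t → PolyInM D g → PolyInM (t ℕ.+ D) (λ d m → toℚ m ^ℚ t * g d m)
polyM-m^ zero w = polyM-ext (λ d hd m → sym (ℚP.*-identityˡ _)) w
polyM-m^ (suc t) w = polyM-ext (λ d hd m → sym (ℚP.*-assoc (toℚ m) _ _)) (polyM-m* (polyM-m^ t w))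

polyM-columnMoment : ∀ e f → PolyInM e (columnMoment e f)
polyM-columnMoment e f = polyM-ext expand (polyM-sumTo (suc e) (λ t t< → polyM-scale (binomℚ e t) (polyM-mono (degree-bound t t<) (polyM-m^ t (polyM-poly (isPoly-sum (isPoly-* (isPoly-^ isPoly-triangle-suc t) (isPoly-^ isPoly-suc (e ∸ t ℕ.+ f)))))))))
  where
  degree-bound : ∀ t → t < suc e → t ℕ.+ 0 ≤ e
  degree-bound t (s≤s t≤e) = ℕP.≤-trans (ℕP.≤-reflexive (ℕP.+-identityʳ t)) t≤e
  expand : ∀ d → 1 ≤ d → ∀ m → sumTo (suc e) (λ t → binomℚ e t * (toℚ m ^ℚ t * sumTo d (λ h → triangle (suc h) ^ℚ t * toℚ (suc h) ^ℚ (e ∸ t ℕ.+ f)))) ≡ columnMoment e f d m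
  expand d hd m = begin
    sumTo (suc e) (λ t → binomℚ e t * (toℚ m ^ℚ t * sumTo d (λ h → triangle (suc h) ^ℚ t * toℚ (suc h) ^ℚ (e ∸ t ℕ.+ f))))
      ≡⟨ sumTo-cong (suc e) (λ t _ → trans (cong (binomℚ e t *_) (sym (sumTo-*ˡ d (toℚ m ^ℚ t) _))) (sym (sumTo-*ˡ d (binomℚ e t) _))) ⟩
    sumTo (suc e) (λ t → sumTo d (λ h → binomℚ e t * (toℚ m ^ℚ t * (triangle (suc h) ^ℚ t * toℚ (suc h) ^ℚ (e ∸ t ℕ.+ f)))))
      ≡⟨ sumTo-swap (suc e) d _ ⟩
    sumTo d (λ h → sumTo (suc e) (λ t → binomℚ e t * (toℚ m ^ℚ t * (triangle (suc h) ^ℚ t * toℚ (suc h) ^ℚ (e ∸ t ℕ.+ f)))))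
      ≡⟨ sumTo-cong d (λ h _ → column-summand h) ⟩
    columnMoment e f d m ∎
    where
    open ≡-Reasoning
    column-summand : ∀ h → sumTo (suc e) (λ t → binomℚ e t * (toℚ m ^ℚ t * (triangle (suc h) ^ℚ t * toℚ (suc h) ^ℚ (e ∸ t ℕ.+ f)))) ≡ toℚ (fullColumnWeight m (suc h)) ^ℚ e * toℚ (suc h) ^ℚ f
    column-summand h = begin
      sumTo (suc e) (λ t → binomℚ e t * (toℚ m ^ℚ t * (Th ^ℚ t * Hh ^ℚ (e ∸ t ℕ.+ f))))
        ≡⟨ sumTo-cong (suc e) (λ t _ → trans (cong (λ z → binomℚ e t * (toℚ m ^ℚ t * (Th ^ℚ t * z))) (^ℚ-+ Hh (e ∸ t) f)) (ring (binomℚ e t) (toℚ m ^ℚ t) (Th ^ℚ t) (Hh ^ℚ (e ∸ t)) (Hh ^ℚ f)) ) ⟩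
      sumTo (suc e) (λ t → (binomℚ e t * ((toℚ m ^ℚ t * Th ^ℚ t) * Hh ^ℚ (e ∸ t))) * Hh ^ℚ f)
        ≡⟨ sumTo-cong (suc e) (λ t _ → cong (λ z → (binomℚ e t * (z * Hh ^ℚ (e ∸ t))) * Hh ^ℚ f) (sym (*-^ℚ (toℚ m) Th t))) ⟩
      sumTo (suc e) (λ t → (binomℚ e t * ((toℚ m * Th) ^ℚ t * Hh ^ℚ (e ∸ t))) * Hh ^ℚ f)
        ≡⟨ trans (sumTo-cong (suc e) (λ t _ → ℚP.*-comm _ (Hh ^ℚ f))) (sumTo-*ˡ (suc e) (Hh ^ℚ f) _) ⟩
      Hh ^ℚ f * sumTo (suc e) (λ t → binomℚ e t * ((toℚ m * Th) ^ℚ t * Hh ^ℚ (e ∸ t)))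
        ≡⟨ cong (Hh ^ℚ f *_) (sym (binomial-theorem (toℚ m * Th) Hh e)) ⟩
      Hh ^ℚ f * (toℚ m * Th + Hh) ^ℚ e ≡⟨ trans (ℚP.*-comm (Hh ^ℚ f) ((toℚ m * Th + Hh) ^ℚ e)) (cong (λ z → z ^ℚ e * Hh ^ℚ f) (sym (fullColumnWeight-ℚ m (suc h)))) ⟩
      toℚ (fullColumnWeight m (suc h)) ^ℚ e * Hh ^ℚ f ∎
      where
      Th = triangle (suc h)
      Hh = toℚ (suc h)
      ring : ∀ c a b x y → c * (a * (b * (x * y))) ≡ (c * ((a * b) * x)) * y
      ring = solve-∀ R

open +-*-Solver using (_:+_; _:=_) renaming (solve to nsolve)

-- Degree bookkeeping: each lower-order term in the moment recurrence has
-- 2a' + b' < 2a + b.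
deg-binomial : ∀ u i j → u ≤ i → u ℕ.+ u ℕ.+ (i ∸ u ℕ.+ j) ≡ u ℕ.+ i ℕ.+ j
deg-binomial u i j u≤i = trans (ring u u (i ∸ u) j) (cong (λ z → u ℕ.+ z ℕ.+ j) (ℕP.m+[n∸m]≡n u≤i))
  where
  ring : ∀ u v t j → u ℕ.+ v ℕ.+ (t ℕ.+ j) ≡ u ℕ.+ (v ℕ.+ t) ℕ.+ j
  ring = nsolve 4 (λ u v t j → u :+ v :+ (t :+ j) := u :+ (v :+ t) :+ j) refl

deg-lower : ∀ u a b → u < a → u ℕ.+ u ℕ.+ (a ∸ u ℕ.+ b) < a ℕ.+ a ℕ.+ b
deg-lower u a b u<a = subst (_< a ℕ.+ a ℕ.+ b) (sym (deg-binomial u a b (ℕP.<⇒≤ u<a))) (ℕP.+-monoˡ-< b (ℕP.+-monoˡ-< a u<a))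

deg-lower≤ : ∀ u i j → u ≤ i → u ℕ.+ u ℕ.+ (i ∸ u ℕ.+ j) ≤ i ℕ.+ i ℕ.+ j
deg-lower≤ u i j u≤i = subst (_≤ i ℕ.+ i ℕ.+ j) (sym (deg-binomial u i j u≤i)) (ℕP.+-monoˡ-≤ j (ℕP.+-monoˡ-≤ i u≤i))

deg-column : ∀ i j a b → i < a → j ≤ b → a ∸ i ℕ.+ (i ℕ.+ i ℕ.+ j) < a ℕ.+ a ℕ.+ b
deg-column i j a b i<a j≤b = subst (_< a ℕ.+ a ℕ.+ b) (sym regroup) (ℕP.+-mono-<-≤ (ℕP.+-monoʳ-< a i<a) j≤b)
  where
  ring : ∀ t i j → t ℕ.+ (i ℕ.+ i ℕ.+ j) ≡ (t ℕ.+ i) ℕ.+ i ℕ.+ j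
  ring = nsolve 3 (λ t i j → t :+ (i :+ i :+ j) := (t :+ i) :+ i :+ j) refl
  regroup : a ∸ i ℕ.+ (i ℕ.+ i ℕ.+ j) ≡ a ℕ.+ i ℕ.+ j
  regroup = trans (ring (a ∸ i) i j) (cong (λ z → z ℕ.+ i ℕ.+ j) (ℕP.m∸n+n≡m (ℕP.<⇒≤ i<a)))

deg-columnTop : ∀ j a b → j < b → a ∸ a ℕ.+ (a ℕ.+ a ℕ.+ j) < a ℕ.+ a ℕ.+ b
deg-columnTop j a b j<b = subst (λ z → z ℕ.+ (a ℕ.+ a ℕ.+ j) < a ℕ.+ a ℕ.+ b) (sym (ℕP.n∸n≡0 a)) (ℕP.+-monoʳ-< (a ℕ.+ a) j<b)

deg-shifted : ∀ i j a b → i < a → j ≤ b → i ℕ.+ i ℕ.+ j < a ℕ.+ a ℕ.+ b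
deg-shifted i j a b i<a j≤b = ℕP.+-mono-<-≤ (ℕP.+-mono-< i<a i<a) j≤b

deg-shiftedTop : ∀ j a b → j < b → a ℕ.+ a ℕ.+ j < a ℕ.+ a ℕ.+ b
deg-shiftedTop j a b j<b = ℕP.+-monoʳ-< (a ℕ.+ a) j<b

-- The weight s^a k^b; its niceSum is the moment T_{a,b}(n) = G⁺_{d,m,a,b}(n).
monomial : ℕ → ℕ → Weight
monomial a b d m s k = toℚ s ^ℚ a * toℚ k ^ℚ b

-- The weight (s + 2k)^i k^j expands binomially into monomials s^u k^(i-u+j), u ≤ i,
-- each of degree ≤ 2i + j; so it is good once those monomials are.
shifted : ℕ → ℕ → ℚ
shifted s k = toℚ (s ℕ.+ (k ℕ.+ k))

shiftedCoeff : ℕ → ℕ → ℚ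
shiftedCoeff i u = binomℚ i u * two ^ℚ (i ∸ u)

shifted-expand : ∀ i j s k → shifted s k ^ℚ i * toℚ k ^ℚ j ≡ sumTo (suc i) (λ u → shiftedCoeff i u * (toℚ s ^ℚ u * toℚ k ^ℚ (i ∸ u ℕ.+ j)))
shifted-expand i j s k = begin
  shifted s k ^ℚ i * K ^ℚ j ≡⟨ cong (λ z → z ^ℚ i * K ^ℚ j) (trans (toℚ-+ s (k ℕ.+ k)) (cong (Sv +_) (trans (toℚ-+ k k) (ring₂ K)))) ⟩
  (Sv + two * K) ^ℚ i * K ^ℚ j ≡⟨ cong (_* K ^ℚ j) (binomial-theorem Sv (two * K) i) ⟩
  sumTo (suc i) (λ u → binomℚ i u * (Sv ^ℚ u * (two * K) ^ℚ (i ∸ u))) * K ^ℚ j ≡⟨ trans (ℚP.*-comm _ (K ^ℚ j)) (sym (sumTo-*ˡ (suc i) (K ^ℚ j) _)) ⟩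
  sumTo (suc i) (λ u → K ^ℚ j * (binomℚ i u * (Sv ^ℚ u * (two * K) ^ℚ (i ∸ u)))) ≡⟨ sumTo-cong (suc i) (λ u _ → summand u) ⟩
  sumTo (suc i) (λ u → shiftedCoeff i u * (Sv ^ℚ u * K ^ℚ (i ∸ u ℕ.+ j))) ∎
  where
  open ≡-Reasoning
  Sv = toℚ s
  K = toℚ k
  ring₂ : ∀ x → x + x ≡ (1ℚ + 1ℚ) * x
  ring₂ = solve-∀ R
  ring₃ : ∀ kj b su t ki → kj * (b * (su * (t * ki))) ≡ (b * t) * (su * (ki * kj))
  ring₃ = solve-∀ R
  summand : ∀ u → K ^ℚ j * (binomℚ i u * (Sv ^ℚ u * (two * K) ^ℚ (i ∸ u))) ≡ shiftedCoeff i u * (Sv ^ℚ u * K ^ℚ (i ∸ u ℕ.+ j))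
  summand u = trans (cong (λ z → K ^ℚ j * (binomℚ i u * (Sv ^ℚ u * z))) (*-^ℚ two K (i ∸ u)))
             (trans (ring₃ (K ^ℚ j) (binomℚ i u) (Sv ^ℚ u) (two ^ℚ (i ∸ u)) (K ^ℚ (i ∸ u))) (cong (λ z → shiftedCoeff i u * (Sv ^ℚ u * z)) (sym (^ℚ-+ K (i ∸ u) j))))

good-shifted : ∀ i j → (∀ u → u ≤ i → Good (u ℕ.+ u ℕ.+ (i ∸ u ℕ.+ j)) (monomial u (i ∸ u ℕ.+ j))) → Good (i ℕ.+ i ℕ.+ j) (λ d m s k → shifted s k ^ℚ i * toℚ k ^ℚ j)
good-shifted i j ih = good-ext (λ d m s k → sym (shifted-expand i j s k)) (good-sumTo (suc i) {λ u d m s k → shiftedCoeff i u * monomial u (i ∸ u ℕ.+ j) d m s k} (λ u u< → good-mono {F = λ d m s k → shiftedCoeff i u * monomial u (i ∸ u ℕ.+ j) d m s k} (deg-lower≤ u i j (ℕP.≤-pred u<)) (good-scale {F = monomial u (i ∸ u ℕ.+ j)} (shiftedCoeff i u) (ih u (ℕP.≤-pred u<)))))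

-- T_{a,b}(n) and the two weights produced by 'niceSum-suc' applied twice:
-- the first column empty ('stayWeight') or equal to {1..h} ('columnWeightSum').
moment : ℕ → ℕ → ℕ → ℕ → ℕ → ℚ
moment a b d m n = niceSum d m (monomial a b d m) n

-- stayWeight (s, k) = (s+k)^a k^b: first column empty, every cell moves one column right.
stayWeight : ℕ → ℕ → Weight
stayWeight a b d m s k = monomial a b d m (s ℕ.+ k) k

-- columnWeightSum (s, k) = Σ_{h=1}^{d} (α(h) + s + 2k)^a (h + k)^b: first column {1..h}, and
-- then (by niceSum′-suc) an empty second column.
columnWeightSum : ℕ → ℕ → Weight
columnWeightSum a b d m s k = sumTo d (λ h → toℚ (fullColumnWeight m (suc h) ℕ.+ ((s ℕ.+ k) ℕ.+ k)) ^ℚ a * toℚ (suc h ℕ.+ k) ^ℚ b)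

moment-split : ∀ a b d m n → moment a b d m (suc (suc n)) ≡ niceSum d m (stayWeight a b d m) (suc n) + niceSum d m (columnWeightSum a b d m) n
moment-split a b d m n = trans (niceSum-suc d m (monomial a b d m) (suc n)) (cong (niceSum d m (stayWeight a b d m) (suc n) +_)
  (trans (sumTo-cong d (λ h _ → niceSum′-suc d m (λ s k → monomial a b d m (fullColumnWeight m (suc h) ℕ.+ (s ℕ.+ k)) (suc h ℕ.+ k)) n)) (sym (niceSum-sumTo d m d (λ h s k → toℚ (fullColumnWeight m (suc h) ℕ.+ ((s ℕ.+ k) ℕ.+ k)) ^ℚ a * toℚ (suc h ℕ.+ k) ^ℚ b) n))))

moment-zero : ∀ a b d m → moment a b d m 0 ≡ monomial a b d m 0 0
moment-zero a b d m = niceSum-zero d m (monomial a b d m)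

moment-one : ∀ a b d m → moment a b d m 1 ≡ monomial a b d m 0 0 + columnMoment a b d m
moment-one a b d m = trans (niceSum-suc d m (monomial a b d m) 0) (cong₂ _+_ (niceSum-zero d m (λ s k → monomial a b d m (s ℕ.+ k) k)) (sumTo-cong d (λ h _ → trans (niceSum′-zero d m (λ s k → monomial a b d m (fullColumnWeight m (suc h) ℕ.+ (s ℕ.+ k)) (suc h ℕ.+ k))) (cong₂ (λ x y → toℚ x ^ℚ a * toℚ y ^ℚ b) (ℕP.+-identityʳ (fullColumnWeight m (suc h))) (ℕP.+-identityʳ (suc h))))))

-- stayWeight - monomial = (s+k)^a k^b - s^a k^b is a combination of monomials of lower degree.
stayWeight-expand : ∀ a b d m s k → stayWeight a b d m s k - monomial a b d m s k ≡ sumTo a (λ u → binomℚ a u * monomial u (a ∸ u ℕ.+ b) d m s k)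
stayWeight-expand a b d m s k = begin
  toℚ (s ℕ.+ k) ^ℚ a * K ^ℚ b - F ≡⟨ cong (λ z → z ^ℚ a * K ^ℚ b - F) (toℚ-+ s k) ⟩
  (Sv + K) ^ℚ a * K ^ℚ b - F ≡⟨ cong (λ z → z * K ^ℚ b - F) (binomial-theorem Sv K a) ⟩
  (sumTo a g + g a) * K ^ℚ b - F ≡⟨ cong (λ z → (sumTo a g + z) * K ^ℚ b - F) ga ⟩
  (sumTo a g + Sv ^ℚ a) * K ^ℚ b - F ≡⟨ ring (sumTo a g) (Sv ^ℚ a) (K ^ℚ b) ⟩
  sumTo a g * K ^ℚ b ≡⟨ trans (ℚP.*-comm _ (K ^ℚ b)) (sym (sumTo-*ˡ a (K ^ℚ b) g)) ⟩
  sumTo a (λ u → K ^ℚ b * g u) ≡⟨ sumTo-cong a (λ u _ → trans (ring₂ (K ^ℚ b) (binomℚ a u) (Sv ^ℚ u) (K ^ℚ (a ∸ u))) (cong (λ z → binomℚ a u * (Sv ^ℚ u * z)) (sym (^ℚ-+ K (a ∸ u) b)))) ⟩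
  sumTo a (λ u → binomℚ a u * monomial u (a ∸ u ℕ.+ b) d m s k) ∎
  where
  open ≡-Reasoning
  Sv = toℚ s
  K = toℚ k
  F = monomial a b d m s k
  g : ℕ → ℚ
  g u = binomℚ a u * (Sv ^ℚ u * K ^ℚ (a ∸ u))
  ga : g a ≡ Sv ^ℚ a
  ga = trans (cong₂ (λ x y → x * (Sv ^ℚ a * K ^ℚ y)) (binomℚ-diag a) (ℕP.n∸n≡0 a)) (trans (ℚP.*-identityˡ _) (ℚP.*-identityʳ _))
  ring : ∀ x y z → (x + y) * z - y * z ≡ x * z
  ring = solve-∀ R
  ring₂ : ∀ kb c su ka → kb * (c * (su * ka)) ≡ c * (su * (ka * kb))
  ring₂ = solve-∀ R

columnTerm : ℕ → ℕ → ℕ → ℕ → ℕ → ℕ → ℕ → ℕ → ℚ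
columnTerm a b i j d m s k = (binomℚ a i * binomℚ b j) * (columnMoment (a ∸ i) (b ∸ j) d m * (shifted s k ^ℚ i * toℚ k ^ℚ j))

columnSummand-expand : ∀ a b m s k h →
  toℚ (fullColumnWeight m (suc h) ℕ.+ ((s ℕ.+ k) ℕ.+ k)) ^ℚ a * toℚ (suc h ℕ.+ k) ^ℚ b ≡
  sumTo (suc a) (λ i → sumTo (suc b) (λ j →
    (binomℚ a i * binomℚ b j) * ((toℚ (fullColumnWeight m (suc h)) ^ℚ (a ∸ i) * toℚ (suc h) ^ℚ (b ∸ j)) * (shifted s k ^ℚ i * toℚ k ^ℚ j))))
columnSummand-expand a b m s k h = begin
  toℚ (α ℕ.+ ((s ℕ.+ k) ℕ.+ k)) ^ℚ a * toℚ (suc h ℕ.+ k) ^ℚ b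
    ≡⟨ cong₂ (λ u v → u ^ℚ a * v ^ℚ b) X+α (K+H) ⟩
  (X + A) ^ℚ a * (K + H) ^ℚ b
    ≡⟨ cong₂ _*_ (binomial-theorem X A a) (binomial-theorem K H b) ⟩
  sumTo (suc a) (λ i → binomℚ a i * (X ^ℚ i * A ^ℚ (a ∸ i))) * sumTo (suc b) (λ j → binomℚ b j * (K ^ℚ j * H ^ℚ (b ∸ j)))
    ≡⟨ sumTo-product (suc a) (suc b) _ _ ⟩
  sumTo (suc a) (λ i → sumTo (suc b) (λ j → (binomℚ a i * (X ^ℚ i * A ^ℚ (a ∸ i))) * (binomℚ b j * (K ^ℚ j * H ^ℚ (b ∸ j)))))
    ≡⟨ sumTo-cong (suc a) (λ i _ → sumTo-cong (suc b) (λ j _ →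
         ring (binomℚ a i) (binomℚ b j) (X ^ℚ i) (A ^ℚ (a ∸ i)) (K ^ℚ j) (H ^ℚ (b ∸ j)))) ⟩
  sumTo (suc a) (λ i → sumTo (suc b) (λ j → (binomℚ a i * binomℚ b j) * ((A ^ℚ (a ∸ i) * H ^ℚ (b ∸ j)) * (X ^ℚ i * K ^ℚ j)))) ∎
  where
  open ≡-Reasoning
  α = fullColumnWeight m (suc h)
  X = shifted s k
  A = toℚ α
  K = toℚ k
  H = toℚ (suc h)
  X+α : toℚ (α ℕ.+ ((s ℕ.+ k) ℕ.+ k)) ≡ X + A
  X+α = trans (cong toℚ (reorder α s k)) (toℚ-+ (s ℕ.+ (k ℕ.+ k)) α)
    where
    reorder : ∀ x s k → x ℕ.+ ((s ℕ.+ k) ℕ.+ k) ≡ (s ℕ.+ (k ℕ.+ k)) ℕ.+ x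
    reorder = nsolve 3 (λ x s k → x :+ ((s :+ k) :+ k) := (s :+ (k :+ k)) :+ x) refl
  K+H : toℚ (suc h ℕ.+ k) ≡ K + H
  K+H = trans (cong toℚ (ℕP.+-comm (suc h) k)) (toℚ-+ k (suc h))
  ring : ∀ ci cj xi ai kj hj → (ci * (xi * ai)) * (cj * (kj * hj)) ≡ (ci * cj) * ((ai * hj) * (xi * kj))
  ring = solve-∀ R

-- Summing over the column heights h turns the α(h)^(a-i) h^(b-j) into column moments:
-- columnWeightSum = Σ_{i≤a, j≤b} columnTerm i j.
columnWeightSum-columnTerms : ∀ a b d m s k →
  columnWeightSum a b d m s k ≡ sumTo (suc a) (λ i → sumTo (suc b) (λ j → columnTerm a b i j d m s k))
columnWeightSum-columnTerms a b d m s k = begin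
  sumTo d (λ h → toℚ (fullColumnWeight m (suc h) ℕ.+ ((s ℕ.+ k) ℕ.+ k)) ^ℚ a * toℚ (suc h ℕ.+ k) ^ℚ b)
    ≡⟨ sumTo-cong d (λ h _ → columnSummand-expand a b m s k h) ⟩
  sumTo d (λ h → sumTo (suc a) (λ i → sumTo (suc b) (λ j → c i j * (w h i j * x i j))))
    ≡⟨ sumTo-swap d (suc a) _ ⟩
  sumTo (suc a) (λ i → sumTo d (λ h → sumTo (suc b) (λ j → c i j * (w h i j * x i j))))
    ≡⟨ sumTo-cong (suc a) (λ i _ → sumTo-swap d (suc b) _) ⟩
  sumTo (suc a) (λ i → sumTo (suc b) (λ j → sumTo d (λ h → c i j * (w h i j * x i j))))
    ≡⟨ sumTo-cong (suc a) (λ i _ → sumTo-cong (suc b) (λ j _ → pull-out i j)) ⟩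
  sumTo (suc a) (λ i → sumTo (suc b) (λ j → columnTerm a b i j d m s k)) ∎
  where
  open ≡-Reasoning
  c : ℕ → ℕ → ℚ
  c i j = binomℚ a i * binomℚ b j
  w : ℕ → ℕ → ℕ → ℚ
  w h i j = toℚ (fullColumnWeight m (suc h)) ^ℚ (a ∸ i) * toℚ (suc h) ^ℚ (b ∸ j)
  x : ℕ → ℕ → ℚ
  x i j = shifted s k ^ℚ i * toℚ k ^ℚ j
  pull-out : ∀ i j → sumTo d (λ h → c i j * (w h i j * x i j)) ≡ columnTerm a b i j d m s k
  pull-out i j = begin
    sumTo d (λ h → c i j * (w h i j * x i j))     ≡⟨ sumTo-*ˡ d (c i j) _ ⟩
    c i j * sumTo d (λ h → w h i j * x i j)       ≡⟨ cong (c i j *_) (sumTo-cong d (λ h _ → ℚP.*-comm (w h i j) (x i j))) ⟩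
    c i j * sumTo d (λ h → x i j * w h i j)       ≡⟨ cong (c i j *_) (sumTo-*ˡ d (x i j) (λ h → w h i j)) ⟩
    c i j * (x i j * columnMoment (a ∸ i) (b ∸ j) d m) ≡⟨ cong (c i j *_) (ℚP.*-comm (x i j) _) ⟩
    columnTerm a b i j d m s k ∎

columnTerm-top : ∀ a b d m s k →
  columnTerm a b a b d m s k ≡ toℚ d * (sumTo a (λ u → shiftedCoeff a u * monomial u (a ∸ u ℕ.+ b) d m s k) + monomial a b d m s k)
columnTerm-top a b d m s k = begin
  (binomℚ a a * binomℚ b b) * (columnMoment (a ∸ a) (b ∸ b) d m * (X ^ℚ a * K ^ℚ b))
    ≡⟨ cong₂ (λ u v → u * (v * (X ^ℚ a * K ^ℚ b))) (trans (cong₂ _*_ (binomℚ-diag a) (binomℚ-diag b)) (ℚP.*-identityˡ 1ℚ))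
             (cong₂ (λ x y → columnMoment x y d m) (ℕP.n∸n≡0 a) (ℕP.n∸n≡0 b)) ⟩
  1ℚ * (columnMoment 0 0 d m * (X ^ℚ a * K ^ℚ b))
    ≡⟨ trans (ℚP.*-identityˡ _) (cong (_* (X ^ℚ a * K ^ℚ b)) (trans (sumTo-const d (1ℚ * 1ℚ)) (ℚP.*-identityʳ (toℚ d)))) ⟩
  toℚ d * (X ^ℚ a * K ^ℚ b)
    ≡⟨ cong (toℚ d *_) (shifted-expand a b s k) ⟩
  toℚ d * (lower + shiftedCoeff a a * (toℚ s ^ℚ a * K ^ℚ (a ∸ a ℕ.+ b)))
    ≡⟨ cong (λ z → toℚ d * (lower + z)) leading ⟩
  toℚ d * (lower + monomial a b d m s k) ∎
  where
  open ≡-Reasoning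
  X = shifted s k
  K = toℚ k
  lower = sumTo a (λ u → shiftedCoeff a u * monomial u (a ∸ u ℕ.+ b) d m s k)
  leading : shiftedCoeff a a * (toℚ s ^ℚ a * K ^ℚ (a ∸ a ℕ.+ b)) ≡ monomial a b d m s k
  leading = begin
    (binomℚ a a * two ^ℚ (a ∸ a)) * (toℚ s ^ℚ a * K ^ℚ (a ∸ a ℕ.+ b))
      ≡⟨ cong₂ (λ u v → (binomℚ a a * two ^ℚ u) * (toℚ s ^ℚ a * K ^ℚ (v ℕ.+ b))) (ℕP.n∸n≡0 a) (ℕP.n∸n≡0 a) ⟩
    (binomℚ a a * 1ℚ) * (toℚ s ^ℚ a * K ^ℚ b)
      ≡⟨ cong (λ z → (z * 1ℚ) * (toℚ s ^ℚ a * K ^ℚ b)) (binomℚ-diag a) ⟩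
    (1ℚ * 1ℚ) * (toℚ s ^ℚ a * K ^ℚ b)
      ≡⟨ ℚP.*-identityˡ _ ⟩
    toℚ s ^ℚ a * K ^ℚ b ∎

columnWeightSum-expand : ∀ a b d m s k → columnWeightSum a b d m s k - toℚ d * monomial a b d m s k ≡
  (sumTo a (λ i → sumTo (suc b) (λ j → columnTerm a b i j d m s k)) + sumTo b (λ j → columnTerm a b a j d m s k))
  + toℚ d * sumTo a (λ u → shiftedCoeff a u * monomial u (a ∸ u ℕ.+ b) d m s k)
columnWeightSum-expand a b d m s k = begin
  columnWeightSum a b d m s k - toℚ d * F
    ≡⟨ cong (_- toℚ d * F) (columnWeightSum-columnTerms a b d m s k) ⟩
  (P + (Q + columnTerm a b a b d m s k)) - toℚ d * F
    ≡⟨ cong (λ z → (P + (Q + z)) - toℚ d * F) (columnTerm-top a b d m s k) ⟩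
  (P + (Q + toℚ d * (lower + F))) - toℚ d * F
    ≡⟨ ring P Q (toℚ d) lower F ⟩
  (P + Q) + toℚ d * lower ∎
  where
  open ≡-Reasoning
  F = monomial a b d m s k
  P = sumTo a (λ i → sumTo (suc b) (λ j → columnTerm a b i j d m s k))
  Q = sumTo b (λ j → columnTerm a b a j d m s k)
  lower = sumTo a (λ u → shiftedCoeff a u * monomial u (a ∸ u ℕ.+ b) d m s k)
  ring : ∀ p q d a f → (p + (q + d * (a + f))) - d * f ≡ (p + q) + d * a
  ring = solve-∀ R

-- Hence T(n+2) = T(n+1) + d·T(n) + inhomogeneity(n), where the inhomogeneity only involves
-- weights of lower degree.
inhomogeneity : ℕ → ℕ → ℕ → ℕ → ℕ → ℚ
inhomogeneity a b d m n = niceSum d m (λ s k → stayWeight a b d m s k - monomial a b d m s k) (suc n) + niceSum d m (λ s k → columnWeightSum a b d m s k - toℚ d * monomial a b d m s k) n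

moment-rec : ∀ a b d m n → moment a b d m (suc (suc n)) ≡ moment a b d m (suc n) + toℚ d * moment a b d m n + inhomogeneity a b d m n
moment-rec a b d m n = begin
  moment a b d m (suc (suc n)) ≡⟨ moment-split a b d m n ⟩
  niceSum d m (stayWeight a b d m) (suc n) + niceSum d m (columnWeightSum a b d m) n
    ≡⟨ cong₂ _+_ (trans (niceSum-cong d m (λ s k → split (stayWeight a b d m s k) (monomial a b d m s k)) (suc n)) (niceSum-+ d m (monomial a b d m) (λ s k → stayWeight a b d m s k - monomial a b d m s k) (suc n)))
                 (trans (niceSum-cong d m (λ s k → split-scaled (columnWeightSum a b d m s k) (toℚ d) (monomial a b d m s k)) n)
                   (trans (niceSum-+ d m (λ s k → toℚ d * monomial a b d m s k) (λ s k → columnWeightSum a b d m s k - toℚ d * monomial a b d m s k) n)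
                     (cong (_+ niceSum d m (λ s k → columnWeightSum a b d m s k - toℚ d * monomial a b d m s k) n) (niceSum-* d m (toℚ d) (monomial a b d m) n)))) ⟩
  (moment a b d m (suc n) + H1) + (toℚ d * moment a b d m n + H2) ≡⟨ ring (moment a b d m (suc n)) H1 (toℚ d * moment a b d m n) H2 ⟩
  moment a b d m (suc n) + toℚ d * moment a b d m n + inhomogeneity a b d m n ∎
  where
  open ≡-Reasoning
  H1 = niceSum d m (λ s k → stayWeight a b d m s k - monomial a b d m s k) (suc n)
  H2 = niceSum d m (λ s k → columnWeightSum a b d m s k - toℚ d * monomial a b d m s k) n
  split : ∀ x y → x ≡ y + (x - y)
  split = solve-∀ R
  split-scaled : ∀ x c y → x ≡ c * y + (x - c * y)
  split-scaled = solve-∀ R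
  ring : ∀ t h1 u h2 → (t + h1) + (u + h2) ≡ t + u + (h1 + h2)
  ring = solve-∀ R

polyM-d : PolyInM 0 (λ d m → toℚ d)
polyM-d = polyM-poly isPoly-id

-- The induction step: if all monomial weights of degree ≤ N are good, then the moment T_{a,b}
-- with 2a + b = N + 1 is expressible of degree N + 1, by 'solve-recurrence' applied to the
-- moment recurrence, since its inhomogeneity is built from weights of degree ≤ N.
module InductionStep (a b N : ℕ) (deg : a ℕ.+ a ℕ.+ b ≡ suc N)
            (IH : ∀ u v → u ℕ.+ u ℕ.+ v ≤ N → Good (u ℕ.+ u ℕ.+ v) (monomial u v)) where

  below : ∀ {x} → x < a ℕ.+ a ℕ.+ b → x ≤ N
  below {x} p = ℕP.≤-pred (subst (x <_) deg p)

  stayDefect-good : Good N (λ d m s k → stayWeight a b d m s k - monomial a b d m s k)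
  stayDefect-good = good-ext {F = λ d m s k → sumTo a (λ u → binomℚ a u * monomial u (a ∸ u ℕ.+ b) d m s k)} (λ d m s k → sym (stayWeight-expand a b d m s k))
    (good-sumTo a {λ u d m s k → binomℚ a u * monomial u (a ∸ u ℕ.+ b) d m s k} (λ u u< → good-mono {F = λ d m s k → binomℚ a u * monomial u (a ∸ u ℕ.+ b) d m s k} (below (deg-lower u a b u<))
       (good-scale {F = monomial u (a ∸ u ℕ.+ b)} (binomℚ a u) (IH u (a ∸ u ℕ.+ b) (below (deg-lower u a b u<))))))

  shiftedWeight : ℕ → ℕ → Weight
  shiftedWeight i j d m s k = shifted s k ^ℚ i * toℚ k ^ℚ j

  columnTerms-good : Good N (λ d m s k → sumTo a (λ i → sumTo (suc b) (λ j → columnTerm a b i j d m s k)))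
  columnTerms-good = good-sumTo a {λ i d m s k → sumTo (suc b) (λ j → columnTerm a b i j d m s k)} (λ i i< →
          good-sumTo (suc b) {λ j d m s k → columnTerm a b i j d m s k} (λ j j< →
            good-mono {F = λ d m s k → columnTerm a b i j d m s k} (below (deg-column i j a b i< (ℕP.≤-pred j<)))
              (good-scale {F = λ d m s k → columnMoment (a ∸ i) (b ∸ j) d m * shiftedWeight i j d m s k} (binomℚ a i * binomℚ b j)
                (good-*polyM {F = shiftedWeight i j} {g = columnMoment (a ∸ i) (b ∸ j)} (polyM-columnMoment (a ∸ i) (b ∸ j))
                  (good-shifted i j (λ u u≤ → IH u (i ∸ u ℕ.+ j) (ℕP.≤-trans (deg-lower≤ u i j u≤) (below (deg-shifted i j a b i< (ℕP.≤-pred j<))))))))))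

  topColumnTerms-good : Good N (λ d m s k → sumTo b (λ j → columnTerm a b a j d m s k))
  topColumnTerms-good = good-sumTo b {λ j d m s k → columnTerm a b a j d m s k} (λ j j< →
          good-mono {F = λ d m s k → columnTerm a b a j d m s k} (below (deg-columnTop j a b j<))
            (good-scale {F = λ d m s k → columnMoment (a ∸ a) (b ∸ j) d m * shiftedWeight a j d m s k} (binomℚ a a * binomℚ b j)
              (good-*polyM {F = shiftedWeight a j} {g = columnMoment (a ∸ a) (b ∸ j)} (polyM-columnMoment (a ∸ a) (b ∸ j))
                (good-shifted a j (λ u u≤ → IH u (a ∸ u ℕ.+ j) (ℕP.≤-trans (deg-lower≤ u a j u≤) (below (deg-shiftedTop j a b j<))))))))

  lowerShifted : Weight
  lowerShifted d m s k = sumTo a (λ u → shiftedCoeff a u * monomial u (a ∸ u ℕ.+ b) d m s k)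

  lowerShifted-good : Good N (λ d m s k → toℚ d * lowerShifted d m s k)
  lowerShifted-good = good-*polyM {F = lowerShifted} {g = λ d m → toℚ d} polyM-d
          (good-sumTo a {λ u d m s k → shiftedCoeff a u * monomial u (a ∸ u ℕ.+ b) d m s k} (λ u u< → good-mono {F = λ d m s k → shiftedCoeff a u * monomial u (a ∸ u ℕ.+ b) d m s k} (below (deg-lower u a b u<))
             (good-scale {F = monomial u (a ∸ u ℕ.+ b)} (shiftedCoeff a u) (IH u (a ∸ u ℕ.+ b) (below (deg-lower u a b u<))))))

  columnDefect-good : Good N (λ d m s k → columnWeightSum a b d m s k - toℚ d * monomial a b d m s k)
  columnDefect-good = good-ext {F = λ d m s k → (sumTo a (λ i → sumTo (suc b) (λ j → columnTerm a b i j d m s k)) + sumTo b (λ j → columnTerm a b a j d m s k)) + toℚ d * lowerShifted d m s k}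
          (λ d m s k → sym (columnWeightSum-expand a b d m s k))
          (good-+ {F = λ d m s k → sumTo a (λ i → sumTo (suc b) (λ j → columnTerm a b i j d m s k)) + sumTo b (λ j → columnTerm a b a j d m s k)} {G = λ d m s k → toℚ d * lowerShifted d m s k}
            (good-+ {F = λ d m s k → sumTo a (λ i → sumTo (suc b) (λ j → columnTerm a b i j d m s k))} {G = λ d m s k → sumTo b (λ j → columnTerm a b a j d m s k)} columnTerms-good topColumnTerms-good) lowerShifted-good)

  inhomogeneity-expressible : Expressible N (inhomogeneity a b)
  inhomogeneity-expressible = expr-+ (expr-shift stayDefect-good) columnDefect-good

  -- The initial values T(0) and T(1) are polynomials of degree ≤ a ≤ N + 1 in m.
  initial₀ : PolyInM (suc N) (λ d m → moment a b d m 0)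
  initial₀ = polyM-ext (λ d hd m → sym (moment-zero a b d m)) (polyM-mono z≤n (polyM-poly (isPoly-const (toℚ 0 ^ℚ a * toℚ 0 ^ℚ b))))

  initial₁ : PolyInM (suc N) (λ d m → moment a b d m 1)
  initial₁ = polyM-ext (λ d hd m → sym (moment-one a b d m)) (polyM-+ (polyM-mono z≤n (polyM-poly (isPoly-const (toℚ 0 ^ℚ a * toℚ 0 ^ℚ b))))
         (polyM-mono (subst (a ≤_) deg (ℕP.≤-trans (ℕP.m≤m+n a a) (ℕP.m≤m+n (a ℕ.+ a) b))) (polyM-columnMoment a b)))

  moment-expressible : Expressible (suc N) (moment a b)
  moment-expressible = solve-recurrence N (inhomogeneity a b) (moment a b) inhomogeneity-expressible (λ d hd m n → moment-rec a b d m n) initial₀ initial₁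

inhomogeneity00 : ∀ d m n → inhomogeneity 0 0 d m n ≡ 0ℚ
inhomogeneity00 d m n = trans (cong₂ _+_ (vanish (λ s k → stayWeight 0 0 d m s k - monomial 0 0 d m s k) (suc n) stay)
                                         (vanish (λ s k → columnWeightSum 0 0 d m s k - toℚ d * monomial 0 0 d m s k) n column))
                              (ℚP.+-identityˡ 0ℚ)
  where
  vanish : ∀ (F : ℕ → ℕ → ℚ) n → (∀ s k → F s k ≡ 0ℚ * 0ℚ) → niceSum d m F n ≡ 0ℚ
  vanish F n F≡0 = trans (niceSum-cong d m F≡0 n) (trans (niceSum-* d m 0ℚ (λ _ _ → 0ℚ) n) (ℚP.*-zeroˡ (niceSum d m (λ _ _ → 0ℚ) n)))
  stay : ∀ s k → stayWeight 0 0 d m s k - monomial 0 0 d m s k ≡ 0ℚ * 0ℚ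
  stay s k = trans (stayWeight-expand 0 0 d m s k) (sym (ℚP.*-zeroˡ 0ℚ))
  column : ∀ s k → columnWeightSum 0 0 d m s k - toℚ d * monomial 0 0 d m s k ≡ 0ℚ * 0ℚ
  column s k = trans (columnWeightSum-expand 0 0 d m s k) (trans (cong ((0ℚ + 0ℚ) +_) (ℚP.*-zeroʳ (toℚ d))) (sym (ℚP.*-zeroˡ 0ℚ)))

-- Base case: T_{0,0}(n) = M(n+1) (the number of nice subsets), as both satisfy the recurrence
-- of M and agree for n = 0, 1; so s^0 k^0 is good of degree 0.
moment00 : ∀ d m n → moment 0 0 d m n ≡ Mℚ d (suc n)
moment00 d m = recurrence-determined (toℚ d) (λ _ → 0ℚ) (moment 0 0 d m) (λ n → Mℚ d (suc n))
  (λ n → trans (moment-rec 0 0 d m n) (cong (moment 0 0 d m (suc n) + toℚ d * moment 0 0 d m n +_) (inhomogeneity00 d m n)))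
  (λ n → trans (Mℚ-rec d (suc n)) (sym (ℚP.+-identityʳ _)))
  (moment-zero 0 0 d m)
  (trans (moment-one 0 0 d m) (trans (cong (1ℚ +_) (trans (sumTo-const d (1ℚ * 1ℚ)) (ℚP.*-identityʳ (toℚ d)))) (sym (Mℚ-2 d))))

good00 : Good 0 (monomial 0 0)
good00 = single (zeroMN , const (constR 1ℚ)) , λ d hd m n → begin
  binomℚ n 0 * (valM (zeroMN {0}) d (toℚ m) * Mℚ d n + valM (const {0} (constR 1ℚ)) d (toℚ m) * Mℚ d (suc n))
    ≡⟨ ℚP.*-identityˡ _ ⟩
  valM (zeroMN {0}) d (toℚ m) * Mℚ d n + valM (const {0} (constR 1ℚ)) d (toℚ m) * Mℚ d (suc n)
    ≡⟨ cong₂ (λ u v → u * Mℚ d n + v * Mℚ d (suc n)) (constR-eval 0ℚ d) (constR-eval 1ℚ d) ⟩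
  0ℚ * Mℚ d n + 1ℚ * Mℚ d (suc n)
    ≡⟨ ring (Mℚ d n) (Mℚ d (suc n)) ⟩
  Mℚ d (suc n)
    ≡⟨ moment00 d m n ⟨
  moment 0 0 d m n ∎
  where
  open ≡-Reasoning
  ring : ∀ x y → 0ℚ * x + 1ℚ * y ≡ y
  ring = solve-∀ R

moments-good : ∀ N a b → a ℕ.+ a ℕ.+ b ≤ N → Good (a ℕ.+ a ℕ.+ b) (monomial a b)
moments-good zero zero zero p = good00
moments-good zero zero (suc b) ()
moments-good zero (suc a) b ()
moments-good (suc N) a b p with ℕP.m≤n⇒m<n∨m≡n p
... | inj₁ lt = moments-good N a b (ℕP.≤-pred lt)
... | inj₂ eq = subst (λ z → Good z (monomial a b)) (sym eq) (InductionStep.moment-expressible a b N eq (λ u v q → moments-good N u v q))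

moment-good : ∀ a b → Good (2 ℕ.* a ℕ.+ b) (monomial a b)
moment-good a b = good-mono {F = monomial a b} (ℕP.≤-reflexive (cong (λ z → a ℕ.+ z ℕ.+ b) (sym (ℕP.+-identityʳ a))))
                            (moments-good (a ℕ.+ a ℕ.+ b) a b ℕP.≤-refl)

expressible⇒explicit : ∀ {D f} → Expressible D f →
  Σ (MN D) λ A → Σ (MN D) λ B → ∀ d → 1 ≤ d → ∀ m n →
    f d m n ≡ ⟦ A ⟧ d (toℚ m) (toℚ n) * Mℚ d n + ⟦ B ⟧ d (toℚ m) (toℚ n) * Mℚ d (suc n)
expressible⇒explicit (q , q≡f) = proj₁ (toPair q 0) , proj₂ (toPair q 0) ,
  λ d hd m n → trans (sym (q≡f d hd m n)) (sym (toPair-spec q 0 d hd (toℚ m) n))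

theorem4p4 : (a b : ℕ) →
  Σ (ℕ → ℕ → RatFun) λ A → Σ (ℕ → ℕ → RatFun) λ B →
    ((k l d : ℕ) → 1 ≤ d →
       (evalPoly (den (A k l)) (toℚ d) ≢ 0ℚ) × (evalPoly (den (B k l)) (toℚ d) ≢ 0ℚ)) ×
    ((d m n : ℕ) → 1 ≤ d →
       toℚ (G+ d m a b n) ≡
         evalPoly2 (2 ℕ.* a ℕ.+ b) A (toℚ m) (toℚ n) (toℚ d) * toℚ (M d n)
         + evalPoly2 (2 ℕ.* a ℕ.+ b) B (toℚ m) (toℚ n) (toℚ d) * toℚ (M d (1 ℕ.+ n)))
theorem4p4 a b = (λ k l → proj₁ (coeffs A k l)) , (λ k l → proj₁ (coeffs B k l)) ,
  (λ k l d hd → proj₂ (coeffs A k l) d hd , proj₂ (coeffs B k l) d hd) , G+≡explicit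
  where
  explicit = expressible⇒explicit (moment-good a b)
  A B : MN (2 ℕ.* a ℕ.+ b)
  A = proj₁ explicit
  B = proj₁ (proj₂ explicit)
  G+≡explicit : ∀ d m n → 1 ≤ d → toℚ (G+ d m a b n) ≡
    evalPoly2 (2 ℕ.* a ℕ.+ b) (λ k l → proj₁ (coeffs A k l)) (toℚ m) (toℚ n) (toℚ d) * Mℚ d n
    + evalPoly2 (2 ℕ.* a ℕ.+ b) (λ k l → proj₁ (coeffs B k l)) (toℚ m) (toℚ n) (toℚ d) * Mℚ d (suc n)
  G+≡explicit d m n hd = begin
    toℚ (G+ d m a b n)                                              ≡⟨ G+-niceSum d m a b n ⟩
    moment a b d m n                                                ≡⟨ proj₂ (proj₂ explicit) d hd m n ⟩
    ⟦ A ⟧ d (toℚ m) (toℚ n) * Mℚ d n + ⟦ B ⟧ d (toℚ m) (toℚ n) * Mℚ d (suc n)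
      ≡⟨ cong₂ (λ x y → x * Mℚ d n + y * Mℚ d (suc n)) (evalPoly2-coeffs A d hd (toℚ m) (toℚ n)) (evalPoly2-coeffs B d hd (toℚ m) (toℚ n)) ⟨
    _ ∎
    where open ≡-Reasoning
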